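{- There exists a randomized algorithm that runs in subexponential time (that is, in time $2^{o(n)}$) and that, for every satisfiable 4-CNF formula $F$ on $n$ variables, finds a satisfying assignment of $F$ with probability $\Omega\left(1.46928^{ -n}\right)$.
   Context: A literal is a propositional variable $x$ or its complement $\bar x$. A clause is a finite set of literals over pairwise distinct variables; a CNF formula is a finite set of clauses. A 4-CNF formula is a CNF formula in which every clause has at most 4 literals. $n$ is the number of variables occurring in the input formula. An assignment of truth values $0,1$ to the variables satisfies $F$ if every clause of $F$ contains a literal $x$ with $x$ assigned $1$ or a literal $\bar x$ with $x$ assigned $0$; $F$ is satisfiable if such an assignment exists. Probabilities are over the algorithm's internal randomness, and the constant hidden in $\Omega$ and the $o(n)$ term are uniform over all inputs $F$. -}

module Defs where

open import Data.Bool using (Bool; true; false; if_then_else_)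
open import Data.Fin using (Fin; zero; suc)
import Data.Bool.Properties as Bool
open import Data.Integer using (+_)
open import Data.List using (List; []; _∷_; length; map; foldr)
open import Data.List.Relation.Unary.All using (All; all?)
open import Data.List.Relation.Unary.AllPairs using (AllPairs)
open import Data.List.Relation.Unary.Any using (Any; any?)
open import Data.List.Relation.Binary.Permutation.Propositional using (_↭_)
open import Data.Nat using (ℕ; zero; suc; _+_; _*_; _^_; _≤_)
open import Data.Nat.Properties using (m^n≢0)
open import Data.Product using (_×_; _,_; ∃-syntax)
open import Data.Rational using (ℚ; _/_)
open import Data.Vec using (Vec; []; _∷_; lookup; replicate; _[_]≔_; foldl)
open import Function using (_∘_; _on_)
open import Relation.Binary.PropositionalEquality using (_≡_; _≢_)
open import Relation.Nullary using (¬_; does)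
open import Relation.Unary using (Pred; Decidable)
open import Level using (0ℓ)

data Literal (n : ℕ) : Set where
  pos neg : Fin n → Literal n

var : ∀ {n} → Literal n → Fin n
var (pos x) = x
var (neg x) = x

Clause : ℕ → Set
Clause n = List (Literal n)

-- Finite sets are given by repetition-free lists in an arbitrary order; two
-- such lists are the same set exactly when they are permutations of each
-- other.  Without `distinct` the length of the input would not be bounded
-- in terms of n.  By `occurs`, n is the number of variables occurring.
record CNF (n : ℕ) : Set where
  field
    clauses      : List (Clause n)
    distinctVars : All (AllPairs (_≢_ on var)) clauses
    distinct     : AllPairs (λ C D → ¬ (C ↭ D)) clauses
    occurs       : ∀ x → Any (Any (λ l → var l ≡ x)) clauses

open CNF public

Is_-CNF : ∀ {n} → ℕ → CNF n → Set
Is k -CNF F = All (λ C → length C ≤ k) (clauses F)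

Assignment : ℕ → Set
Assignment n = Vec Bool n

_⊨ˡ_ : ∀ {n} → Assignment n → Literal n → Set
a ⊨ˡ pos x = lookup a x ≡ true
a ⊨ˡ neg x = lookup a x ≡ false

_⊨_ : ∀ {n} → Assignment n → CNF n → Set
a ⊨ F = All (Any (a ⊨ˡ_)) (clauses F)

Satisfiable : ∀ {n} → CNF n → Set
Satisfiable F = ∃[ a ] a ⊨ F

_⊨ˡ?_ : ∀ {n} (a : Assignment n) → Decidable (a ⊨ˡ_)
a ⊨ˡ? pos x = lookup a x Bool.≟ true
a ⊨ˡ? neg x = lookup a x Bool.≟ false

_⊨?_ : ∀ {n} (a : Assignment n) → Decidable (a ⊨_)
a ⊨? F = all? (any? (a ⊨ˡ?_)) (clauses F)

-- Randomized algorithms are programs of the WHILE language of N. D. Jones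
-- ("Computability and Complexity from a Programming Perspective", 1997)
-- extended by a fair coin.  Data are binary trees; `nil` is false and every
-- other tree is true.
data Tree : Set where
  nil  : Tree
  cons : Tree → Tree → Tree

data Expr (k : ℕ) : Set where
  `_    : Fin k → Expr k
  nil   : Expr k
  cons  : Expr k → Expr k → Expr k
  hd tl : Expr k → Expr k

infix  6 _≔_
infixr 5 _⨾_

data Cmd (k : ℕ) : Set where
  _≔_   : Fin k → Expr k → Cmd k
  flip  : Fin k → Cmd k
  _⨾_   : Cmd k → Cmd k → Cmd k
  ifte  : Expr k → Cmd k → Cmd k → Cmd k
  while : Expr k → Cmd k → Cmd k

-- A program has 1 + aux variables; variable zero holds the input at the
-- start and the output at the end, the other variables start as nil.
record Program : Set where
  field
    aux  : ℕ
    body : Cmd (suc aux)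

open Program public

Store : ℕ → Set
Store k = Vec Tree k

hdᵗ tlᵗ : Tree → Tree
hdᵗ nil        = nil
hdᵗ (cons s t) = s
tlᵗ nil        = nil
tlᵗ (cons s t) = t

⟦_⟧ : ∀ {k} → Expr k → Store k → Tree
⟦ ` x ⟧      σ = lookup σ x
⟦ nil ⟧      σ = nil
⟦ cons d e ⟧ σ = cons (⟦ d ⟧ σ) (⟦ e ⟧ σ)
⟦ hd e ⟧     σ = hdᵗ (⟦ e ⟧ σ)
⟦ tl e ⟧     σ = tlᵗ (⟦ e ⟧ σ)

isTrue : Tree → Bool
isTrue nil        = false
isTrue (cons _ _) = true

bit : Bool → Tree
bit false = nil
bit true  = cons nil nil

-- The commands still to be executed, and the store.
Config : ℕ → Set
Config k = List (Cmd k) × Store k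

-- One unit of time.  With trees represented by pointers to shared nodes a
-- step takes time bounded by the size of the expression evaluated, hence by
-- a constant for a fixed program; so the time measured here is polynomially
-- related to that of probabilistic Turing machines.  A fresh fair bit is
-- supplied at every step and ignored by all commands other than `flip`.
step : ∀ {k} → Config k → Bool → Config k
step ([]             , σ) b = [] , σ
step ((x ≔ e)    ∷ κ , σ) b = κ , σ [ x ]≔ ⟦ e ⟧ σ
step (flip x     ∷ κ , σ) b = κ , σ [ x ]≔ bit b
step ((c ⨾ d)    ∷ κ , σ) b = c ∷ d ∷ κ , σ
step (ifte e c d ∷ κ , σ) b = (if isTrue (⟦ e ⟧ σ) then c else d) ∷ κ , σ
step (while e c  ∷ κ , σ) b = (if isTrue (⟦ e ⟧ σ) then c ∷ while e c ∷ κ else κ) , σ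

-- The configuration after T steps on the given input, using the coins ω.
run : ∀ {T} (P : Program) → Tree → Vec Bool T → Config (suc (aux P))
run P input ω =
  foldl (λ _ → Config (suc (aux P))) step (body P ∷ [] , input ∷ replicate (aux P) nil) ω

Halted : ∀ {k} → Config k → Set
Halted (κ , _) = κ ≡ []

output : ∀ {k} → Config (suc k) → Tree
output (_ , σ) = lookup σ zero

list : List Tree → Tree
list = foldr cons nil

unary : ∀ {n} → Fin n → Tree
unary zero    = nil
unary (suc x) = cons nil (unary x)

⌜_⌝ˡ : ∀ {n} → Literal n → Tree
⌜ pos x ⌝ˡ = cons (bit true)  (unary x)
⌜ neg x ⌝ˡ = cons (bit false) (unary x)

⌜_⌝ : ∀ {n} → CNF n → Tree
⌜ F ⌝ = list (map (list ∘ map ⌜_⌝ˡ) (clauses F))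

-- The i-th entry of the output list is the value of variable i; missing
-- entries are read as false.
assignment : ∀ n → Tree → Assignment n
assignment zero    t = []
assignment (suc n) t = isTrue (hdᵗ t) ∷ assignment n (tlᵗ t)

count : ∀ {T} {E : Pred (Vec Bool T) 0ℓ} → Decidable E → ℕ
count {zero}  E? = if does (E? []) then 1 else 0
count {suc T} E? = count (λ ω → E? (false ∷ ω)) + count (λ ω → E? (true ∷ ω))

-- The probability of an event under T independent fair coins.
Pr : ∀ {T} {E : Pred (Vec Bool T) 0ℓ} → Decidable E → ℚ
Pr {T} E? = (+ count E? / 2 ^ T) {{m^n≢0 2 T}}

-- f(n) = o(n)
Sublinear : (ℕ → ℕ) → Set
Sublinear f = ∀ k → ∃[ N ] (∀ n → N ≤ n → k * f n ≤ n)

RunsInTime : Program → (∀ {n} → CNF n → Set) → (ℕ → ℕ) → Set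
RunsInTime P Admissible t =
  ∀ {n} (F : CNF n) → Admissible F → (ω : Vec Bool (t n)) → Halted (run P ⌜ F ⌝ ω)

-- The probability that the assignment output by P after T steps satisfies F.
-- If P always halts within T steps, this does not depend on T.
successProbability : ∀ {n} → Program → CNF n → (T : ℕ) → ℚ
successProbability {n} P F T =
  Pr {T} (λ ω → assignment n (output (run P ⌜ F ⌝ ω)) ⊨? F)

-- The algorithm is PPSZ.  In each of R rounds every unassigned variable is
-- picked with probability ρ = 2^-b; a picked variable gets the value forced by
-- a refutation of depth d of the other value, and a random value if there is
-- none.  A frozen variable (one with the same value in all solutions) is forced
-- once the picked variables cut its critical clause tree.  When the others have
-- been picked with probability r, Harris' inequality bounds the probability of
-- a cut below by Q_d(r), where Q_0 = 0 and Q_{k+1} = (r + (1-r) Q_k)^3, and a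
-- Riemann sum over r shows that a frozen variable is guessed with probability
-- less than 0.5551 < log₂ 1.46928.
--
-- Formulas with several solutions are treated as by Hertli (2011), by comparison
-- with a process that picks variables together with a value that preserves
-- satisfiability.  It picks liquid (not frozen) variables at twice the rate, and
-- the resulting factor 1 + ρ pays for guessing them, since the potential of a
-- liquid variable is at least ½.  Chords of t ↦ 2^-t between integers replace
-- Jensen's inequality, so that all quantities are rational.

module Submission where

open import Defs
open import Data.Bool using (Bool; true; false; if_then_else_; _∧_; _∨_; not)
import Data.Bool.Properties as Bool
open import Data.Fin using (Fin; zero; suc; toℕ; #_)
import Data.Fin.Properties as Fin
import Data.Integer as ℤ
import Data.Integer.Properties as ℤₚ
import Data.Integer.Tactic.RingSolver as ℤ-Solver
open import Data.List using (List; []; _∷_; _++_; length; map; allFin; tabulate; cartesianProductWith)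
open import Data.List.Membership.Propositional using (_∈_; _∉_)
open import Data.List.Membership.Propositional.Properties using (∈-allFin; ∈-map⁺; ∈-++⁺ˡ; ∈-++⁺ʳ; ∈-++⁻; ∈-∃++; ∈-cartesianProductWith⁺)
open import Data.List.Relation.Unary.All using (All; []; _∷_; all?)
import Data.List.Relation.Unary.All as All
open import Data.List.Properties using (++-identityʳ; length-++; length-map; length-tabulate)
open import Data.List.Relation.Unary.All.Properties using (¬Any⇒All¬; ¬All⇒Any¬)
open import Data.List.Relation.Unary.AllPairs using (AllPairs; []; _∷_)
open import Data.List.Relation.Unary.Any using (Any; here; there; any?)
import Data.List.Relation.Unary.Any as Any
import Data.List.Relation.Unary.AllPairs as AllPairs
open import Data.List.Relation.Binary.Permutation.Propositional using (↭-reflexive)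
open import Data.Maybe using (Maybe; just; nothing)
import Data.Maybe.Properties as Maybe
open import Data.Nat using (ℕ; zero; suc; _^_; z≤n; s≤s)
import Data.Nat as ℕ
import Data.Nat.DivMod as ℕ using (m/n*n≤m; m≡m%n+[m/n]*n; m%n<n; _%_)
import Data.Nat.Properties as ℕₚ
import Data.Nat.Tactic.RingSolver as ℕ-Solver
open import Data.Product using (_×_; _,_; proj₁; proj₂; ∃-syntax; Σ-syntax)
open import Data.Rational using (ℚ; 0ℚ; 1ℚ; ½; _/_; _+_; _-_; _*_; -_; _≤_; _<_; +-*-rawSemiring)
import Data.Rational as ℚ
import Data.Rational.Properties as ℚₚ
import Data.Rational.Unnormalised as ℚᵘ
import Data.Rational.Unnormalised.Properties as ℚᵘₚ
open import Data.Sum using (_⊎_; inj₁; inj₂)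
open import Data.Unit using (⊤; tt)
open import Data.Vec using (Vec; []; _∷_; lookup; replicate; _[_]≔_)
import Data.Vec as Vec
import Data.Vec.Properties as Vecₚ
open import Function using (_∘_; id; case_of_)
open import Level using (0ℓ)
open import Relation.Binary.PropositionalEquality
  using (_≡_; _≢_; refl; sym; trans; cong; cong₂; subst; subst₂; module ≡-Reasoning)
open import Relation.Nullary using (¬_; Dec; yes; no; does; contradiction)
open import Relation.Nullary.Decidable using (dec⇒maybe; map′; _×-dec_)
open import Tactic.RingSolver using (solve-∀)
import Tactic.RingSolver.Core.AlmostCommutativeRing as ACR using (AlmostCommutativeRing; fromCommutativeRing)
open import Algebra.Definitions.RawSemiring +-*-rawSemiring using () renaming (_^_ to _^ℚ_)

-- With several solutions, a variable both of whose values survive has no critical clause tree, and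
-- which variables are frozen depends on the choices made so far. Hence the induction runs over the
-- remaining events with an arbitrary partial assignment, on a potential summed over the variables
-- and averaged over the final assignment of the comparison process; a coin costs one unit of it,
-- because it halves the success probability. The averages can be combined because setting a
-- variable as in α can only raise the law of α and only lower the cost of any other frozen
-- variable: oppositely ordered quantities obey a Chebyshev inequality in the direction required. A
-- variable can freeze in the middle of a round, so its cost must be bounded in terms of the number
-- of its remaining events alone: the probability r restarts from 0 there, and a slack of ρ in σ
-- pays for the interrupted round. As the limit 0.55482 of the exponent lies strictly below log₂
-- 1.46928, the depth, ρ and R can be constants, so that the running time is even polynomial.

ℚ-ring : ACR.AlmostCommutativeRing 0ℓ 0ℓ
ℚ-ring = ACR.fromCommutativeRing ℚₚ.+-*-commutativeRing (λ x → dec⇒maybe (0ℚ ℚₚ.≟ x))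

-- Ordered-field arithmetic

-- Reduces an inequality to a ring identity with an explicit nonnegative remainder `e`; most
-- estimates below are stated through such a remainder.
≤-by : ∀ {a b e} → 0ℚ ≤ e → b ≡ a + e → a ≤ b
≤-by {a} {b} {e} 0≤e eq = begin
  a  ≡⟨ sym (ℚₚ.+-identityʳ a) ⟩
  a + 0ℚ  ≤⟨ ℚₚ.+-monoʳ-≤ a 0≤e ⟩
  a + e  ≡⟨ sym eq ⟩
  b  ∎
  where open ℚₚ.≤-Reasoning

x+[y-x]≡y : ∀ x y → y ≡ x + (y - x)
x+[y-x]≡y = solve-∀ ℚ-ring

p≤q⇒0≤q-p : ∀ {a b} → a ≤ b → 0ℚ ≤ b - a
p≤q⇒0≤q-p {a} {b} a≤b = begin
  0ℚ  ≡⟨ sym (ℚₚ.+-inverseʳ a) ⟩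
  a - a  ≤⟨ ℚₚ.+-monoˡ-≤ (- a) a≤b ⟩
  b - a  ∎
  where open ℚₚ.≤-Reasoning

0≤+ : ∀ {a b} → 0ℚ ≤ a → 0ℚ ≤ b → 0ℚ ≤ a + b
0≤+ = ℚₚ.+-mono-≤

0≤* : ∀ {a b} → 0ℚ ≤ a → 0ℚ ≤ b → 0ℚ ≤ a * b
0≤* {a} {b} 0≤a 0≤b = begin
  0ℚ  ≡⟨ sym (ℚₚ.*-zeroʳ a) ⟩
  a * 0ℚ  ≤⟨ ℚₚ.*-monoˡ-≤-nonNeg a {{ℚ.nonNegative 0≤a}} 0≤b ⟩
  a * b  ∎
  where open ℚₚ.≤-Reasoning

*-monoʳ : ∀ {a b c} → 0ℚ ≤ a → b ≤ c → a * b ≤ a * c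
*-monoʳ {a} 0≤a b≤c = ℚₚ.*-monoˡ-≤-nonNeg a {{ℚ.nonNegative 0≤a}} b≤c

*-monoˡ : ∀ {a b c} → 0ℚ ≤ a → b ≤ c → b * a ≤ c * a
*-monoˡ {a} 0≤a b≤c = ℚₚ.*-monoʳ-≤-nonNeg a {{ℚ.nonNegative 0≤a}} b≤c

*-mono : ∀ {a b c d} → 0ℚ ≤ a → 0ℚ ≤ d → a ≤ b → c ≤ d → a * c ≤ b * d
*-mono 0≤a 0≤d a≤b c≤d = ℚₚ.≤-trans (*-monoʳ 0≤a c≤d) (*-monoˡ 0≤d a≤b)

0≤1 : 0ℚ ≤ 1ℚ
0≤1 = ℚ.*≤* (ℤ.+≤+ z≤n)

0≤½ : 0ℚ ≤ ½
0≤½ = ℚ.*≤* (ℤ.+≤+ z≤n)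

mix : ℚ → ℚ → ℚ → ℚ
mix r x y = r * x + (1ℚ - r) * y

mix-mono : ∀ {r x x′ y y′} → 0ℚ ≤ r → r ≤ 1ℚ → x ≤ x′ → y ≤ y′ → mix r x y ≤ mix r x′ y′
mix-mono 0≤r r≤1 x≤x′ y≤y′ = ℚₚ.+-mono-≤ (*-monoʳ 0≤r x≤x′) (*-monoʳ (p≤q⇒0≤q-p r≤1) y≤y′)

mix-const : ∀ r x → mix r x x ≡ x
mix-const r x = lemma r x
  where
  lemma : ∀ r x → r * x + (1ℚ - r) * x ≡ x
  lemma = solve-∀ ℚ-ring

0≤mix : ∀ {r x y} → 0ℚ ≤ r → r ≤ 1ℚ → 0ℚ ≤ x → 0ℚ ≤ y → 0ℚ ≤ mix r x y
0≤mix {r} 0≤r r≤1 0≤x 0≤y = 0≤+ (0≤* 0≤r 0≤x) (0≤* (p≤q⇒0≤q-p r≤1) 0≤y)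

-- The difference of the two sides is the covariance of a two-point distribution,
-- `r (1 - r) (x - x′) (y - y′)`.
chebyshev : ∀ {r x x′ y y′} → 0ℚ ≤ r → r ≤ 1ℚ → 0ℚ ≤ (x - x′) * (y - y′) →
            mix r x x′ * mix r y y′ ≤ mix r (x * y) (x′ * y′)
chebyshev {r} {x} {x′} {y} {y′} 0≤r r≤1 h =
  ≤-by (0≤* (0≤* 0≤r (p≤q⇒0≤q-p r≤1)) h) (lemma r x x′ y y′)
  where
  lemma : ∀ r x x′ y y′ →
          r * (x * y) + (1ℚ - r) * (x′ * y′) ≡
          (r * x + (1ℚ - r) * x′) * (r * y + (1ℚ - r) * y′) + r * (1ℚ - r) * ((x - x′) * (y - y′))
  lemma = solve-∀ ℚ-ring

chebyshev′ : ∀ {r x x′ y y′} → 0ℚ ≤ r → r ≤ 1ℚ → 0ℚ ≤ (x - x′) * (y′ - y) →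
             mix r (x * y) (x′ * y′) ≤ mix r x x′ * mix r y y′
chebyshev′ {r} {x} {x′} {y} {y′} 0≤r r≤1 h =
  ≤-by (0≤* (0≤* 0≤r (p≤q⇒0≤q-p r≤1)) h) (lemma r x x′ y y′)
  where
  lemma : ∀ r x x′ y y′ →
          (r * x + (1ℚ - r) * x′) * (r * y + (1ℚ - r) * y′) ≡
          r * (x * y) + (1ℚ - r) * (x′ * y′) + r * (1ℚ - r) * ((x - x′) * (y′ - y))
  lemma = solve-∀ ℚ-ring

indicator : Bool → ℚ
indicator b = if b then 1ℚ else 0ℚ

0≤indicator : ∀ b → 0ℚ ≤ indicator b
0≤indicator false = ℚₚ.≤-refl
0≤indicator true  = 0≤1

-- Finite sums

∑ : ∀ {A : Set} → List A → (A → ℚ) → ℚ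
∑ []       f = 0ℚ
∑ (x ∷ xs) f = f x + ∑ xs f

module _ {A : Set} where

  ∑-cong : ∀ (xs : List A) {f g} → (∀ x → f x ≡ g x) → ∑ xs f ≡ ∑ xs g
  ∑-cong []       eq = refl
  ∑-cong (x ∷ xs) eq = cong₂ _+_ (eq x) (∑-cong xs eq)

  ∑-mono : ∀ (xs : List A) {f g} → (∀ x → f x ≤ g x) → ∑ xs f ≤ ∑ xs g
  ∑-mono []       le = ℚₚ.≤-refl
  ∑-mono (x ∷ xs) le = ℚₚ.+-mono-≤ (le x) (∑-mono xs le)

  ∑-zero : ∀ (xs : List A) → ∑ xs (λ _ → 0ℚ) ≡ 0ℚ
  ∑-zero []       = refl
  ∑-zero (x ∷ xs) = trans (ℚₚ.+-identityˡ _) (∑-zero xs)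

  0≤∑ : ∀ (xs : List A) {f} → (∀ x → 0ℚ ≤ f x) → 0ℚ ≤ ∑ xs f
  0≤∑ []       h = ℚₚ.≤-refl
  0≤∑ (x ∷ xs) h = 0≤+ (h x) (0≤∑ xs h)

  ∑-+ : ∀ (xs : List A) f g → ∑ xs (λ x → f x + g x) ≡ ∑ xs f + ∑ xs g
  ∑-+ []       f g = refl
  ∑-+ (x ∷ xs) f g = trans (cong ((f x + g x) +_) (∑-+ xs f g)) (lemma (f x) (g x) (∑ xs f) (∑ xs g))
    where
    lemma : ∀ a b c d → a + b + (c + d) ≡ a + c + (b + d)
    lemma = solve-∀ ℚ-ring

  ∑-*ˡ : ∀ (xs : List A) c f → ∑ xs (λ x → c * f x) ≡ c * ∑ xs f
  ∑-*ˡ []       c f = sym (ℚₚ.*-zeroʳ c)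
  ∑-*ˡ (x ∷ xs) c f = trans (cong (c * f x +_) (∑-*ˡ xs c f)) (sym (ℚₚ.*-distribˡ-+ c (f x) (∑ xs f)))

  ∑-*ʳ : ∀ (xs : List A) c f → ∑ xs (λ x → f x * c) ≡ ∑ xs f * c
  ∑-*ʳ []       c f = sym (ℚₚ.*-zeroˡ c)
  ∑-*ʳ (x ∷ xs) c f = trans (cong (f x * c +_) (∑-*ʳ xs c f)) (sym (ℚₚ.*-distribʳ-+ c (f x) (∑ xs f)))

  ∑-mix : ∀ (xs : List A) r f g → ∑ xs (λ x → mix r (f x) (g x)) ≡ mix r (∑ xs f) (∑ xs g)
  ∑-mix xs r f g = trans (∑-+ xs _ _) (cong₂ _+_ (∑-*ˡ xs r f) (∑-*ˡ xs (1ℚ - r) g))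

  ∑-++ : ∀ (xs ys : List A) f → ∑ (xs ++ ys) f ≡ ∑ xs f + ∑ ys f
  ∑-++ []       ys f = sym (ℚₚ.+-identityˡ _)
  ∑-++ (x ∷ xs) ys f = trans (cong (f x +_) (∑-++ xs ys f)) (sym (ℚₚ.+-assoc (f x) _ _))

  ∑-map : ∀ {B : Set} (h : B → A) xs f → ∑ (map h xs) f ≡ ∑ xs (f ∘ h)
  ∑-map h []       f = refl
  ∑-map h (x ∷ xs) f = cong (f (h x) +_) (∑-map h xs f)

  ∑-mono-gain : ∀ {xs : List A} {x₀ f g δ} → x₀ ∈ xs → (∀ x → f x ≤ g x) →
                f x₀ + δ ≤ g x₀ → ∑ xs f + δ ≤ ∑ xs g
  ∑-mono-gain {x ∷ xs} {f = f} {g} {δ} (here refl) le h =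
    subst (_≤ _) (lemma (f x) δ (∑ xs f)) (ℚₚ.+-mono-≤ h (∑-mono xs le))
    where
    lemma : ∀ a b c → a + b + c ≡ a + c + b
    lemma = solve-∀ ℚ-ring
  ∑-mono-gain {x ∷ xs} {f = f} {g} {δ} (there x₀∈xs) le h =
    subst (_≤ _) (sym (ℚₚ.+-assoc (f x) (∑ xs f) δ)) (ℚₚ.+-mono-≤ (le x) (∑-mono-gain x₀∈xs le h))

-- Partial assignments and bounded-depth refutation

PA : ℕ → Set
PA n = Vec (Maybe Bool) n

_[_↦_] : ∀ {n} → PA n → Fin n → Bool → PA n
τ [ x ↦ b ] = τ [ x ]≔ just b

sign : ∀ {n} → Literal n → Bool
sign (pos _) = true
sign (neg _) = false

agrees : Bool → Bool → Bool
agrees a     true  = a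
agrees true  false = false
agrees false false = true

agrees-refl : ∀ b → agrees b b ≡ true
agrees-refl true  = refl
agrees-refl false = refl

agrees⇒≡ : ∀ a b → agrees a b ≡ true → a ≡ b
agrees⇒≡ true  true  eq = refl
agrees⇒≡ false false eq = refl

falsifies : Maybe Bool → Bool → Bool
falsifies nothing  b = false
falsifies (just a) b = not (agrees a b)

falseIn : ∀ {n} → PA n → Literal n → Bool
falseIn τ l = falsifies (lookup τ (var l)) (sign l)

every : ∀ {A : Set} → (A → Bool) → List A → Bool
every f []       = true
every f (x ∷ xs) = f x ∧ every f xs

some : ∀ {A : Set} → (A → Bool) → List A → Bool
some f []       = false
some f (x ∷ xs) = f x ∨ some f xs

∧⁻ : ∀ {a b} → a ∧ b ≡ true → a ≡ true × b ≡ true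
∧⁻ {true} {true} refl = refl , refl

every⁻ : ∀ {A : Set} {f : A → Bool} xs → every f xs ≡ true → All (λ x → f x ≡ true) xs
every⁻ []       eq = []
every⁻ (x ∷ xs) eq = proj₁ (∧⁻ eq) ∷ every⁻ xs (proj₂ (∧⁻ eq))

every⁺ : ∀ {A : Set} {f : A → Bool} {xs} → All (λ x → f x ≡ true) xs → every f xs ≡ true
every⁺ []         = refl
every⁺ (eq ∷ eqs) = cong₂ _∧_ eq (every⁺ eqs)

some⁻ : ∀ {A : Set} {f : A → Bool} xs → some f xs ≡ true → Any (λ x → f x ≡ true) xs
some⁻ {f = f} (x ∷ xs) eq with f x in eqx
... | true  = here eqx
... | false = there (some⁻ xs eq)

some⁺ : ∀ {A : Set} {f : A → Bool} {xs} → Any (λ x → f x ≡ true) xs → some f xs ≡ true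
some⁺ (here eq)             rewrite eq = refl
some⁺ {f = f} (there {x} a) rewrite some⁺ {f = f} a = Bool.∨-zeroʳ (f x)

∨⁻ : ∀ {a b} → a ∨ b ≡ true → a ≡ true ⊎ b ≡ true
∨⁻ {true}  eq = inj₁ refl
∨⁻ {false} eq = inj₂ eq

∨⁺ˡ : ∀ {a b} → a ≡ true → a ∨ b ≡ true
∨⁺ˡ refl = refl

∨⁺ʳ : ∀ {a b} → b ≡ true → a ∨ b ≡ true
∨⁺ʳ {a} refl = Bool.∨-zeroʳ a

infix 4 _⊑_ _⊒_

record _⊑_ {n} (τ τ′ : PA n) : Set where
  constructor mk⊑
  field ⊑-lookup : ∀ x b → lookup τ x ≡ just b → lookup τ′ x ≡ just b

record _⊒_ {n} (α : Assignment n) (τ : PA n) : Set where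
  constructor mk⊒
  field ⊒-lookup : ∀ x b → lookup τ x ≡ just b → lookup α x ≡ b

open _⊑_ public
open _⊒_ public

_⊒?_ : ∀ {n} (α : Assignment n) (τ : PA n) → Dec (α ⊒ τ)
α ⊒? τ = map′ mk⊒ ⊒-lookup (Fin.all? λ x → decide (lookup α x) (lookup τ x))
  where
  decide : ∀ a m → Dec (∀ b → m ≡ just b → a ≡ b)
  decide a (just c) = map′ (λ eq b eq′ → trans eq (Maybe.just-injective eq′)) (λ h → h c refl) (a Bool.≟ c)
  decide a nothing  = yes λ b ()

lookup-↦ : ∀ {n} (τ : PA n) x b → lookup (τ [ x ↦ b ]) x ≡ just b
lookup-↦ τ x b = Vecₚ.lookup∘update x τ (just b)

lookup-↦′ : ∀ {n} {x y : Fin n} → x ≢ y → ∀ (τ : PA n) b → lookup (τ [ y ↦ b ]) x ≡ lookup τ x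
lookup-↦′ x≢y τ b = Vecₚ.lookup∘update′ x≢y τ (just b)

↦-comm : ∀ {n} (τ : PA n) {x y : Fin n} {a b} → x ≢ y → τ [ x ↦ a ] [ y ↦ b ] ≡ τ [ y ↦ b ] [ x ↦ a ]
↦-comm τ {x} {y} x≢y = Vecₚ.[]≔-commutes τ x y x≢y

↦-mono : ∀ {n} {τ τ′ : PA n} x b → τ ⊑ τ′ → (τ [ x ↦ b ]) ⊑ (τ′ [ x ↦ b ])
↦-mono {τ = τ} {τ′} x b τ⊑τ′ = mk⊑ go
  where
  go : ∀ y c → lookup (τ [ x ↦ b ]) y ≡ just c → lookup (τ′ [ x ↦ b ]) y ≡ just c
  go y c eq with y Fin.≟ x
  ... | yes refl = trans (lookup-↦ τ′ x b) (trans (sym (lookup-↦ τ x b)) eq)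
  ... | no y≢x   = trans (lookup-↦′ y≢x τ′ b) (⊑-lookup τ⊑τ′ y c (trans (sym (lookup-↦′ y≢x τ b)) eq))

⊑-↦ : ∀ {n} {τ : PA n} {x} b → lookup τ x ≡ nothing → τ ⊑ (τ [ x ↦ b ])
⊑-↦ {τ = τ} {x} b un = mk⊑ go
  where
  go : ∀ y c → lookup τ y ≡ just c → lookup (τ [ x ↦ b ]) y ≡ just c
  go y c eq with y Fin.≟ x
  ... | yes refl = case trans (sym un) eq of λ ()
  ... | no y≢x   = trans (lookup-↦′ y≢x τ b) eq

⊒-↦ : ∀ {n} {α : Assignment n} {τ : PA n} {x b} → α ⊒ τ → lookup α x ≡ b → α ⊒ (τ [ x ↦ b ])
⊒-↦ {α = α} {τ} {x} {b} α⊒τ eq = mk⊒ go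
  where
  go : ∀ y c → lookup (τ [ x ↦ b ]) y ≡ just c → lookup α y ≡ c
  go y c eq′ with y Fin.≟ x
  ... | yes refl = trans eq (Maybe.just-injective (trans (sym (lookup-↦ τ x b)) eq′))
  ... | no y≢x   = ⊒-lookup α⊒τ y c (trans (sym (lookup-↦′ y≢x τ b)) eq′)

⊒-⊑ : ∀ {n} {α : Assignment n} {τ τ′ : PA n} → τ ⊑ τ′ → α ⊒ τ′ → α ⊒ τ
⊒-⊑ τ⊑τ′ α⊒τ′ = mk⊒ λ x b eq → ⊒-lookup α⊒τ′ x b (⊑-lookup τ⊑τ′ x b eq)

falseIn-mono : ∀ {n} {τ τ′ : PA n} l → τ ⊑ τ′ → falseIn τ l ≡ true → falseIn τ′ l ≡ true
falseIn-mono {τ = τ} l τ⊑τ′ eq with lookup τ (var l) | ⊑-lookup τ⊑τ′ (var l)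
... | just a | h rewrite h a refl = eq

⊨ˡ-sign : ∀ {n} {α : Assignment n} l → α ⊨ˡ l → lookup α (var l) ≡ sign l
⊨ˡ-sign (pos x) eq = eq
⊨ˡ-sign (neg x) eq = eq

falsifies⇒≢ : ∀ a b → falsifies (just a) b ≡ true → a ≢ b
falsifies⇒≢ true  .true  () refl
falsifies⇒≢ false .false () refl

≢⇒falsifies : ∀ a b → a ≢ b → falsifies (just a) b ≡ true
≢⇒falsifies true  true  h = contradiction refl h
≢⇒falsifies true  false h = refl
≢⇒falsifies false true  h = refl
≢⇒falsifies false false h = contradiction refl h

module Refutation {n} (cls : List (Clause n)) where

  Sol : PA n → Assignment n → Set
  Sol τ α = All (Any (α ⊨ˡ_)) cls × α ⊒ τ

  abstract
    Sol? : ∀ τ α → Dec (Sol τ α)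
    Sol? τ α = all? (any? (α ⊨ˡ?_)) cls ×-dec (α ⊒? τ)

  Sol-⊑ : ∀ {τ τ′ α} → τ ⊑ τ′ → Sol τ′ α → Sol τ α
  Sol-⊑ τ⊑τ′ (s , e) = s , ⊒-⊑ τ⊑τ′ e

  Sol-↦ : ∀ {τ α x b} → Sol τ α → lookup α x ≡ b → Sol (τ [ x ↦ b ]) α
  Sol-↦ (s , e) eq = s , ⊒-↦ e eq

  Sol-lookup : ∀ {τ α x b} → Sol τ α → lookup τ x ≡ just b → lookup α x ≡ b
  Sol-lookup (s , e) = ⊒-lookup e _ _

  -- Branching on the literals of a clause: a refutation of depth k amounts to a
  -- critical clause tree of depth k.
  refute : ℕ → PA n → Bool
  refuteLit : ℕ → PA n → Literal n → Bool

  refute zero    τ = false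
  refute (suc k) τ = some (every (refuteLit k τ)) cls

  refuteLit k τ l = falseIn τ l ∨ refute k (τ [ var l ↦ sign l ])

  refute-mono : ∀ k {τ τ′} → τ ⊑ τ′ → refute k τ ≡ true → refute k τ′ ≡ true
  refuteLit-mono : ∀ k {τ τ′} l → τ ⊑ τ′ → refuteLit k τ l ≡ true → refuteLit k τ′ l ≡ true

  refute-mono (suc k) {τ} {τ′} τ⊑τ′ eq =
    some⁺ (Any.map (λ {C} e → every⁺ (All.map (λ {l} → refuteLit-mono k l τ⊑τ′) (every⁻ C e))) (some⁻ cls eq))

  refuteLit-mono k {τ} {τ′} l τ⊑τ′ eq with ∨⁻ {falseIn τ l} eq
  ... | inj₁ f = ∨⁺ˡ (falseIn-mono l τ⊑τ′ f)
  ... | inj₂ r = ∨⁺ʳ {falseIn τ′ l} (refute-mono k (↦-mono (var l) (sign l) τ⊑τ′) r)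

  -- A solution α extending τ makes some literal of the refuted clause true. That literal is not
  -- false in τ, so its branch was refuted at smaller depth, although α extends that branch too.
  refute-sound : ∀ k {τ α} → refute k τ ≡ true → ¬ Sol τ α
  refute-sound (suc k) {τ} {α} eq (sat , ext) = go sat (some⁻ cls eq)
    where
    clause : ∀ {C} → Any (α ⊨ˡ_) C → ¬ All (λ l → refuteLit k τ l ≡ true) C
    clause (there a) (_ ∷ rs) = clause a rs
    clause (here {l} α⊨l) (r ∷ _) with ∨⁻ {falseIn τ l} r
    ... | inj₂ r′ = refute-sound k r′ (Sol-↦ (sat , ext) (⊨ˡ-sign {α = α} l α⊨l))
    ... | inj₁ f with lookup τ (var l) in eqv
    ...   | just a = falsifies⇒≢ a (sign l) f
                       (trans (sym (⊒-lookup ext _ _ eqv)) (⊨ˡ-sign {α = α} l α⊨l))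
    go : ∀ {Cs} → All (Any (α ⊨ˡ_)) Cs → ¬ Any (λ C → every (refuteLit k τ) C ≡ true) Cs
    go (s ∷ _)  (here e)  = clause s (every⁻ _ e)
    go (_ ∷ ss) (there a) = go ss a

-- Assignments, and the reference process

assignments : ∀ n → List (Assignment n)
assignments zero    = [] ∷ []
assignments (suc n) = map (false ∷_) (assignments n) ++ map (true ∷_) (assignments n)

∈-assignments : ∀ {n} (α : Assignment n) → α ∈ assignments n
∈-assignments []          = here refl
∈-assignments (false ∷ α) = ∈-++⁺ˡ (∈-map⁺ (false ∷_) (∈-assignments α))
∈-assignments (true ∷ α)  = ∈-++⁺ʳ _ (∈-map⁺ (true ∷_) (∈-assignments α))

same : ∀ {n} → Assignment n → Assignment n → Bool
same []      []      = true
same (a ∷ α) (b ∷ β) = agrees a b ∧ same α β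

same-refl : ∀ {n} (α : Assignment n) → same α α ≡ true
same-refl []      = refl
same-refl (a ∷ α) = cong₂ _∧_ (agrees-refl a) (same-refl α)

same⇒≡ : ∀ {n} (α β : Assignment n) → same α β ≡ true → α ≡ β
same⇒≡ []      []      eq = refl
same⇒≡ (a ∷ α) (b ∷ β) eq =
  cong₂ _∷_ (agrees⇒≡ a b (proj₁ (∧⁻ eq))) (same⇒≡ α β (proj₂ (∧⁻ {agrees a b} eq)))

∑-same : ∀ {n} (β : Assignment n) → ∑ (assignments n) (λ α → indicator (same β α)) ≡ 1ℚ
∑-same []      = refl
∑-same {suc n} (b ∷ β) = begin
  ∑ (map (false ∷_) A ++ map (true ∷_) A) f  ≡⟨ ∑-++ (map (false ∷_) A) _ f ⟩
  ∑ (map (false ∷_) A) f + ∑ (map (true ∷_) A) f  ≡⟨ cong₂ _+_ (∑-map (false ∷_) A f) (∑-map (true ∷_) A f) ⟩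
  ∑ A (f ∘ (false ∷_)) + ∑ A (f ∘ (true ∷_))  ≡⟨ halves b ⟩
  1ℚ  ∎
  where
  open ≡-Reasoning
  A = assignments n
  f = λ α → indicator (same (b ∷ β) α)
  halves : ∀ b → ∑ A (λ α → indicator (same (b ∷ β) (false ∷ α))) + ∑ A (λ α → indicator (same (b ∷ β) (true ∷ α))) ≡ 1ℚ
  halves false = trans (cong₂ _+_ (∑-same β) (∑-zero A)) (ℚₚ.+-identityʳ 1ℚ)
  halves true  = trans (cong₂ _+_ (∑-zero A) (∑-same β)) (ℚₚ.+-identityˡ 1ℚ)

unassigned? : ∀ {A : Set} → Maybe Bool → A → A → A
unassigned? (just _) a u = a
unassigned? nothing  a u = u

unassigned?-just : ∀ {A : Set} {m b} {a u : A} → m ≡ just b → unassigned? m a u ≡ a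
unassigned?-just refl = refl

infixr 8 _^^_
_^^_ : ℚ → ℕ → ℚ
x ^^ zero  = 1ℚ
x ^^ suc m = x * x ^^ m

2ℚ : ℚ
2ℚ = 1ℚ + 1ℚ

0≤^^ : ∀ {x} m → 0ℚ ≤ x → 0ℚ ≤ x ^^ m
0≤^^ zero    0≤x = 0≤1
0≤^^ (suc m) 0≤x = 0≤* 0≤x (0≤^^ m 0≤x)

0≤2 : 0ℚ ≤ 2ℚ
0≤2 = 0≤+ 0≤1 0≤1

halves : ∀ m → ½ ^^ m * 2ℚ ^^ m ≡ 1ℚ
halves zero    = refl
halves (suc m) = trans (lemma (½ ^^ m) (2ℚ ^^ m)) (halves m)
  where
  lemma : ∀ a b → ½ * a * ((1ℚ + 1ℚ) * b) ≡ a * b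
  lemma = solve-∀ ℚ-ring

abstract
  natℚ : ℕ → ℚ
  natℚ zero    = 0ℚ
  natℚ (suc m) = 1ℚ + natℚ m

  natℚ-zero : natℚ 0 ≡ 0ℚ
  natℚ-zero = refl

  natℚ-suc : ∀ m → natℚ (suc m) ≡ 1ℚ + natℚ m
  natℚ-suc m = refl

  natℚ-+ : ∀ a b → natℚ (a ℕ.+ b) ≡ natℚ a + natℚ b
  natℚ-+ zero    b = sym (ℚₚ.+-identityˡ (natℚ b))
  natℚ-+ (suc a) b = trans (cong (1ℚ +_) (natℚ-+ a b)) (sym (ℚₚ.+-assoc 1ℚ (natℚ a) (natℚ b)))

  natℚ-* : ∀ a b → natℚ (a ℕ.* b) ≡ natℚ a * natℚ b
  natℚ-* zero    b = sym (ℚₚ.*-zeroˡ (natℚ b))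
  natℚ-* (suc a) b = trans (natℚ-+ b (a ℕ.* b)) (trans (cong (natℚ b +_) (natℚ-* a b)) (lemma (natℚ a) (natℚ b)))
    where
    lemma : ∀ a b → b + a * b ≡ (1ℚ + a) * b
    lemma = solve-∀ ℚ-ring

  natℚ-2^ : ∀ m → natℚ (2 ^ m) ≡ 2ℚ ^^ m
  natℚ-2^ zero    = ℚₚ.+-identityʳ 1ℚ
  natℚ-2^ (suc m) = trans (natℚ-* 2 (2 ^ m)) (cong (2ℚ *_) (natℚ-2^ m))

  0≤natℚ : ∀ m → 0ℚ ≤ natℚ m
  0≤natℚ zero    = ℚₚ.≤-refl
  0≤natℚ (suc m) = 0≤+ 0≤1 (0≤natℚ m)

  natℚ-mono : ∀ {a b} → a ℕ.≤ b → natℚ a ≤ natℚ b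
  natℚ-mono {b = b} z≤n = 0≤natℚ b
  natℚ-mono (s≤s le)    = ℚₚ.+-monoʳ-≤ 1ℚ (natℚ-mono le)

  natℚ-∸ : ∀ {a b} → a ℕ.≤ b → natℚ (b ℕ.∸ a) ≡ natℚ b - natℚ a
  natℚ-∸ {a} {b} a≤b = trans (lemma (natℚ (b ℕ.∸ a)) (natℚ a))
    (cong (_- natℚ a) (trans (sym (natℚ-+ (b ℕ.∸ a) a)) (cong natℚ (ℕₚ.m∸n+n≡m a≤b))))
    where
    lemma : ∀ x y → x ≡ x + y - y
    lemma = solve-∀ ℚ-ring

occurrences : ∀ {n} → Fin n → List (Fin n) → ℕ
occurrences v []       = zero
occurrences v (x ∷ es) = (if does (x Fin.≟ v) then 1 else 0) ℕ.+ occurrences v es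

unassigned : ∀ {n} → PA n → ℚ
unassigned τ = ∑ (allFin _) λ v → unassigned? (lookup τ v) 0ℚ 1ℚ

module Process {n} (cls : List (Clause n)) (d : ℕ) (ρ w : ℚ) (0≤ρ : 0ℚ ≤ ρ) (ρ≤1 : ρ ≤ 1ℚ)
               (0≤w : 0ℚ ≤ w) (w≤1 : w ≤ 1ℚ) (w-inverse : (1ℚ + ρ) * w ≡ 1ℚ) where

  open Refutation cls

  A : List (Assignment n)
  A = assignments n

  sat : PA n → Bool
  sat τ = does (any? (Sol? τ) A)

  sat⁺ : ∀ {τ α} → Sol τ α → sat τ ≡ true
  sat⁺ {τ} {α} s with any? (Sol? τ) A
  ... | yes _ = refl
  ... | no ¬a = contradiction (Any.map (λ eq → subst (Sol τ) eq s) (∈-assignments α)) ¬a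

  sat⁻ : ∀ {τ} → sat τ ≡ true → ∃[ α ] Sol τ α
  sat⁻ {τ} eq with any? (Sol? τ) A
  ... | yes a = _ , proj₂ (Any.satisfied a)

  unsat : ∀ {τ α} → sat τ ≡ false → ¬ Sol τ α
  unsat {τ} eq s = case trans (sym eq) (sat⁺ s) of λ ()

  sat-⊑ : ∀ {τ τ′} → τ ⊑ τ′ → sat τ′ ≡ true → sat τ ≡ true
  sat-⊑ τ⊑τ′ eq = sat⁺ (Sol-⊑ τ⊑τ′ (proj₂ (sat⁻ eq)))

  liquid : PA n → Fin n → Bool
  liquid τ x = sat (τ [ x ↦ false ]) ∧ sat (τ [ x ↦ true ])

  liquid-⊑ : ∀ {τ τ′} x → τ ⊑ τ′ → liquid τ′ x ≡ true → liquid τ x ≡ true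
  liquid-⊑ {τ} {τ′} x τ⊑τ′ eq =
    cong₂ _∧_ (sat-⊑ (↦-mono x false τ⊑τ′) (proj₁ (∧⁻ eq)))
              (sat-⊑ (↦-mono x true τ⊑τ′) (proj₂ (∧⁻ {sat (τ′ [ x ↦ false ])} eq)))

  firstSol : PA n → List (Assignment n) → Maybe (Assignment n)
  firstSol τ []       = nothing
  firstSol τ (α ∷ αs) = if does (Sol? τ α) then just α else firstSol τ αs

  firstSol-Sol : ∀ τ αs {α} → firstSol τ αs ≡ just α → Sol τ α
  firstSol-Sol τ (β ∷ βs) eq with Sol? τ β
  firstSol-Sol τ (β ∷ βs) refl | yes s = s
  ... | no _ = firstSol-Sol τ βs eq

  -- Extending τ only removes solutions, so the first one stays first as long as it survives.
  firstSol-⊑ : ∀ {τ τ′} αs {α} → τ ⊑ τ′ → Sol τ′ α → firstSol τ αs ≡ just α → firstSol τ′ αs ≡ just α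
  firstSol-⊑ {τ} {τ′} (β ∷ βs) τ⊑τ′ s eq with Sol? τ β
  firstSol-⊑ {τ} {τ′} (β ∷ βs) τ⊑τ′ s refl | yes _ with Sol? τ′ β
  ... | yes _ = refl
  ... | no ¬s = contradiction s ¬s
  firstSol-⊑ {τ} {τ′} (β ∷ βs) τ⊑τ′ s eq | no ¬s with Sol? τ′ β
  ... | yes s′ = contradiction (Sol-⊑ τ⊑τ′ s′) ¬s
  ... | no _   = firstSol-⊑ βs τ⊑τ′ s eq

  firstSol-nothing : ∀ τ αs → firstSol τ αs ≡ nothing → ¬ Any (Sol τ) αs
  firstSol-nothing τ (β ∷ βs) eq a with Sol? τ β
  firstSol-nothing τ (β ∷ βs) eq (here s)  | no ¬s = ¬s s
  firstSol-nothing τ (β ∷ βs) eq (there a) | no ¬s = firstSol-nothing τ βs eq a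

  isJust : Maybe (Assignment n) → Assignment n → Bool
  isJust nothing  α = false
  isJust (just β) α = same β α

  weight : PA n → Fin n → ℚ
  weight τ x = if liquid τ x then w else 1ℚ

  -- The law of the final assignment when a variable is picked together with a
  -- value that keeps the formula satisfiable, each such literal at rate ρ.  A
  -- liquid variable is thus picked at twice the rate of a frozen one, whence
  -- the normalisation by 1/(1+ρ).
  law : List (Fin n) → PA n → Assignment n → ℚ
  law []       τ α = indicator (isJust (firstSol τ A) α)
  law (x ∷ es) τ α = unassigned? (lookup τ x) (law es τ α)
    (weight τ x * mix ρ (law es (τ [ x ↦ lookup α x ]) α) (law es τ α))

  0≤weight : ∀ τ x → 0ℚ ≤ weight τ x
  0≤weight τ x with liquid τ x
  ... | true  = 0≤w
  ... | false = 0≤1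

  weight≤1 : ∀ τ x → weight τ x ≤ 1ℚ
  weight≤1 τ x with liquid τ x
  ... | true  = w≤1
  ... | false = ℚₚ.≤-refl

  weight-⊑ : ∀ {τ τ′} x → τ ⊑ τ′ → weight τ x ≤ weight τ′ x
  weight-⊑ {τ} {τ′} x τ⊑τ′ with liquid τ′ x | liquid-⊑ x τ⊑τ′
  ... | true  | h rewrite h refl = ℚₚ.≤-refl
  ... | false | _ = weight≤1 τ x

  0≤law : ∀ es τ α → 0ℚ ≤ law es τ α
  0≤law []       τ α = 0≤indicator (isJust (firstSol τ A) α)
  0≤law (x ∷ es) τ α with lookup τ x
  ... | just _  = 0≤law es τ α
  ... | nothing = 0≤* (0≤weight τ x) (0≤mix 0≤ρ ρ≤1 (0≤law es _ α) (0≤law es τ α))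

  0≤mixed-law : ∀ es τ x α → 0ℚ ≤ mix ρ (law es (τ [ x ↦ lookup α x ]) α) (law es τ α)
  0≤mixed-law es τ x α = 0≤mix 0≤ρ ρ≤1 (0≤law es _ α) (0≤law es τ α)

  law-¬Sol : ∀ es τ α → ¬ Sol τ α → law es τ α ≡ 0ℚ
  law-¬Sol [] τ α ¬s with firstSol τ A in eq
  ... | nothing = refl
  ... | just β with same β α in eq′
  ...   | false = refl
  ...   | true  = contradiction (subst (Sol τ) (same⇒≡ β α eq′) (firstSol-Sol τ A eq)) ¬s
  law-¬Sol (x ∷ es) τ α ¬s with lookup τ x in eq
  ... | just _  = law-¬Sol es τ α ¬s
  ... | nothing rewrite law-¬Sol es (τ [ x ↦ lookup α x ]) α (¬s ∘ Sol-⊑ (⊑-↦ _ eq)) | law-¬Sol es τ α ¬s =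
    lemma (weight τ x) ρ
    where
    lemma : ∀ a r → a * (r * 0ℚ + (1ℚ - r) * 0ℚ) ≡ 0ℚ
    lemma = solve-∀ ℚ-ring

  Sol-other : ∀ {τ α x} → ¬ Sol (τ [ x ↦ not (lookup α x) ]) α
  Sol-other {τ} {α} {x} s with lookup α x in eq
  ... | true  = case trans (sym eq) (Sol-lookup s (lookup-↦ τ x false)) of λ ()
  ... | false = case trans (sym eq) (Sol-lookup s (lookup-↦ τ x true)) of λ ()

  -- For each α only the branch with `b = lookup α x` has positive law. A value read off from the
  -- final assignment is thereby exchanged for a sum over the two restricted formulas, to which
  -- induction applies.
  ∑-split : ∀ es τ x (f : PA n → Assignment n → ℚ) →
            ∑ A (λ α → law es (τ [ x ↦ lookup α x ]) α * f (τ [ x ↦ lookup α x ]) α) ≡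
            ∑ A (λ α → law es (τ [ x ↦ false ]) α * f (τ [ x ↦ false ]) α) +
            ∑ A (λ α → law es (τ [ x ↦ true ]) α * f (τ [ x ↦ true ]) α)
  ∑-split es τ x f = trans (∑-cong A pointwise) (∑-+ A (term false) (term true))
    where
    term : Bool → Assignment n → ℚ
    term b α = law es (τ [ x ↦ b ]) α * f (τ [ x ↦ b ]) α
    pointwise : ∀ α → term (lookup α x) α ≡ term false α + term true α
    pointwise α with lookup α x in eq
    ... | false rewrite law-¬Sol es (τ [ x ↦ true ]) α (subst (λ b → ¬ Sol (τ [ x ↦ not b ]) α) eq (Sol-other {τ} {α} {x})) =
      sym (trans (cong (term false α +_) (ℚₚ.*-zeroˡ (f (τ [ x ↦ true ]) α))) (ℚₚ.+-identityʳ _))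
    ... | true rewrite law-¬Sol es (τ [ x ↦ false ]) α (subst (λ b → ¬ Sol (τ [ x ↦ not b ]) α) eq (Sol-other {τ} {α} {x})) =
      sym (trans (cong (_+ term true α) (ℚₚ.*-zeroˡ (f (τ [ x ↦ false ]) α))) (ℚₚ.+-identityˡ _))

  ∑-split₁ : ∀ es τ x → ∑ A (λ α → law es (τ [ x ↦ lookup α x ]) α) ≡
                        ∑ A (law es (τ [ x ↦ false ])) + ∑ A (law es (τ [ x ↦ true ]))
  ∑-split₁ es τ x = begin
    ∑ A (λ α → law es (τ [ x ↦ lookup α x ]) α)  ≡⟨ ∑-cong A (λ α → sym (ℚₚ.*-identityʳ _)) ⟩
    ∑ A (λ α → law es (τ [ x ↦ lookup α x ]) α * 1ℚ)  ≡⟨ ∑-split es τ x (λ _ _ → 1ℚ) ⟩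
    _  ≡⟨ cong₂ _+_ (∑-cong A (λ α → ℚₚ.*-identityʳ _)) (∑-cong A (λ α → ℚₚ.*-identityʳ _)) ⟩
    _  ∎
    where open ≡-Reasoning

  sat-cases : ∀ {τ} x → sat τ ≡ true → sat (τ [ x ↦ false ]) ≡ true ⊎ sat (τ [ x ↦ true ]) ≡ true
  sat-cases {τ} x eq with sat⁻ {τ} eq
  ... | α , s with lookup α x in eqx
  ...   | false = inj₁ (sat⁺ (Sol-↦ s eqx))
  ...   | true  = inj₂ (sat⁺ (Sol-↦ s eqx))

  -- Two satisfiable branches contribute `2ρ + (1 - ρ) = 1 + ρ`, which the weight `w` of a liquid
  -- variable cancels; a frozen variable has one satisfiable branch and needs no correction.
  ∑-law : ∀ es τ → ∑ A (law es τ) ≡ indicator (sat τ)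
  ∑-law es τ with sat τ in eq
  ... | false = trans (∑-cong A (λ α → law-¬Sol es τ α (unsat eq))) (∑-zero A)
  ... | true  = total es eq
    where
    total : ∀ es → sat τ ≡ true → ∑ A (law es τ) ≡ 1ℚ
    total [] eq with firstSol τ A in eq′
    ... | just β  = ∑-same β
    ... | nothing with sat⁻ {τ} eq
    ...   | α , s = contradiction (Any.map (λ e → subst (Sol τ) e s) (∈-assignments α)) (firstSol-nothing τ A eq′)
    total (x ∷ es) eq with lookup τ x in un
    ... | just _  = total es eq
    ... | nothing = begin
      ∑ A (λ α → weight τ x * mix ρ (law es (τ [ x ↦ lookup α x ]) α) (law es τ α))
        ≡⟨ ∑-*ˡ A (weight τ x) _ ⟩
      weight τ x * ∑ A (λ α → mix ρ (law es (τ [ x ↦ lookup α x ]) α) (law es τ α))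
        ≡⟨ cong (weight τ x *_) (∑-mix A ρ _ (law es τ)) ⟩
      weight τ x * mix ρ (∑ A (λ α → law es (τ [ x ↦ lookup α x ]) α)) (∑ A (law es τ))
        ≡⟨ cong₂ (λ a b → weight τ x * mix ρ a b)
                 (trans (∑-split₁ es τ x) (cong₂ _+_ (∑-law es (τ [ x ↦ false ])) (∑-law es (τ [ x ↦ true ]))))
                 (total es eq) ⟩
      weight τ x * mix ρ (indicator (sat (τ [ x ↦ false ])) + indicator (sat (τ [ x ↦ true ]))) 1ℚ
        ≡⟨ finish ⟩
      1ℚ ∎
      where
      open ≡-Reasoning
      lemma : ∀ w r → w * (r * (1ℚ + 1ℚ) + (1ℚ - r) * 1ℚ) ≡ (1ℚ + r) * w
      lemma = solve-∀ ℚ-ring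
      lemma₁ : ∀ r → 1ℚ * (r * (1ℚ + 0ℚ) + (1ℚ - r) * 1ℚ) ≡ 1ℚ
      lemma₁ = solve-∀ ℚ-ring
      lemma₂ : ∀ r → 1ℚ * (r * (0ℚ + 1ℚ) + (1ℚ - r) * 1ℚ) ≡ 1ℚ
      lemma₂ = solve-∀ ℚ-ring
      finish : weight τ x * mix ρ (indicator (sat (τ [ x ↦ false ])) + indicator (sat (τ [ x ↦ true ]))) 1ℚ ≡ 1ℚ
      finish with sat (τ [ x ↦ false ]) | sat (τ [ x ↦ true ]) | sat-cases {τ} x eq
      ... | true  | true  | _ = trans (lemma w ρ) w-inverse
      ... | true  | false | _ = lemma₁ ρ
      ... | false | true  | _ = lemma₂ ρ
      ... | false | false | inj₁ ()
      ... | false | false | inj₂ ()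

  -- Setting `x` as in α leaves fewer variables liquid, so the later weights rise, and α remains the
  -- first solution if it was so before. If the next event concerns `x` itself, the bound
  -- `weight τ x ≤ 1` suffices.
  law-mono : ∀ es τ α x → lookup τ x ≡ nothing → law es τ α ≤ law es (τ [ x ↦ lookup α x ]) α
  law-mono [] τ α x un with Sol? τ α
  ... | no ¬s = ℚₚ.≤-trans (ℚₚ.≤-reflexive (law-¬Sol [] τ α ¬s)) (0≤law [] _ α)
  ... | yes s with firstSol τ A in eq
  ...   | nothing = 0≤law [] _ α
  ...   | just β with same β α in eq′
  ...     | false = 0≤law [] _ α
  ...     | true  = ℚₚ.≤-reflexive (sym (cong indicator (trans
                      (cong (λ m → isJust m α) (firstSol-⊑ A (⊑-↦ (lookup α x) un) (Sol-↦ s refl)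
                        (trans eq (cong just (same⇒≡ β α eq′)))))
                      (same-refl α))))
  law-mono (e ∷ es) τ α x un with e Fin.≟ x
  ... | yes refl rewrite un | lookup-↦ τ x (lookup α x) = begin
      weight τ x * mix ρ L′ L  ≤⟨ *-monoˡ (0≤mixed-law es τ x α) (weight≤1 τ x) ⟩
      1ℚ * mix ρ L′ L  ≡⟨ ℚₚ.*-identityˡ _ ⟩
      mix ρ L′ L  ≤⟨ mix-mono 0≤ρ ρ≤1 ℚₚ.≤-refl (law-mono es τ α x un) ⟩
      mix ρ L′ L′  ≡⟨ mix-const ρ L′ ⟩
      L′  ∎
      where
      open ℚₚ.≤-Reasoning
      L = law es τ α
      L′ = law es (τ [ x ↦ lookup α x ]) α
  ... | no e≢x rewrite lookup-↦′ e≢x τ (lookup α x) with lookup τ e in une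
  ...   | just _  = law-mono es τ α x un
  ...   | nothing = *-mono (0≤weight τ e) (0≤mixed-law es (τ [ x ↦ lookup α x ]) e α)
                      (weight-⊑ e (⊑-↦ _ un))
                      (mix-mono 0≤ρ ρ≤1
                        (subst (law es _ α ≤_) (cong (λ τ′ → law es τ′ α) (↦-comm τ e≢x))
                          (law-mono es (τ [ e ↦ lookup α e ]) α x (trans (lookup-↦′ (e≢x ∘ sym) τ _) un)))
                        (law-mono es τ α x un))

xor-indicator : ∀ {a b} → a ≡ true ⊎ b ≡ true → a ∧ b ≡ false → indicator a + indicator b ≡ 1ℚ
xor-indicator {true}  {false} _         _ = refl
xor-indicator {false} {true}  _         _ = refl
xor-indicator {false} {false} (inj₁ ()) _
xor-indicator {false} {false} (inj₂ ()) _

-- The cost of guessing and the potential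

module Cost {n} (cls : List (Clause n)) (d : ℕ) (ρ w : ℚ) (0≤ρ : 0ℚ ≤ ρ) (ρ≤1 : ρ ≤ 1ℚ)
            (0≤w : 0ℚ ≤ w) (w≤1 : w ≤ 1ℚ) (w-inverse : (1ℚ + ρ) * w ≡ 1ℚ)
            (σ : ℚ) (½≤σ : ½ ≤ σ) where

  open Refutation cls
  open Process cls d ρ w 0≤ρ ρ≤1 0≤w w≤1 w-inverse

  forced : PA n → Fin n → Bool
  forced τ x = refute d (τ [ x ↦ true ]) ∨ refute d (τ [ x ↦ false ])

  guessed : PA n → Fin n → ℚ
  guessed τ x = indicator (not (forced τ x))

  -- The probability that the frozen variable v is guessed when all picked
  -- variables are set as in α.
  cost : List (Fin n) → PA n → Assignment n → Fin n → ℚ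
  cost []       τ α v = unassigned? (lookup τ v) 0ℚ 1ℚ
  cost (x ∷ es) τ α v = unassigned? (lookup τ x) (cost es τ α v)
    (mix ρ (if does (x Fin.≟ v) then guessed τ v else cost es (τ [ x ↦ lookup α x ]) α v) (cost es τ α v))

  -- The summand `(1 - ρ) ^^ m` is the probability of never being picked in m events, in which case
  -- the variable is left to the final coins.
  limit : ℕ → ℚ
  limit m = σ + (1ℚ - ρ) ^^ m

  -- A liquid variable is charged in advance for the largest cost it can have once it freezes. That
  -- charge must not depend on τ or α, hence a function of the number of remaining events.
  potential : List (Fin n) → PA n → Assignment n → Fin n → ℚ
  potential es τ α v = unassigned? (lookup τ v) 0ℚ
    (if liquid τ v then limit (occurrences v es) else cost es τ α v)

  Bounded : List (Fin n) → Set
  Bounded es = ∀ τ α v → Sol τ α → lookup τ v ≡ nothing → liquid τ v ≡ false →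
               cost es τ α v ≤ limit (occurrences v es)

  -- Boundedness for all proper suffixes, which are the lists still to be processed after each
  -- event.
  BoundedTails : List (Fin n) → Set
  BoundedTails []       = ⊤
  BoundedTails (x ∷ es) = Bounded es × BoundedTails es

  0≤1-ρ : 0ℚ ≤ 1ℚ - ρ
  0≤1-ρ = p≤q⇒0≤q-p ρ≤1

  0≤limit : ∀ m → 0ℚ ≤ limit m
  0≤limit m = 0≤+ (ℚₚ.≤-trans 0≤½ ½≤σ) (0≤^^ m 0≤1-ρ)

  0≤guessed : ∀ τ v → 0ℚ ≤ guessed τ v
  0≤guessed τ v = 0≤indicator (not (forced τ v))

  0≤cost : ∀ es τ α v → 0ℚ ≤ cost es τ α v
  0≤cost [] τ α v with lookup τ v
  ... | just _  = ℚₚ.≤-refl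
  ... | nothing = 0≤1
  0≤cost (x ∷ es) τ α v with lookup τ x
  ... | just _  = 0≤cost es τ α v
  ... | nothing with x Fin.≟ v
  ...   | yes _ = 0≤mix 0≤ρ ρ≤1 (0≤guessed τ v) (0≤cost es τ α v)
  ...   | no _  = 0≤mix 0≤ρ ρ≤1 (0≤cost es _ α v) (0≤cost es τ α v)

  cost-assigned : ∀ es τ α v {b} → lookup τ v ≡ just b → cost es τ α v ≡ 0ℚ
  cost-assigned [] τ α v eq rewrite eq = refl
  cost-assigned (x ∷ es) τ α v eq with lookup τ x in eqx
  ... | just _  = cost-assigned es τ α v eq
  ... | nothing with x Fin.≟ v
  ...   | yes refl = case trans (sym eqx) eq of λ ()
  ...   | no x≢v = trans
    (cong₂ (mix ρ) (cost-assigned es _ α v (trans (lookup-↦′ (x≢v ∘ sym) τ (lookup α x)) eq)) (cost-assigned es τ α v eq))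
    (mix-const ρ 0ℚ)

  guessed-⊑ : ∀ {τ τ′} v → τ ⊑ τ′ → guessed τ′ v ≤ guessed τ v
  guessed-⊑ {τ} {τ′} v τ⊑τ′ with forced τ v in eq
  ... | false = indicator≤1 (not (forced τ′ v))
    where
    indicator≤1 : ∀ b → indicator b ≤ 1ℚ
    indicator≤1 true  = ℚₚ.≤-refl
    indicator≤1 false = 0≤1
  ... | true with ∨⁻ {refute d (τ [ v ↦ true ])} eq
  ...   | inj₁ r rewrite refute-mono d (↦-mono v true τ⊑τ′) r = ℚₚ.≤-refl
  ...   | inj₂ r rewrite refute-mono d (↦-mono v false τ⊑τ′) r | Bool.∨-zeroʳ (refute d (τ′ [ v ↦ true ])) = ℚₚ.≤-refl

  -- Refutations persist under extension, so a variable that is forced stays forced; for `y = v` the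
  -- cost drops to 0.
  cost-mono : ∀ es τ α v y → lookup τ y ≡ nothing → cost es (τ [ y ↦ lookup α y ]) α v ≤ cost es τ α v
  cost-mono es τ α v y un with y Fin.≟ v
  cost-mono es τ α v y un | yes refl =
    ℚₚ.≤-trans (ℚₚ.≤-reflexive (cost-assigned es _ α v (lookup-↦ τ v (lookup α v)))) (0≤cost es τ α v)
  cost-mono [] τ α v y un | no y≢v rewrite lookup-↦′ (y≢v ∘ sym) τ (lookup α y) = ℚₚ.≤-refl
  cost-mono (e ∷ es) τ α v y un | no y≢v with e Fin.≟ y
  cost-mono (e ∷ es) τ α v y un | no y≢v | yes refl rewrite un | lookup-↦ τ y (lookup α y) with y Fin.≟ v
  ... | yes y≡v = contradiction y≡v y≢v
  ... | no _    = ℚₚ.≤-trans (ℚₚ.≤-reflexive (sym (mix-const ρ _)))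
                    (mix-mono 0≤ρ ρ≤1 ℚₚ.≤-refl (cost-mono es τ α v y un))
  cost-mono (e ∷ es) τ α v y un | no y≢v | no e≢y rewrite lookup-↦′ e≢y τ (lookup α y) with lookup τ e in eqe
  ... | just _  = cost-mono es τ α v y un
  ... | nothing with e Fin.≟ v
  ...   | yes refl = mix-mono 0≤ρ ρ≤1 (guessed-⊑ v (⊑-↦ _ un)) (cost-mono es τ α v y un)
  ...   | no e≢v   = mix-mono 0≤ρ ρ≤1
    (subst (_≤ cost es (τ [ e ↦ lookup α e ]) α v) (cong (λ τ′ → cost es τ′ α v) (↦-comm τ e≢y))
      (cost-mono es (τ [ e ↦ lookup α e ]) α v y (trans (lookup-↦′ (e≢y ∘ sym) τ _) un)))
    (cost-mono es τ α v y un)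

  expected : List (Fin n) → PA n → Fin n → ℚ
  expected es τ v = ∑ A λ α → law es τ α * potential es τ α v

  total : List (Fin n) → PA n → ℚ
  total es τ = ∑ (allFin n) (expected es τ)

  0≤potential : ∀ es τ α v → 0ℚ ≤ potential es τ α v
  0≤potential es τ α v with lookup τ v
  ... | just _  = ℚₚ.≤-refl
  ... | nothing with liquid τ v
  ...   | true  = 0≤limit (occurrences v es)
  ...   | false = 0≤cost es τ α v

  0≤total : ∀ es τ → 0ℚ ≤ total es τ
  0≤total es τ = 0≤∑ (allFin n) λ v → 0≤∑ A λ α → 0≤* (0≤law es τ α) (0≤potential es τ α v)

  total-unsat : ∀ es τ → sat τ ≡ false → total es τ ≡ 0ℚ
  total-unsat es τ eq = trans (∑-cong (allFin n) λ v → trans (∑-cong A (vanish v)) (∑-zero A)) (∑-zero (allFin n))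
    where
    vanish : ∀ v α → law es τ α * potential es τ α v ≡ 0ℚ
    vanish v α = trans (cong (_* potential es τ α v) (law-¬Sol es τ α (unsat eq))) (ℚₚ.*-zeroˡ (potential es τ α v))

  module Step (es : List (Fin n)) (bounded : Bounded es) (τ : PA n) (x : Fin n)
              (un : lookup τ x ≡ nothing) (τ-sat : sat τ ≡ true) where

    -- The inverse of `weight τ x`; multiplying by it keeps the step free of divisions.
    W : ℚ
    W = if liquid τ x then 1ℚ + ρ else 1ℚ

    L L′ M : Assignment n → ℚ
    L α  = law es τ α
    L′ α = law es (τ [ x ↦ lookup α x ]) α
    M α  = mix ρ (L′ α) (L α)

    K K′ K″ : Fin n → Assignment n → ℚ
    K v α  = potential es τ α v
    K′ v α = potential es (τ [ x ↦ lookup α x ]) α v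
    K″ v α = potential (x ∷ es) τ α v

    0≤L′ : ∀ α → 0ℚ ≤ L′ α
    0≤L′ α = 0≤law es _ α

    L≤L′ : ∀ α → 0ℚ ≤ L′ α - L α
    L≤L′ α = p≤q⇒0≤q-p (law-mono es τ α x un)

    W-law : ∀ α → W * law (x ∷ es) τ α ≡ M α
    W-law α rewrite un with liquid τ x
    ... | true  = trans (sym (ℚₚ.*-assoc (1ℚ + ρ) w (M α))) (trans (cong (_* M α) w-inverse) (ℚₚ.*-identityˡ (M α)))
    ... | false = trans (ℚₚ.*-identityˡ _) (ℚₚ.*-identityˡ (M α))

    W-expected : ∀ v → ∑ A (λ α → M α * K″ v α) ≡ W * expected (x ∷ es) τ v
    W-expected v = trans
      (∑-cong A λ α → trans (cong (_* K″ v α) (sym (W-law α))) (ℚₚ.*-assoc W (law (x ∷ es) τ α) (K″ v α)))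
      (∑-*ˡ A W _)

    sides : Fin n → ℚ
    sides v = mix ρ (expected es (τ [ x ↦ false ]) v + expected es (τ [ x ↦ true ]) v) (expected es τ v)

    ∑-sides : ∀ v → ∑ A (λ α → mix ρ (L′ α * K′ v α) (L α * K v α)) ≡ sides v
    ∑-sides v = trans (∑-mix A ρ _ _) (cong (λ a → mix ρ a (expected es τ v)) (∑-split es τ x (λ τ′ α → potential es τ′ α v)))

    ∑-L′ : ∑ A L′ ≡ indicator (sat (τ [ x ↦ false ])) + indicator (sat (τ [ x ↦ true ]))
    ∑-L′ = trans (∑-split₁ es τ x) (cong₂ _+_ (∑-law es _) (∑-law es _))

    ∑-L : ∑ A L ≡ 1ℚ
    ∑-L = trans (∑-law es τ) (cong indicator τ-sat)

    -- For a frozen `v`, setting `x` raises the law of α and lowers the cost of `v`, so the mean of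
    -- the products is at most the product of the means. For a liquid `v`, one limit bounds the
    -- potential in both branches.
    pointwise-other : ∀ v → x ≢ v → ∀ α → mix ρ (L′ α * K′ v α) (L α * K v α) ≤ M α * K″ v α
    pointwise-other v x≢v α with Sol? τ α
    ... | no ¬s rewrite law-¬Sol es τ α ¬s | law-¬Sol es (τ [ x ↦ lookup α x ]) α (¬s ∘ Sol-⊑ (⊑-↦ _ un)) =
      ℚₚ.≤-reflexive (lemma ρ (K′ v α) (K v α) (K″ v α))
      where
      lemma : ∀ r a b c → r * (0ℚ * a) + (1ℚ - r) * (0ℚ * b) ≡ (r * 0ℚ + (1ℚ - r) * 0ℚ) * c
      lemma = solve-∀ ℚ-ring
    ... | yes s rewrite un | lookup-↦′ (x≢v ∘ sym) τ (lookup α x) with lookup τ v in eqv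
    ...   | just _ = ℚₚ.≤-reflexive (lemma ρ (L′ α) (L α))
      where
      lemma : ∀ r a b → r * (a * 0ℚ) + (1ℚ - r) * (b * 0ℚ) ≡ (r * a + (1ℚ - r) * b) * 0ℚ
      lemma = solve-∀ ℚ-ring
    ...   | nothing with liquid τ v in liq
    ...     | false with liquid (τ [ x ↦ lookup α x ]) v in liq′
    ...       | true  = case trans (sym liq) (liquid-⊑ v (⊑-↦ _ un) liq′) of λ ()
    ...       | false with x Fin.≟ v
    ...         | yes x≡v = contradiction x≡v x≢v
    ...         | no _ = chebyshev′ 0≤ρ ρ≤1 (0≤* (L≤L′ α) (p≤q⇒0≤q-p (cost-mono es τ α v x un)))
    pointwise-other v x≢v α | yes s | nothing | true with x Fin.≟ v
    ... | yes x≡v = contradiction x≡v x≢v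
    ... | no _ = ℚₚ.≤-trans (mix-mono 0≤ρ ρ≤1 (*-monoʳ (0≤L′ α) K′≤) ℚₚ.≤-refl)
                            (ℚₚ.≤-reflexive (lemma ρ (L′ α) (L α) l))
      where
      l = limit (occurrences v es)
      lemma : ∀ r a b c → r * (a * c) + (1ℚ - r) * (b * c) ≡ (r * a + (1ℚ - r) * b) * c
      lemma = solve-∀ ℚ-ring
      K′≤ : (if liquid (τ [ x ↦ lookup α x ]) v then l else cost es (τ [ x ↦ lookup α x ]) α v) ≤ l
      K′≤ with liquid (τ [ x ↦ lookup α x ]) v in liq′
      ... | true  = ℚₚ.≤-refl
      -- Setting `x` has frozen `v`: the charge made in advance covers the cost that it now has.
      ... | false = bounded _ α v (Sol-↦ s refl) (trans (lookup-↦′ (x≢v ∘ sym) τ (lookup α x)) eqv) liq′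

    step-other : ∀ v → x ≢ v → sides v ≤ W * expected (x ∷ es) τ v
    step-other v x≢v = subst₂ _≤_ (∑-sides v) (W-expected v) (∑-mono A (pointwise-other v x≢v))

    -- The potential released by picking `x`, per unit of ρ; it has to pay for a possible coin.
    gain : ℚ
    gain = if liquid τ x then 1ℚ else guessed τ x

    0≤gain : 0ℚ ≤ gain
    0≤gain with liquid τ x
    ... | true  = 0≤1
    ... | false = 0≤guessed τ x

    -- With `y = (1 - ρ) ^^ occurrences x es`, the part of the right side beyond the first summand
    -- is `ρ σ L′ + ρ (1 - ρ) y (L′ - L)`. Here `½ ≤ σ` enters: since `L′` has total mass 2 for a
    -- liquid `x`, the term `ρ ½ L′` sums to ρ.
    pointwise-liquid : liquid τ x ≡ true → ∀ α →
      mix ρ (L′ α * K′ x α) (L α * K x α) + ρ * ½ * L′ α ≤ M α * K″ x α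
    pointwise-liquid liq α rewrite lookup-↦ τ x (lookup α x) | un | liq with x Fin.≟ x
    ... | no x≢x = contradiction refl x≢x
    ... | yes _ = ≤-by (0≤+ (0≤* (0≤* 0≤ρ (0≤L′ α)) (p≤q⇒0≤q-p ½≤σ))
                            (0≤* (0≤* 0≤ρ (0≤* 0≤1-ρ (0≤^^ (occurrences x es) 0≤1-ρ))) (L≤L′ α)))
                       (lemma ρ (L′ α) (L α) σ ((1ℚ - ρ) ^^ occurrences x es))
      where
      lemma : ∀ r a b s y →
              (r * a + (1ℚ - r) * b) * (s + (1ℚ - r) * y) ≡
              r * (a * 0ℚ) + (1ℚ - r) * (b * (s + y)) + r * ½ * a +
              (r * a * (s - ½) + r * ((1ℚ - r) * y) * (a - b))
      lemma = solve-∀ ℚ-ring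

    pointwise-frozen : liquid τ x ≡ false → ∀ α →
      mix ρ (L′ α * K′ x α) (L α * K x α) + ρ * guessed τ x * M α ≤ M α * K″ x α
    pointwise-frozen liq α rewrite lookup-↦ τ x (lookup α x) | un | liq with x Fin.≟ x
    ... | no x≢x = contradiction refl x≢x
    ... | yes _ = ≤-by (0≤* (0≤* (0≤* 0≤ρ 0≤1-ρ) (L≤L′ α)) (0≤cost es τ α x))
                       (lemma ρ (L′ α) (L α) (guessed τ x) (cost es τ α x))
      where
      lemma : ∀ r a b g c →
              (r * a + (1ℚ - r) * b) * (r * g + (1ℚ - r) * c) ≡
              r * (a * 0ℚ) + (1ℚ - r) * (b * c) + r * g * (r * a + (1ℚ - r) * b) +
              r * (1ℚ - r) * (a - b) * c
      lemma = solve-∀ ℚ-ring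

    step-self : sides x + ρ * gain ≤ W * expected (x ∷ es) τ x
    step-self = by-kind (liquid τ x) refl
      where
      open ℚₚ.≤-Reasoning
      by-kind : ∀ b → liquid τ x ≡ b → sides x + ρ * gain ≤ W * expected (x ∷ es) τ x
      by-kind true liq = begin
        sides x + ρ * gain
          ≡⟨ cong₂ _+_ (sym (∑-sides x)) gain≡ ⟩
        ∑ A (λ α → mix ρ (L′ α * K′ x α) (L α * K x α)) + ∑ A (λ α → ρ * ½ * L′ α)
          ≡⟨ sym (∑-+ A _ _) ⟩
        ∑ A (λ α → mix ρ (L′ α * K′ x α) (L α * K x α) + ρ * ½ * L′ α)
          ≤⟨ ∑-mono A (pointwise-liquid liq) ⟩
        ∑ A (λ α → M α * K″ x α)
          ≡⟨ W-expected x ⟩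
        W * expected (x ∷ es) τ x ∎
        where
        lemma : ∀ r → r * 1ℚ ≡ r * ½ * (1ℚ + 1ℚ)
        lemma = solve-∀ ℚ-ring
        gain≡ : ρ * gain ≡ ∑ A (λ α → ρ * ½ * L′ α)
        gain≡ = trans (cong (λ b → ρ * (if b then 1ℚ else guessed τ x)) liq)
          (trans (lemma ρ) (sym (trans (∑-*ˡ A (ρ * ½) L′) (cong (ρ * ½ *_) (trans ∑-L′
            (cong₂ _+_ (cong indicator (proj₁ (∧⁻ {sat (τ [ x ↦ false ])} liq))) (cong indicator (proj₂ (∧⁻ {sat (τ [ x ↦ false ])} liq)))))))))
      by-kind false liq = begin
        sides x + ρ * gain
          ≡⟨ cong₂ _+_ (sym (∑-sides x)) gain≡ ⟩
        ∑ A (λ α → mix ρ (L′ α * K′ x α) (L α * K x α)) + ∑ A (λ α → ρ * guessed τ x * M α)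
          ≡⟨ sym (∑-+ A _ _) ⟩
        ∑ A (λ α → mix ρ (L′ α * K′ x α) (L α * K x α) + ρ * guessed τ x * M α)
          ≤⟨ ∑-mono A (pointwise-frozen liq) ⟩
        ∑ A (λ α → M α * K″ x α)
          ≡⟨ W-expected x ⟩
        W * expected (x ∷ es) τ x ∎
        where
        ∑-M : ∑ A M ≡ 1ℚ
        ∑-M = trans (∑-mix A ρ L′ L) (trans (cong₂ (mix ρ) (trans ∑-L′ (xor-indicator {sat (τ [ x ↦ false ])} (sat-cases {τ} x τ-sat) liq)) ∑-L) (mix-const ρ 1ℚ))
        gain≡ : ρ * gain ≡ ∑ A (λ α → ρ * guessed τ x * M α)
        gain≡ = trans (cong (λ b → ρ * (if b then 1ℚ else guessed τ x)) liq)
          (sym (trans (∑-*ˡ A (ρ * guessed τ x) M) (trans (cong (ρ * guessed τ x *_) ∑-M) (ℚₚ.*-identityʳ _))))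

    step-any : ∀ v → sides v ≤ W * expected (x ∷ es) τ v
    step-any v = by-cases (x Fin.≟ v)
      where
      by-cases : Dec (x ≡ v) → sides v ≤ W * expected (x ∷ es) τ v
      by-cases (no x≢v)   = step-other v x≢v
      by-cases (yes refl) = ℚₚ.≤-trans (≤-by (0≤* 0≤ρ 0≤gain) refl) step-self

    -- For a liquid `x` the coefficients of the three totals add up to `ρ + ρ + (1 - ρ) = W`, so
    -- after division by `W` this compares the potential before an event with an average of those
    -- after it.
    step-total : mix ρ (total es (τ [ x ↦ false ]) + total es (τ [ x ↦ true ])) (total es τ) + ρ * gain ≤
                 W * total (x ∷ es) τ
    step-total = subst₂ _≤_ (cong (_+ ρ * gain) ∑-sides′) (∑-*ˡ (allFin n) W _)
                   (∑-mono-gain (∈-allFin x) step-any step-self)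
      where
      ∑-sides′ : ∑ (allFin n) sides ≡ mix ρ (total es (τ [ x ↦ false ]) + total es (τ [ x ↦ true ])) (total es τ)
      ∑-sides′ = trans (∑-mix (allFin n) ρ _ _) (cong (λ a → mix ρ a (total es τ)) (∑-+ (allFin n) _ _))

-- The success probability compared with the potential

module Algorithm {n} (cls : List (Clause n)) (d : ℕ) (ρ : ℚ) (final : PA n → ℚ) where

  open Refutation cls

  picked : PA n → Fin n → (Bool → ℚ) → ℚ
  picked τ x f =
    if refute d (τ [ x ↦ true ]) then f false else
    if refute d (τ [ x ↦ false ]) then f true else
    ½ * (f false + f true)

  -- The success probability of the algorithm with the given variables still to
  -- be considered.
  success : List (Fin n) → PA n → ℚ
  success []       τ = final τ
  success (x ∷ es) τ = unassigned? (lookup τ x) (success es τ)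
    (mix ρ (picked τ x (λ b → success es (τ [ x ↦ b ]))) (success es τ))

module Success {n} (cls : List (Clause n)) (d : ℕ) (ρ w : ℚ) (0≤ρ : 0ℚ ≤ ρ) (ρ≤1 : ρ ≤ 1ℚ)
               (0≤w : 0ℚ ≤ w) (w≤1 : w ≤ 1ℚ) (w-inverse : (1ℚ + ρ) * w ≡ 1ℚ)
               (σ : ℚ) (½≤σ : ½ ≤ σ)
               (final : PA n → ℚ) (0≤final : ∀ τ → 0ℚ ≤ final τ) where

  open Refutation cls
  open Algorithm cls d ρ final
  open Process cls d ρ w 0≤ρ ρ≤1 0≤w w≤1 w-inverse
  open Cost cls d ρ w 0≤ρ ρ≤1 0≤w w≤1 w-inverse σ ½≤σ

  0≤picked : ∀ τ x f → (∀ b → 0ℚ ≤ f b) → 0ℚ ≤ picked τ x f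
  0≤picked τ x f h with refute d (τ [ x ↦ true ])
  ... | true  = h false
  ... | false with refute d (τ [ x ↦ false ])
  ...   | true  = h true
  ...   | false = 0≤* 0≤½ (0≤+ (h false) (h true))

  0≤success : ∀ es τ → 0ℚ ≤ success es τ
  0≤success []       τ = 0≤final τ
  0≤success (x ∷ es) τ with lookup τ x
  ... | just _  = 0≤success es τ
  ... | nothing = 0≤mix 0≤ρ ρ≤1 (0≤picked τ x _ (λ b → 0≤success es (τ [ x ↦ b ]))) (0≤success es τ)

  -- Convexity of 2^-t enters through the chords between consecutive integers:
  -- m ↦ 2^-m (1 + m - t) is the chord over [m-1, m] as a function of t.
  ChordBound : List (Fin n) → PA n → Set
  ChordBound es τ = ∀ m → 1ℚ + natℚ m - total es τ ≤ 2ℚ ^^ m * success es τ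

  -- The factor ½ of a coin is absorbed by passing from the chord of `m` to that of its predecessor;
  -- for `m = 0` the left side is not positive.
  half : ∀ {es τ} → ChordBound es τ → ∀ m → natℚ m - total es τ ≤ 2ℚ ^^ m * (½ * success es τ)
  half {es} {τ} h zero    rewrite natℚ-zero = ℚₚ.≤-trans (≤-by (0≤total es τ) (lemma (total es τ)))
                              (0≤* 0≤1 (0≤* 0≤½ (0≤success es τ)))
    where
    lemma : ∀ a → 0ℚ ≡ 0ℚ - a + a
    lemma = solve-∀ ℚ-ring
  half {es} {τ} h (suc m) rewrite natℚ-suc m = ℚₚ.≤-trans (h m) (ℚₚ.≤-reflexive (lemma (2ℚ ^^ m) (success es τ)))
    where
    lemma : ∀ a b → a * b ≡ (1ℚ + 1ℚ) * a * (½ * b)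
    lemma = solve-∀ ℚ-ring

  not-refuted : ∀ {τ} → sat τ ≡ true → refute d τ ≡ false
  not-refuted {τ} eq with refute d τ in eq′
  ... | false = refl
  ... | true  = contradiction (proj₂ (sat⁻ eq)) (refute-sound d eq′)

  -- The right value `b` is never refuted. If the wrong one is refuted, `b` is certain; otherwise a
  -- coin is thrown, the success of the wrong branch is dropped, and `guessed` supplies the unit
  -- that `half` needs.
  picked-frozen : ∀ {es τ x} b → sat (τ [ x ↦ b ]) ≡ true → ChordBound es (τ [ x ↦ b ]) → ∀ m →
    1ℚ + natℚ m - total es (τ [ x ↦ b ]) - guessed τ x ≤ 2ℚ ^^ m * picked τ x (λ b → success es (τ [ x ↦ b ]))
  picked-frozen {es} {τ} {x} b b-sat h m = by-value b b-sat h
    where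
    S : Bool → ℚ
    S b = success es (τ [ x ↦ b ])
    T : Bool → ℚ
    T b = total es (τ [ x ↦ b ])
    drop-0 : ∀ a → a - 0ℚ ≡ a
    drop-0 = solve-∀ ℚ-ring
    drop-1 : ∀ a b → 1ℚ + a - b - 1ℚ ≡ a - b
    drop-1 = solve-∀ ℚ-ring
    coin : ∀ b → natℚ m - T b ≤ 2ℚ ^^ m * (½ * S b) → ∀ c → 0ℚ ≤ c → ∀ s → s ≡ S b + c →
           1ℚ + natℚ m - T b - 1ℚ ≤ 2ℚ ^^ m * (½ * s)
    coin b h c 0≤c s eq = begin
      1ℚ + natℚ m - T b - 1ℚ  ≡⟨ drop-1 (natℚ m) (T b) ⟩
      natℚ m - T b  ≤⟨ h ⟩
      2ℚ ^^ m * (½ * S b)  ≤⟨ *-monoʳ (0≤^^ m 0≤2) (*-monoʳ 0≤½ (≤-by {S b} 0≤c eq)) ⟩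
      2ℚ ^^ m * (½ * s)  ∎
      where open ℚₚ.≤-Reasoning
    by-value : ∀ b → sat (τ [ x ↦ b ]) ≡ true → ChordBound es (τ [ x ↦ b ]) →
      1ℚ + natℚ m - T b - guessed τ x ≤ 2ℚ ^^ m * picked τ x S
    by-value true b-sat h rewrite not-refuted b-sat with refute d (τ [ x ↦ false ])
    ... | true  = ℚₚ.≤-trans (ℚₚ.≤-reflexive (drop-0 _)) (h m)
    ... | false = coin true (half {es} h m) (S false) (0≤success es _) (S false + S true) (ℚₚ.+-comm (S false) (S true))
    by-value false b-sat h rewrite not-refuted b-sat with refute d (τ [ x ↦ true ])
    ... | true  = ℚₚ.≤-trans (ℚₚ.≤-reflexive (drop-0 _)) (h m)
    ... | false = coin false (half {es} h m) (S true) (0≤success es _) (S false + S true) refl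

  -- When z = 1 + m - C exceeds 1, the gain ρ z of normalisation pays for the
  -- guess; otherwise the chord of m + 1 lies above that of m.
  from-affine : ∀ {S} → 0ℚ ≤ S → ∀ C → (∀ m → (1ℚ + ρ) * (1ℚ + natℚ m - C) - ρ ≤ 2ℚ ^^ m * S) →
                ∀ m → 1ℚ + natℚ m - C ≤ 2ℚ ^^ m * S
  from-affine {S} 0≤S C h m with ℚₚ.≤-total 1ℚ (1ℚ + natℚ m - C)
  ... | inj₁ 1≤z = ℚₚ.≤-trans (≤-by (0≤* 0≤ρ (p≤q⇒0≤q-p 1≤z)) (lemma ρ (1ℚ + natℚ m - C))) (h m)
    where
    lemma : ∀ r z → (1ℚ + r) * z - r ≡ z + r * (z - 1ℚ)
    lemma = solve-∀ ℚ-ring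
  ... | inj₂ z≤1 with ℚₚ.≤-total 0ℚ (1ℚ + natℚ m - C)
  ...   | inj₂ z≤0 = ℚₚ.≤-trans z≤0 (0≤* (0≤^^ m 0≤2) 0≤S)
  ...   | inj₁ 0≤z = begin
    z  ≤⟨ ≤-by (0≤* 0≤½ (0≤+ (p≤q⇒0≤q-p z≤1) (0≤* 0≤ρ 0≤z))) (lemma ρ (natℚ m) C) ⟩
    ½ * ((1ℚ + ρ) * (1ℚ + (1ℚ + natℚ m) - C) - ρ)  ≡⟨ cong (λ i → ½ * ((1ℚ + ρ) * (1ℚ + i - C) - ρ)) (sym (natℚ-suc m)) ⟩
    ½ * ((1ℚ + ρ) * (1ℚ + natℚ (suc m) - C) - ρ)  ≤⟨ *-monoʳ 0≤½ (h (suc m)) ⟩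
    ½ * (2ℚ ^^ suc m * S)  ≡⟨ lemma₂ (2ℚ ^^ m) S ⟩
    2ℚ ^^ m * S  ∎
    where
    open ℚₚ.≤-Reasoning
    z = 1ℚ + natℚ m - C
    lemma : ∀ r i C → ½ * ((1ℚ + r) * (1ℚ + (1ℚ + i) - C) - r) ≡
                      1ℚ + i - C + ½ * (1ℚ - (1ℚ + i - C) + r * (1ℚ + i - C))
    lemma = solve-∀ ℚ-ring
    lemma₂ : ∀ a b → ½ * ((1ℚ + 1ℚ) * a * b) ≡ a * b
    lemma₂ = solve-∀ ℚ-ring

  -- Each event turns the inequality of potentials given by `step-total` into one between chords,
  -- which is legitimate since chords are affine in the potential.
  chord : (∀ τ → sat τ ≡ true → ∀ m → 1ℚ + natℚ m - unassigned τ ≤ 2ℚ ^^ m * final τ) →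
          ∀ es → BoundedTails es → ∀ τ → sat τ ≡ true → ChordBound es τ
  chord final-chord [] _ τ τ-sat m = ℚₚ.≤-trans (≤-by (p≤q⇒0≤q-p unassigned≤) (lemma (natℚ m) (unassigned τ) (total [] τ))) (final-chord τ τ-sat m)
    where
    lemma : ∀ a u t → 1ℚ + a - u ≡ 1ℚ + a - t + (t - u)
    lemma = solve-∀ ℚ-ring
    U : Fin n → ℚ
    U v = unassigned? (lookup τ v) 0ℚ 1ℚ
    U≤ : ∀ v α → U v ≤ potential [] τ α v
    U≤ v α with lookup τ v
    ... | just _ = ℚₚ.≤-refl
    ... | nothing with liquid τ v
    -- With no events left the limit is `σ + (1 - ρ) ^^ 0`, hence at least the one unit that the
    -- final coin costs.
    ...   | true  = ≤-by (ℚₚ.≤-trans 0≤½ ½≤σ) (ℚₚ.+-comm σ 1ℚ)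
    ...   | false = ℚₚ.≤-refl
    unassigned≤ : unassigned τ ≤ total [] τ
    unassigned≤ = ∑-mono (allFin n) λ v → begin
      U v  ≡⟨ sym (ℚₚ.*-identityˡ (U v)) ⟩
      1ℚ * U v  ≡⟨ cong (_* U v) (sym (trans (∑-law [] τ) (cong indicator τ-sat))) ⟩
      ∑ A (law [] τ) * U v  ≡⟨ sym (∑-*ʳ A (U v) (law [] τ)) ⟩
      ∑ A (λ α → law [] τ α * U v)  ≤⟨ ∑-mono A (λ α → *-monoʳ (0≤law [] τ α) (U≤ v α)) ⟩
      expected [] τ v  ∎
      where open ℚₚ.≤-Reasoning
  chord final-chord (x ∷ es) (bounded , tails) τ τ-sat = by-status (lookup τ x) refl
    where
    ih : ∀ τ → sat τ ≡ true → ChordBound es τ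
    ih = chord final-chord es tails
    S : Bool → ℚ
    S b = success es (τ [ x ↦ b ])
    T : Bool → ℚ
    T b = total es (τ [ x ↦ b ])
    skip : ∀ {b} → lookup τ x ≡ just b → total es τ ≤ total (x ∷ es) τ
    skip {b} eq = ∑-mono (allFin n) λ v → ∑-mono A λ α → pointwise v α
      where
      pointwise : ∀ v α → law es τ α * potential es τ α v ≤ law (x ∷ es) τ α * potential (x ∷ es) τ α v
      pointwise v α rewrite eq with x Fin.≟ v
      ... | no _ = ℚₚ.≤-refl
      ... | yes refl rewrite eq = ℚₚ.≤-refl
    by-status : ∀ s → lookup τ x ≡ s → ChordBound (x ∷ es) τ
    by-status (just b) eq m = begin
      1ℚ + natℚ m - total (x ∷ es) τ  ≤⟨ ℚₚ.+-monoʳ-≤ (1ℚ + natℚ m) (ℚₚ.neg-antimono-≤ (skip eq)) ⟩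
      1ℚ + natℚ m - total es τ  ≤⟨ ih τ τ-sat m ⟩
      2ℚ ^^ m * success es τ  ≡⟨ cong (λ s → 2ℚ ^^ m * unassigned? s (success es τ) (mix ρ (picked τ x S) (success es τ))) (sym eq) ⟩
      2ℚ ^^ m * success (x ∷ es) τ  ∎
      where open ℚₚ.≤-Reasoning
    by-status nothing un = by-kind (liquid τ x) refl
      where
      open Step es bounded τ x un τ-sat using (gain; step-total)
      open ℚₚ.≤-Reasoning
      C = total (x ∷ es) τ
      success≡ : success (x ∷ es) τ ≡ mix ρ (picked τ x S) (success es τ)
      success≡ = cong (λ s → unassigned? s (success es τ) (mix ρ (picked τ x S) (success es τ))) un
      distribute : ∀ m → mix ρ (2ℚ ^^ m * picked τ x S) (2ℚ ^^ m * success es τ) ≡ 2ℚ ^^ m * success (x ∷ es) τ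
      distribute m = trans (lemma ρ (2ℚ ^^ m) (picked τ x S) (success es τ)) (cong (2ℚ ^^ m *_) (sym success≡))
        where
        lemma : ∀ r a p s → r * (a * p) + (1ℚ - r) * (a * s) ≡ a * (r * p + (1ℚ - r) * s)
        lemma = solve-∀ ℚ-ring

      frozen : ∀ b → liquid τ x ≡ false → sat (τ [ x ↦ b ]) ≡ true → T false + T true ≡ T b → ChordBound (x ∷ es) τ
      frozen b liq b-sat T≡ m = begin
        1ℚ + natℚ m - C
          ≤⟨ ≤-by (p≤q⇒0≤q-p cost-step) (lemma ρ (natℚ m) (T b) (guessed τ x) (total es τ) C) ⟩
        mix ρ (1ℚ + natℚ m - T b - guessed τ x) (1ℚ + natℚ m - total es τ)
          ≤⟨ mix-mono 0≤ρ ρ≤1 (picked-frozen {es} b b-sat (ih _ b-sat) m) (ih τ τ-sat m) ⟩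
        mix ρ (2ℚ ^^ m * picked τ x S) (2ℚ ^^ m * success es τ)
          ≡⟨ distribute m ⟩
        2ℚ ^^ m * success (x ∷ es) τ ∎
        where
        cost-step : mix ρ (T b) (total es τ) + ρ * guessed τ x ≤ C
        cost-step = subst₂ _≤_
          (cong₂ (λ a c → mix ρ a (total es τ) + ρ * (if c then 1ℚ else guessed τ x)) T≡ liq)
          (trans (cong (λ c → (if c then 1ℚ + ρ else 1ℚ) * C) liq) (ℚₚ.*-identityˡ C))
          step-total
        lemma : ∀ r i t g t′ C → r * (1ℚ + i - t - g) + (1ℚ - r) * (1ℚ + i - t′) ≡
                1ℚ + i - C + (C - (r * t + (1ℚ - r) * t′ + r * g))
        lemma = solve-∀ ℚ-ring

      by-kind : ∀ b → liquid τ x ≡ b → ChordBound (x ∷ es) τ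
      by-kind false liq with sat-cases {τ} x τ-sat
      ... | inj₁ sat₀ = frozen false liq sat₀ (trans (cong (T false +_) (total-unsat es _ (other sat₀ liq))) (ℚₚ.+-identityʳ _))
        where
        other : ∀ {a b} → a ≡ true → a ∧ b ≡ false → b ≡ false
        other refl eq = eq
      ... | inj₂ sat₁ = frozen true liq sat₁ (trans (cong (_+ T true) (total-unsat es _ (other sat₁ liq))) (ℚₚ.+-identityˡ _))
        where
        other : ∀ {a b} → b ≡ true → a ∧ b ≡ false → a ≡ false
        other {false} refl eq = refl
      by-kind true liq = from-affine (0≤success (x ∷ es) τ) C affine
        where
        sat₀ : sat (τ [ x ↦ false ]) ≡ true
        sat₀ = proj₁ (∧⁻ {sat (τ [ x ↦ false ])} liq)
        sat₁ : sat (τ [ x ↦ true ]) ≡ true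
        sat₁ = proj₂ (∧⁻ {sat (τ [ x ↦ false ])} liq)
        cost-step : mix ρ (T false + T true) (total es τ) + ρ * 1ℚ ≤ (1ℚ + ρ) * C
        cost-step = subst₂ _≤_
          (cong (λ c → mix ρ (T false + T true) (total es τ) + ρ * (if c then 1ℚ else guessed τ x)) liq)
          (cong (λ c → (if c then 1ℚ + ρ else 1ℚ) * C) liq)
          step-total
        -- Both values extend to solutions, so neither is refuted and a coin decides.
        picked≡ : picked τ x S ≡ ½ * S false + ½ * S true
        picked≡ rewrite not-refuted sat₀ | not-refuted sat₁ = ℚₚ.*-distribˡ-+ ½ (S false) (S true)
        affine : ∀ m → (1ℚ + ρ) * (1ℚ + natℚ m - C) - ρ ≤ 2ℚ ^^ m * success (x ∷ es) τ
        affine m = begin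
          (1ℚ + ρ) * (1ℚ + natℚ m - C) - ρ
            ≤⟨ ≤-by (p≤q⇒0≤q-p cost-step) (lemma ρ (natℚ m) (T false) (T true) (total es τ) C) ⟩
          mix ρ (natℚ m - T false + (natℚ m - T true)) (1ℚ + natℚ m - total es τ)
            ≤⟨ mix-mono 0≤ρ ρ≤1 (ℚₚ.+-mono-≤ (half {es} (ih _ sat₀) m) (half {es} (ih _ sat₁) m)) (ih τ τ-sat m) ⟩
          mix ρ (2ℚ ^^ m * (½ * S false) + 2ℚ ^^ m * (½ * S true)) (2ℚ ^^ m * success es τ)
            ≡⟨ cong (λ a → mix ρ a (2ℚ ^^ m * success es τ))
                 (trans (sym (ℚₚ.*-distribˡ-+ (2ℚ ^^ m) _ _)) (cong (2ℚ ^^ m *_) (sym picked≡))) ⟩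
          mix ρ (2ℚ ^^ m * picked τ x S) (2ℚ ^^ m * success es τ)
            ≡⟨ distribute m ⟩
          2ℚ ^^ m * success (x ∷ es) τ ∎
          where
          lemma : ∀ r i a b t C → r * (i - a + (i - b)) + (1ℚ - r) * (1ℚ + i - t) ≡
                  (1ℚ + r) * (1ℚ + i - C) - r + ((1ℚ + r) * C - (r * (a + b) + (1ℚ - r) * t + r * 1ℚ))
          lemma = solve-∀ ℚ-ring

-- Random sets of variables

expect : ∀ {n} → Vec ℚ n → (Vec Bool n → ℚ) → ℚ
expect []      f = f []
expect (q ∷ v) f = mix q (expect v (f ∘ (true ∷_))) (expect v (f ∘ (false ∷_)))

record IsProbability {n} (v : Vec ℚ n) : Set where
  constructor probabilities
  field range : ∀ y → 0ℚ ≤ lookup v y × lookup v y ≤ 1ℚ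

open IsProbability public

tail-probability : ∀ {n q} {v : Vec ℚ n} → IsProbability (q ∷ v) → IsProbability v
tail-probability pr = probabilities (range pr ∘ suc)

expect-cong : ∀ {n} (v : Vec ℚ n) {f g} → (∀ B → f B ≡ g B) → expect v f ≡ expect v g
expect-cong []      eq = eq []
expect-cong (q ∷ v) eq = cong₂ (mix q) (expect-cong v (λ B → eq (true ∷ B))) (expect-cong v (λ B → eq (false ∷ B)))

expect-mono : ∀ {n} {v : Vec ℚ n} {f g} → IsProbability v → (∀ B → f B ≤ g B) → expect v f ≤ expect v g
expect-mono {v = []}    pr le = le []
expect-mono {v = q ∷ v} pr le = mix-mono (proj₁ (range pr zero)) (proj₂ (range pr zero))
  (expect-mono (tail-probability pr) (λ B → le (true ∷ B))) (expect-mono (tail-probability pr) (λ B → le (false ∷ B)))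

expect-const : ∀ {n} (v : Vec ℚ n) c → expect v (λ _ → c) ≡ c
expect-const []      c = refl
expect-const (q ∷ v) c = trans (cong₂ (mix q) (expect-const v c) (expect-const v c)) (mix-const q c)

mix-mix : ∀ r q a b c e → mix q (mix r a b) (mix r c e) ≡ mix r (mix q a c) (mix q b e)
mix-mix r q a b c e = lemma r q a b c e
  where
  lemma : ∀ r q a b c e → q * (r * a + (1ℚ - r) * b) + (1ℚ - q) * (r * c + (1ℚ - r) * e) ≡
                          r * (q * a + (1ℚ - q) * c) + (1ℚ - r) * (q * b + (1ℚ - q) * e)
  lemma = solve-∀ ℚ-ring

expect-mix : ∀ {n} (v : Vec ℚ n) r f g → expect v (λ B → mix r (f B) (g B)) ≡ mix r (expect v f) (expect v g)
expect-mix []      r f g = refl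
expect-mix (q ∷ v) r f g =
  trans (cong₂ (mix q) (expect-mix v r _ _) (expect-mix v r _ _))
        (mix-mix r q (expect v (f ∘ (true ∷_))) (expect v (g ∘ (true ∷_))) (expect v (f ∘ (false ∷_))) (expect v (g ∘ (false ∷_))))

expect-complement : ∀ {n} (v : Vec ℚ n) f → expect v (λ B → 1ℚ - f B) ≡ 1ℚ - expect v f
expect-complement []      f = refl
expect-complement (q ∷ v) f = trans (cong₂ (mix q) (expect-complement v _) (expect-complement v _))
                                    (lemma q (expect v (f ∘ (true ∷_))) (expect v (f ∘ (false ∷_))))
  where
  lemma : ∀ q a b → q * (1ℚ - a) + (1ℚ - q) * (1ℚ - b) ≡ 1ℚ - (q * a + (1ℚ - q) * b)
  lemma = solve-∀ ℚ-ring

expect-coordinate : ∀ {n} (v : Vec ℚ n) y f →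
  expect v f ≡ mix (lookup v y) (expect v (λ B → f (B [ y ]≔ true))) (expect v (λ B → f (B [ y ]≔ false)))
expect-coordinate (q ∷ v) zero    f = sym (cong₂ (mix q) (mix-const q _) (mix-const q _))
expect-coordinate (q ∷ v) (suc y) f =
  trans (cong₂ (mix q) (expect-coordinate v y _) (expect-coordinate v y _)) (mix-mix (lookup v y) q _ _ _ _)

expect-independent : ∀ {n} (v : Vec ℚ n) y q b (f : Vec Bool n → ℚ) →
  expect (v [ y ]≔ q) (λ B → f (B [ y ]≔ b)) ≡ expect v (λ B → f (B [ y ]≔ b))
expect-independent (q′ ∷ v) zero    q b f = trans (mix-const q _) (sym (mix-const q′ _))
expect-independent (q′ ∷ v) (suc y) q b f =
  cong₂ (mix q′) (expect-independent v y q b (f ∘ (true ∷_))) (expect-independent v y q b (f ∘ (false ∷_)))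

expect-zeros : ∀ {n} f → expect (replicate n 0ℚ) f ≡ f (replicate n false)
expect-zeros {zero}  f = refl
expect-zeros {suc n} f = trans (lemma (expect (replicate n 0ℚ) (f ∘ (true ∷_))) (expect (replicate n 0ℚ) (f ∘ (false ∷_))))
                               (expect-zeros (f ∘ (false ∷_)))
  where
  lemma : ∀ a b → 0ℚ * a + (1ℚ - 0ℚ) * b ≡ b
  lemma = solve-∀ ℚ-ring

record _≼_ {n} (B B′ : Vec Bool n) : Set where
  constructor mk≼
  field ≼-lookup : ∀ y → lookup B y ≡ true → lookup B′ y ≡ true

open _≼_ public

Increasing : ∀ {n} → (Vec Bool n → ℚ) → Set
Increasing f = ∀ {B B′} → B ≼ B′ → f B ≤ f B′

∷-≼ : ∀ {n} b {B B′ : Vec Bool n} → B ≼ B′ → (b ∷ B) ≼ (b ∷ B′)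
∷-≼ b B≼B′ = mk≼ λ { zero → id ; (suc y) → ≼-lookup B≼B′ y }

false≼true : ∀ {n} (B : Vec Bool n) → (false ∷ B) ≼ (true ∷ B)
false≼true B = mk≼ λ { zero _ → refl ; (suc y) → id }

-- By induction on the coordinates: the conditional means of `f` and `g` given the first coordinate
-- are ordered alike, so the two-point Chebyshev inequality applies to them.
harris : ∀ {n} {v : Vec ℚ n} {f g} → IsProbability v → Increasing f → Increasing g →
         expect v f * expect v g ≤ expect v (λ B → f B * g B)
harris {v = []}            pr f↑ g↑ = ℚₚ.≤-refl
harris {v = q ∷ v} {f} {g} pr f↑ g↑ = ℚₚ.≤-trans
  (chebyshev 0≤q q≤1 (0≤* (gap f f↑) (gap g g↑)))
  (mix-mono 0≤q q≤1 (harris {f = f ∘ (true ∷_)} {g ∘ (true ∷_)} (tail-probability pr) (f↑ ∘ ∷-≼ true) (g↑ ∘ ∷-≼ true))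
                    (harris {f = f ∘ (false ∷_)} {g ∘ (false ∷_)} (tail-probability pr) (f↑ ∘ ∷-≼ false) (g↑ ∘ ∷-≼ false)))
  where
  0≤q = proj₁ (range pr zero)
  q≤1 = proj₂ (range pr zero)
  gap : ∀ h → Increasing h → 0ℚ ≤ expect v (h ∘ (true ∷_)) - expect v (h ∘ (false ∷_))
  gap h h↑ = p≤q⇒0≤q-p (expect-mono (tail-probability pr) (λ B → h↑ (false≼true B)))

fillWith : Maybe Bool → Bool → Bool → Maybe Bool
fillWith (just b) _     _ = just b
fillWith nothing  true  a = just a
fillWith nothing  false a = nothing

-- The partial assignment reached from τ when the variables in the random set `B` have been picked
-- and have received their values in α.
fill : ∀ {n} → PA n → Assignment n → Vec Bool n → PA n
fill []      []      []      = []
fill (m ∷ τ) (a ∷ α) (c ∷ B) = fillWith m c a ∷ fill τ α B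

lookup-fill : ∀ {n} (τ : PA n) α B y → lookup (fill τ α B) y ≡ fillWith (lookup τ y) (lookup B y) (lookup α y)
lookup-fill (m ∷ τ) (a ∷ α) (c ∷ B) zero    = refl
lookup-fill (m ∷ τ) (a ∷ α) (c ∷ B) (suc y) = lookup-fill τ α B y

fill-none : ∀ {n} (τ : PA n) α → fill τ α (replicate n false) ≡ τ
fill-none []            []      = refl
fill-none (just b ∷ τ)  (a ∷ α) = cong (just b ∷_) (fill-none τ α)
fill-none (nothing ∷ τ) (a ∷ α) = cong (nothing ∷_) (fill-none τ α)

fill-⊑ : ∀ {n} (τ : PA n) α B → τ ⊑ fill τ α B
fill-⊑ τ α B = mk⊑ λ y b eq → trans (lookup-fill τ α B y) (cong (λ m → fillWith m (lookup B y) (lookup α y)) eq)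

fill-mono : ∀ {n} (τ : PA n) α {B B′} → B ≼ B′ → fill τ α B ⊑ fill τ α B′
fill-mono τ α {B} {B′} B≼B′ = mk⊑ λ y b eq → trans (lookup-fill τ α B′ y) (go y b (trans (sym (lookup-fill τ α B y)) eq))
  where
  go : ∀ y b → fillWith (lookup τ y) (lookup B y) (lookup α y) ≡ just b →
       fillWith (lookup τ y) (lookup B′ y) (lookup α y) ≡ just b
  go y b eq with lookup τ y
  ... | just _ = eq
  ... | nothing with lookup B y | ≼-lookup B≼B′ y
  ...   | true | h rewrite h refl = eq

fill-≔ : ∀ {n} (τ : PA n) α B y → lookup τ y ≡ nothing →
         fill τ α (B [ y ]≔ true) ≡ fill τ α (B [ y ]≔ false) [ y ↦ lookup α y ]
fill-≔ (nothing ∷ τ) (a ∷ α) (c ∷ B) zero    un = refl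
fill-≔ (m ∷ τ)       (a ∷ α) (c ∷ B) (suc y) un = cong (fillWith m c a ∷_) (fill-≔ τ α B y un)

fill-≔-⊑ : ∀ {n} (τ : PA n) α B y b → (fill (τ [ y ↦ b ]) α B) ⊑ (fill τ α (B [ y ]≔ false) [ y ↦ b ])
fill-≔-⊑ τ α B y b = mk⊑ λ z c eq → go z c (trans (sym (lookup-fill (τ [ y ↦ b ]) α B z)) eq)
  where
  go : ∀ z c → fillWith (lookup (τ [ y ↦ b ]) z) (lookup B z) (lookup α z) ≡ just c →
       lookup (fill τ α (B [ y ]≔ false) [ y ↦ b ]) z ≡ just c
  go z c eq with z Fin.≟ y
  ... | yes refl rewrite lookup-↦ τ y b = trans (lookup-↦ (fill τ α (B [ y ]≔ false)) y b) eq
  ... | no z≢y = begin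
    lookup (fill τ α (B [ y ]≔ false) [ y ↦ b ]) z  ≡⟨ lookup-↦′ z≢y (fill τ α (B [ y ]≔ false)) b ⟩
    lookup (fill τ α (B [ y ]≔ false)) z  ≡⟨ lookup-fill τ α _ z ⟩
    fillWith (lookup τ z) (lookup (B [ y ]≔ false) z) (lookup α z)  ≡⟨ cong₂ (λ m c → fillWith m c (lookup α z))
                                                                              (sym (lookup-↦′ z≢y τ b)) (Vecₚ.lookup∘update′ z≢y B false) ⟩
    fillWith (lookup (τ [ y ↦ b ]) z) (lookup B z) (lookup α z)  ≡⟨ eq ⟩
    just c  ∎
    where open ≡-Reasoning

override : ∀ {n} → PA n → Assignment n → Assignment n
override []            []      = []
override (just b ∷ τ)  (a ∷ α) = b ∷ override τ α
override (nothing ∷ τ) (a ∷ α) = a ∷ override τ α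

override-assigned : ∀ {n} (τ : PA n) α y {b} → lookup τ y ≡ just b → lookup (override τ α) y ≡ b
override-assigned (just b ∷ τ)  (a ∷ α) zero    refl = refl
override-assigned (just b ∷ τ)  (a ∷ α) (suc y) eq   = override-assigned τ α y eq
override-assigned (nothing ∷ τ) (a ∷ α) (suc y) eq   = override-assigned τ α y eq

override-unassigned : ∀ {n} (τ : PA n) α y → lookup τ y ≡ nothing → lookup (override τ α) y ≡ lookup α y
override-unassigned (nothing ∷ τ) (a ∷ α) zero    eq = refl
override-unassigned (just b ∷ τ)  (a ∷ α) (suc y) eq = override-unassigned τ α y eq
override-unassigned (nothing ∷ τ) (a ∷ α) (suc y) eq = override-unassigned τ α y eq

-- A lower bound for the probability that a critical clause tree of depth k in
-- which every node has three children is cut, when each of its labels belongs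
-- to the random set with probability r.
cut : ℕ → ℚ → ℚ
cut zero    r = 0ℚ
cut (suc k) r = mix r 1ℚ (cut k r) ^^ 3

^^≤1 : ∀ {x} m → 0ℚ ≤ x → x ≤ 1ℚ → x ^^ m ≤ 1ℚ
^^≤1 zero    0≤x x≤1 = ℚₚ.≤-refl
^^≤1 (suc m) 0≤x x≤1 = *-mono 0≤x 0≤1 x≤1 (^^≤1 m 0≤x x≤1)

^^-mono : ∀ {x y} m → 0ℚ ≤ x → x ≤ y → x ^^ m ≤ y ^^ m
^^-mono zero    0≤x x≤y = ℚₚ.≤-refl
^^-mono (suc m) 0≤x x≤y = *-mono 0≤x (0≤^^ m (ℚₚ.≤-trans 0≤x x≤y)) x≤y (^^-mono m 0≤x x≤y)

cut-range : ∀ k {r} → 0ℚ ≤ r → r ≤ 1ℚ → 0ℚ ≤ cut k r × cut k r ≤ 1ℚ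
cut-range zero    0≤r r≤1 = ℚₚ.≤-refl , 0≤1
cut-range (suc k) {r} 0≤r r≤1 = 0≤^^ 3 0≤t , ^^≤1 3 0≤t t≤1
  where
  0≤t : 0ℚ ≤ mix r 1ℚ (cut k r)
  0≤t = 0≤mix 0≤r r≤1 0≤1 (proj₁ (cut-range k 0≤r r≤1))
  t≤1 : mix r 1ℚ (cut k r) ≤ 1ℚ
  t≤1 = ℚₚ.≤-trans (mix-mono 0≤r r≤1 ℚₚ.≤-refl (proj₂ (cut-range k 0≤r r≤1))) (ℚₚ.≤-reflexive (mix-const r 1ℚ))

mix-monoˡ : ∀ {r r′ x y} → r ≤ r′ → y ≤ x → mix r x y ≤ mix r′ x y
mix-monoˡ {r} {r′} {x} {y} r≤r′ y≤x = ≤-by (0≤* (p≤q⇒0≤q-p r≤r′) (p≤q⇒0≤q-p y≤x)) (lemma r r′ x y)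
  where
  lemma : ∀ r s x y → s * x + (1ℚ - s) * y ≡ r * x + (1ℚ - r) * y + (s - r) * (x - y)
  lemma = solve-∀ ℚ-ring

-- Critical clause trees and the probability of cutting them

module Critical {n} (cls : List (Clause n)) (short : All (λ C → length C ℕ.≤ 4) cls) where

  open Refutation cls

  unfalsified : PA n → Clause n → ℕ
  unfalsified θ []      = 0
  unfalsified θ (l ∷ C) = (if falseIn θ l then 0 else 1) ℕ.+ unfalsified θ C

  unfalsified≤ : ∀ θ C → unfalsified θ C ℕ.≤ length C
  unfalsified≤ θ []      = z≤n
  unfalsified≤ θ (l ∷ C) with falseIn θ l
  ... | true  = ℕₚ.m≤n⇒m≤1+n (unfalsified≤ θ C)
  ... | false = s≤s (unfalsified≤ θ C)

  unfalsified< : ∀ θ {C} → Any (λ l → falseIn θ l ≡ true) C → unfalsified θ C ℕ.< length C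
  unfalsified< θ {l ∷ C} (here eq) rewrite eq = s≤s (unfalsified≤ θ C)
  unfalsified< θ {l ∷ C} (there a) with falseIn θ l
  ... | true  = ℕₚ.m≤n⇒m≤1+n (unfalsified< θ a)
  ... | false = s≤s (unfalsified< θ a)

  ¬⊨ˡ⇒≢ : ∀ {α : Assignment n} l → ¬ α ⊨ˡ l → lookup α (var l) ≢ sign l
  ¬⊨ˡ⇒≢ (pos x) h = h
  ¬⊨ˡ⇒≢ (neg x) h = h

  indicator-mono : ∀ {a b} → (a ≡ true → b ≡ true) → indicator a ≤ indicator b
  indicator-mono {false} {b} h = 0≤indicator b
  indicator-mono {true}      h rewrite h refl = ℚₚ.≤-refl

  indicator-∧ : ∀ a b → indicator (a ∧ b) ≡ indicator a * indicator b
  indicator-∧ true  b = sym (ℚₚ.*-identityˡ (indicator b))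
  indicator-∧ false b = sym (ℚₚ.*-zeroˡ (indicator b))

  module _ {α : Assignment n} (α⊨ : All (Any (α ⊨ˡ_)) cls) {v : Vec ℚ n} (pr : IsProbability v)
           {r : ℚ} (0≤r : 0ℚ ≤ r) (r≤1 : r ≤ 1ℚ) where

    Dense : PA n → Set
    Dense θ = ∀ y → lookup θ y ≡ nothing → r ≤ lookup v y

    CutBound : ℕ → Set
    CutBound k = ∀ θ → (∀ β → ¬ Sol θ β) → Dense θ → cut k r ≤ expect v (λ B → indicator (refute k (fill θ α B)))

    module _ (k : ℕ) (ih : CutBound k) (θ : PA n) (θ-unsat : ∀ β → ¬ Sol θ β) (dense : Dense θ) where

      t : ℚ
      t = mix r 1ℚ (cut k r)

      0≤t : 0ℚ ≤ t
      0≤t = 0≤mix 0≤r r≤1 0≤1 (proj₁ (cut-range k 0≤r r≤1))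

      t≤1 : t ≤ 1ℚ
      t≤1 = ℚₚ.≤-trans (mix-mono 0≤r r≤1 ℚₚ.≤-refl (proj₂ (cut-range k 0≤r r≤1))) (ℚₚ.≤-reflexive (mix-const r 1ℚ))

      -- The label of a child of the clause tree is `var l`. If it lies in the random set, its value
      -- in α falsifies `l` at once. Otherwise the child's formula, with `l` set to true, still has
      -- no solution and induction applies to it.
      literal-bound : ∀ l → lookup θ (var l) ≡ nothing → lookup α (var l) ≢ sign l →
                      t ≤ expect v (λ B → indicator (refuteLit k (fill θ α B) l))
      literal-bound l un α≢ = begin
        mix r 1ℚ (cut k r)  ≤⟨ mix-monoˡ (dense y un) (proj₂ (cut-range k 0≤r r≤1)) ⟩
        mix (lookup v y) 1ℚ (cut k r)  ≤⟨ mix-mono (proj₁ (range pr y)) (proj₂ (range pr y)) in-set out-of-set ⟩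
        mix (lookup v y) (expect v (λ B → X (B [ y ]≔ true))) (expect v (λ B → X (B [ y ]≔ false)))
                                           ≡⟨ sym (expect-coordinate v y X) ⟩
        expect v X  ∎
        where
        open ℚₚ.≤-Reasoning
        y = var l
        X : Vec Bool n → ℚ
        X B = indicator (refuteLit k (fill θ α B) l)
        false-here : ∀ B → falseIn (fill θ α (B [ y ]≔ true)) l ≡ true
        false-here B = trans (cong (λ m → falsifies m (sign l)) eq) (≢⇒falsifies (lookup α y) (sign l) α≢)
          where
          eq : lookup (fill θ α (B [ y ]≔ true)) y ≡ just (lookup α y)
          eq = trans (lookup-fill θ α _ y) (cong₂ (λ m c → fillWith m c (lookup α y)) un (Vecₚ.lookup∘update y B true))
        in-set : 1ℚ ≤ expect v (λ B → X (B [ y ]≔ true))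
        in-set = ℚₚ.≤-trans (ℚₚ.≤-reflexive (sym (expect-const v 1ℚ)))
          (expect-mono pr λ B → indicator-mono {true} λ _ → ∨⁺ˡ (false-here B))
        θ′ = θ [ y ↦ sign l ]
        dense′ : Dense θ′
        dense′ z un′ = dense z (go (lookup θ z) refl)
          where
          go : ∀ m → lookup θ z ≡ m → lookup θ z ≡ nothing
          go nothing  eq = eq
          go (just b) eq = case trans (sym (⊑-lookup (⊑-↦ {τ = θ} {x = y} (sign l) un) z b eq)) un′ of λ ()
        out-of-set : cut k r ≤ expect v (λ B → X (B [ y ]≔ false))
        out-of-set = ℚₚ.≤-trans (ih θ′ (λ β → θ-unsat β ∘ Sol-⊑ (⊑-↦ _ un)) dense′)
          (expect-mono pr λ B → indicator-mono λ eq → ∨⁺ʳ {falseIn (fill θ α (B [ y ]≔ false)) l}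
            (refute-mono k (fill-≔-⊑ θ α B y (sign l)) eq))

      -- Subtrees of different literals may share labels, so their cuts are not independent; but
      -- they are increasing events, and Harris' inequality bounds their joint probability by the
      -- product. Clauses with fewer than `m` unfalsified literals are covered by `t ≤ 1`.
      clause-bound : ∀ C m → All (λ l → lookup (override θ α) (var l) ≢ sign l) C → unfalsified θ C ℕ.≤ m →
                     t ^^ m ≤ expect v (λ B → indicator (every (refuteLit k (fill θ α B)) C))
      clause-bound []      m _ _ = ℚₚ.≤-trans (^^≤1 m 0≤t t≤1) (ℚₚ.≤-reflexive (sym (expect-const v 1ℚ)))
      clause-bound (l ∷ C) m (l-false ∷ C-false) le with lookup θ (var l) in eqθ
      ... | just b rewrite ≢⇒falsifies b (sign l) (l-false ∘ trans (override-assigned θ α (var l) eqθ)) =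
        ℚₚ.≤-trans (clause-bound C m C-false le) (expect-mono pr λ B → indicator-mono λ eq →
          cong₂ _∧_ (∨⁺ˡ (falseIn-mono l (fill-⊑ θ α B) (trans (cong (λ m → falsifies m (sign l)) eqθ) (≢⇒falsifies b (sign l) (l-false ∘ trans (override-assigned θ α (var l) eqθ)))))) eq)
      clause-bound (l ∷ C) (suc m) (l-false ∷ C-false) (s≤s le) | nothing = begin
        t * t ^^ m  ≤⟨ *-mono 0≤t (ℚₚ.≤-trans (0≤^^ m 0≤t) rest) first rest ⟩
        expect v X * expect v Y  ≤⟨ harris {f = X} {Y} pr X↑ Y↑ ⟩
        expect v (λ B → X B * Y B)  ≡⟨ expect-cong v (λ B → sym (indicator-∧ (refuteLit k (fill θ α B) l) _)) ⟩
        _  ∎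
        where
        open ℚₚ.≤-Reasoning
        X Y : Vec Bool n → ℚ
        X B = indicator (refuteLit k (fill θ α B) l)
        Y B = indicator (every (refuteLit k (fill θ α B)) C)
        X↑ : Increasing X
        X↑ B≼B′ = indicator-mono (refuteLit-mono k l (fill-mono θ α B≼B′))
        Y↑ : Increasing Y
        Y↑ B≼B′ = indicator-mono λ eq → every⁺ (All.map (λ {l} → refuteLit-mono k l (fill-mono θ α B≼B′)) (every⁻ C eq))
        first : t ≤ expect v X
        first = literal-bound l eqθ (l-false ∘ trans (override-unassigned θ α (var l) eqθ))
        rest : t ^^ m ≤ expect v Y
        rest = clause-bound C m C-false le

      -- `override θ α` extends θ, which has no solution, so it violates some clause; this clause
      -- labels the root of the critical clause tree.
      violated : Any (λ C → All (λ l → lookup (override θ α) (var l) ≢ sign l) C) cls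
      violated = Any.map (λ {C} h → All.map (λ {l} → ¬⊨ˡ⇒≢ l) (¬Any⇒All¬ C h)) (¬All⇒Any¬ (any? (override θ α ⊨ˡ?_)) cls
        λ β⊨ → θ-unsat (override θ α) (β⊨ , mk⊒ λ y b → override-assigned θ α y))

      -- α satisfies the clause while `override θ α` does not, and the two differ only on variables
      -- assigned by θ. The literal falsified by θ is what leaves at most three children from a
      -- clause of length four.
      some-falsified : ∀ {C} → Any (α ⊨ˡ_) C → All (λ l → lookup (override θ α) (var l) ≢ sign l) C →
                       Any (λ l → falseIn θ l ≡ true) C
      some-falsified (there a)      (_ ∷ fs) = there (some-falsified a fs)
      some-falsified (here {l} α⊨l) (f ∷ _)  with lookup θ (var l) in eqθ
      ... | nothing = contradiction (trans (override-unassigned θ α (var l) eqθ) (⊨ˡ-sign l α⊨l)) f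
      ... | just b  = here (trans (cong (λ m → falsifies m (sign l)) eqθ)
                                  (≢⇒falsifies b (sign l) (f ∘ trans (override-assigned θ α (var l) eqθ))))

      refute-bound : ∀ Cs → (∀ {C} → C ∈ Cs → C ∈ cls) → All (Any (α ⊨ˡ_)) Cs → All (λ C → length C ℕ.≤ 4) Cs →
        Any (λ C → All (λ l → lookup (override θ α) (var l) ≢ sign l) C) Cs →
        t ^^ 3 ≤ expect v (λ B → indicator (refute (suc k) (fill θ α B)))
      refute-bound (C ∷ Cs) ⊆cls (s ∷ _) (C≤4 ∷ _) (here f) =
        ℚₚ.≤-trans (clause-bound C 3 f (ℕₚ.≤-pred (ℕₚ.≤-trans (unfalsified< θ (some-falsified s f)) C≤4)))
          (expect-mono pr λ B → indicator-mono λ eq → some⁺ (Any.map (λ { refl → eq }) (⊆cls (here refl))))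
      refute-bound (C ∷ Cs) ⊆cls (_ ∷ ss) (_ ∷ ls) (there a) = refute-bound Cs (⊆cls ∘ there) ss ls a

    cut-bound : ∀ k → CutBound k
    cut-bound zero    θ _ _ = ℚₚ.≤-reflexive (sym (expect-const v 0ℚ))
    cut-bound (suc k) θ θ-unsat dense =
      refute-bound k (cut-bound k) θ θ-unsat dense cls id α⊨ short (violated k (cut-bound k) θ θ-unsat dense)

-- The cost of a frozen variable over the rounds

rounds : ∀ {n} → List (Fin n) → ℕ → List (Fin n)
rounds vs zero    = []
rounds vs (suc m) = vs ++ rounds vs m

module Forcing (d : ℕ) (ρ : ℚ) where

  -- One further independent chance ρ to be picked.
  later : ℚ → ℚ
  later r = mix r 1ℚ ρ

  -- Bounds the probability that a frozen variable is not forced within m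
  -- rounds when every other variable has been picked with probability at
  -- least r.
  unforced : ℕ → ℚ → ℚ
  unforced zero    r = 1ℚ
  unforced (suc m) r = mix ρ (1ℚ - cut d r) (unforced m (later r))

module Schedule {n} (cls : List (Clause n)) (short : All (λ C → length C ℕ.≤ 4) cls)
                (d : ℕ) (ρ w : ℚ) (0≤ρ : 0ℚ ≤ ρ) (ρ≤1 : ρ ≤ 1ℚ)
                (0≤w : 0ℚ ≤ w) (w≤1 : w ≤ 1ℚ) (w-inverse : (1ℚ + ρ) * w ≡ 1ℚ)
                (σ : ℚ) (½≤σ : ½ ≤ σ) where

  open Refutation cls
  open Process cls d ρ w 0≤ρ ρ≤1 0≤w w≤1 w-inverse
  open Cost cls d ρ w 0≤ρ ρ≤1 0≤w w≤1 w-inverse σ ½≤σ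
  open Critical cls short

  open Forcing d ρ

  0≤later : ∀ {r} → 0ℚ ≤ r → r ≤ 1ℚ → 0ℚ ≤ later r
  0≤later 0≤r r≤1 = 0≤mix 0≤r r≤1 0≤1 0≤ρ

  later≤1 : ∀ {r} → 0ℚ ≤ r → r ≤ 1ℚ → later r ≤ 1ℚ
  later≤1 {r} 0≤r r≤1 = ℚₚ.≤-trans (mix-mono 0≤r r≤1 ℚₚ.≤-refl ρ≤1) (ℚₚ.≤-reflexive (mix-const r 1ℚ))

  module Frozen {τ α v} (sol : Sol τ α) (un : lookup τ v ≡ nothing) (frz : liquid τ v ≡ false) where

    -- `v` is kept unassigned whatever the random set says about it, since its cost concerns the
    -- moment at which it is picked.
    state : Vec Bool n → PA n
    state B = fill τ α (B [ v ]≔ false)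

    costs : List (Fin n) → Vec Bool n → ℚ
    costs es B = cost es (state B) α v

    DenseOff : ℚ → Vec ℚ n → Set
    DenseOff r p = ∀ y → y ≢ v → lookup τ y ≡ nothing → r ≤ lookup p y

    state-v : ∀ B → lookup (state B) v ≡ nothing
    state-v B = trans (lookup-fill τ α _ v) (cong₂ (λ m c → fillWith m c (lookup α v)) un (Vecₚ.lookup∘update v B false))

    flipped : PA n
    flipped = τ [ v ↦ not (lookup α v) ]

    flipped-unsat : ∀ β → ¬ Sol flipped β
    flipped-unsat β s with lookup α v in eq
    ... | true  = case trans (sym frz) (cong₂ _∧_ (sat⁺ s) (sat⁺ (Sol-↦ sol eq))) of λ ()
    ... | false = case trans (sym frz) (cong₂ _∧_ (sat⁺ (Sol-↦ sol eq)) (sat⁺ s)) of λ ()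

    -- As `v` is frozen, the formula with the opposite value of `v` has no solution; the cut of its
    -- clause tree is a refutation of that value and thus forces `v`.
    guessed-bound : ∀ {p r} → IsProbability p → 0ℚ ≤ r → r ≤ 1ℚ → DenseOff r p →
                    expect p (λ B → guessed (state B) v) ≤ 1ℚ - cut d r
    guessed-bound {p} {r} pr 0≤r r≤1 dense = begin
      expect p (λ B → guessed (state B) v)  ≤⟨ expect-mono pr pointwise ⟩
      expect p (λ B → 1ℚ - indicator (refute d (fill flipped α B)))  ≡⟨ expect-complement p _ ⟩
      1ℚ - expect p (λ B → indicator (refute d (fill flipped α B)))  ≤⟨ ℚₚ.+-monoʳ-≤ 1ℚ (ℚₚ.neg-antimono-≤
                                                                             (cut-bound (proj₁ sol) pr 0≤r r≤1 d flipped flipped-unsat dense′)) ⟩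
      1ℚ - cut d r  ∎
      where
      open ℚₚ.≤-Reasoning
      dense′ : ∀ y → lookup flipped y ≡ nothing → r ≤ lookup p y
      dense′ y eq with y Fin.≟ v
      ... | yes refl = case trans (sym (lookup-↦ τ v _)) eq of λ ()
      ... | no y≢v   = dense y y≢v (trans (sym (lookup-↦′ y≢v τ _)) eq)
      refuted⇒forced : ∀ τ′ b → refute d (τ′ [ v ↦ b ]) ≡ true → guessed τ′ v ≡ 0ℚ
      refuted⇒forced τ′ true  eq rewrite eq = refl
      refuted⇒forced τ′ false eq rewrite eq | Bool.∨-zeroʳ (refute d (τ′ [ v ↦ true ])) = refl
      guessed≤1 : ∀ τ′ → guessed τ′ v ≤ 1ℚ
      guessed≤1 τ′ with forced τ′ v
      ... | true  = 0≤1
      ... | false = ℚₚ.≤-refl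
      pointwise : ∀ B → guessed (state B) v ≤ 1ℚ - indicator (refute d (fill flipped α B))
      pointwise B with refute d (fill flipped α B) in eq
      ... | false = guessed≤1 (state B)
      ... | true  = ℚₚ.≤-reflexive (refuted⇒forced (state B) _ (refute-mono d (fill-≔-⊑ τ α B v _) eq))

    pick : Vec ℚ n → Fin n → Vec ℚ n
    pick p y = p [ y ]≔ later (lookup p y)

    pick-probability : ∀ {p} y → IsProbability p → IsProbability (pick p y)
    pick-probability {p} y pr = probabilities go
      where
      go : ∀ z → 0ℚ ≤ lookup (pick p y) z × lookup (pick p y) z ≤ 1ℚ
      go z with z Fin.≟ y
      ... | yes refl rewrite Vecₚ.lookup∘update y p (later (lookup p y)) =
        0≤later (proj₁ (range pr y)) (proj₂ (range pr y)) , later≤1 (proj₁ (range pr y)) (proj₂ (range pr y))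
      ... | no z≢y rewrite Vecₚ.lookup∘update′ z≢y p (later (lookup p y)) = range pr z

    pick-dense : ∀ {r p} y → IsProbability p → DenseOff r p → DenseOff r (pick p y)
    pick-dense {r} {p} y pr dense z z≢v un with z Fin.≟ y
    ... | no z≢y   rewrite Vecₚ.lookup∘update′ z≢y p (later (lookup p y)) = dense z z≢v un
    ... | yes refl rewrite Vecₚ.lookup∘update y p (later (lookup p y)) = ℚₚ.≤-trans (dense z z≢v un)
      (≤-by (0≤* (p≤q⇒0≤q-p (proj₂ (range pr z))) 0≤ρ) (lemma (lookup p z) ρ))
      where
      lemma : ∀ q r → q * 1ℚ + (1ℚ - q) * r ≡ q + (1ℚ - q) * r
      lemma = solve-∀ ℚ-ring

    later-mono : ∀ {q q′} → q ≤ q′ → later q ≤ later q′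
    later-mono q≤q′ = mix-monoˡ q≤q′ ρ≤1

    costs-assigned : ∀ y es {b} → lookup τ y ≡ just b → ∀ B → costs (y ∷ es) B ≡ costs es B
    costs-assigned y es eq B = unassigned?-just
      (trans (lookup-fill τ α _ y) (cong (λ m → fillWith m (lookup (B [ v ]≔ false) y) (lookup α y)) eq))

    -- An event at `y` puts `y` into the random set with probability ρ if it is not there yet. Since
    -- its value is prescribed by α, the event amounts to raising one coordinate of the product
    -- measure, which therefore remains a product measure.
    costs-other : ∀ p y es → y ≢ v → lookup τ y ≡ nothing → expect p (costs (y ∷ es)) ≡ expect (pick p y) (costs es)
    costs-other p y es y≢v uny = begin
      expect p (costs (y ∷ es))
        ≡⟨ expect-coordinate p y _ ⟩
      mix q (expect p (λ B → costs (y ∷ es) (B [ y ]≔ true))) (expect p (λ B → costs (y ∷ es) (B [ y ]≔ false)))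
        ≡⟨ cong₂ (mix q) (expect-cong p in-set) (trans (expect-cong p out-of-set) (expect-mix p ρ _ _)) ⟩
      mix q T (mix ρ T F)
        ≡⟨ lemma q ρ T F ⟩
      mix (later q) T F
        ≡⟨ cong₂ (mix (later q)) (sym (expect-independent p y (later q) true (costs es))) (sym (expect-independent p y (later q) false (costs es))) ⟩
      mix (later q) (expect (pick p y) (λ B → costs es (B [ y ]≔ true))) (expect (pick p y) (λ B → costs es (B [ y ]≔ false)))
        ≡⟨ cong (λ q → mix q (expect (pick p y) (λ B → costs es (B [ y ]≔ true))) (expect (pick p y) (λ B → costs es (B [ y ]≔ false)))) (sym (Vecₚ.lookup∘update y p (later q))) ⟩
      mix (lookup (pick p y) y) (expect (pick p y) (λ B → costs es (B [ y ]≔ true))) (expect (pick p y) (λ B → costs es (B [ y ]≔ false)))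
        ≡⟨ sym (expect-coordinate (pick p y) y _) ⟩
      expect (pick p y) (costs es) ∎
      where
      open ≡-Reasoning
      q = lookup p y
      T = expect p (λ B → costs es (B [ y ]≔ true))
      F = expect p (λ B → costs es (B [ y ]≔ false))
      lemma : ∀ q r a b → q * a + (1ℚ - q) * (r * a + (1ℚ - r) * b) ≡
                          (q * 1ℚ + (1ℚ - q) * r) * a + (1ℚ - (q * 1ℚ + (1ℚ - q) * r)) * b
      lemma = solve-∀ ℚ-ring
      status : ∀ B c → lookup (state (B [ y ]≔ c)) y ≡ fillWith nothing c (lookup α y)
      status B c = trans (lookup-fill τ α _ y) (cong₂ (λ m c → fillWith m c (lookup α y)) uny
        (trans (Vecₚ.lookup∘update′ y≢v (B [ y ]≔ c) false) (Vecₚ.lookup∘update y B c)))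
      in-set : ∀ B → costs (y ∷ es) (B [ y ]≔ true) ≡ costs es (B [ y ]≔ true)
      in-set B = unassigned?-just (status B true)
      picked-state : ∀ B → state (B [ y ]≔ false) [ y ↦ lookup α y ] ≡ state (B [ y ]≔ true)
      picked-state B = trans (cong (λ B′ → fill τ α B′ [ y ↦ lookup α y ]) (Vecₚ.[]≔-commutes B y v y≢v))
        (trans (sym (fill-≔ τ α (B [ v ]≔ false) y uny)) (cong (fill τ α) (sym (Vecₚ.[]≔-commutes B y v y≢v))))
      out-of-set : ∀ B → costs (y ∷ es) (B [ y ]≔ false) ≡ mix ρ (costs es (B [ y ]≔ true)) (costs es (B [ y ]≔ false))
      out-of-set B rewrite status B false with y Fin.≟ v
      ... | yes y≡v = contradiction y≡v y≢v
      ... | no _    = cong (λ τ′ → mix ρ (cost es τ′ α v) (costs es (B [ y ]≔ false))) (picked-state B)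

    costs-self : ∀ p es → expect p (costs (v ∷ es)) ≡ mix ρ (expect p (λ B → guessed (state B) v)) (expect p (costs es))
    costs-self p es = trans (expect-cong p pointwise) (expect-mix p ρ _ _)
      where
      pointwise : ∀ B → costs (v ∷ es) B ≡ mix ρ (guessed (state B) v) (costs es B)
      pointwise B rewrite state-v B with v Fin.≟ v
      ... | yes _  = refl
      ... | no v≢v = contradiction refl v≢v

    module Round {lo hi : ℚ} (0≤lo : 0ℚ ≤ lo) (lo≤1 : lo ≤ 1ℚ) (hi≤ : hi ≤ later lo) (es : List (Fin n)) (N : ℚ)
                 (after : ∀ {p} → IsProbability p → DenseOff hi p → expect p (costs es) ≤ N) where

      -- With `ys` the rest of the current round, the variables outside `ys` have had their event
      -- and reached `hi`; the others are only known to have probability at least `lo`.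
      Done : List (Fin n) → Vec ℚ n → Set
      Done ys p = ∀ y → y ∉ ys → y ≢ v → lookup τ y ≡ nothing → hi ≤ lookup p y

      pick-done : ∀ {y ys p} → DenseOff lo p → Done (y ∷ ys) p → Done ys (pick p y)
      pick-done {y} {ys} {p} dense done z z∉ys z≢v un with z Fin.≟ y
      ... | yes refl rewrite Vecₚ.lookup∘update y p (later (lookup p y)) =
        ℚₚ.≤-trans hi≤ (later-mono (dense y z≢v un))
      ... | no z≢y rewrite Vecₚ.lookup∘update′ z≢y p (later (lookup p y)) =
        done z (λ { (here z≡y) → z≢y z≡y ; (there z∈ys) → z∉ys z∈ys }) z≢v un

      skip-done : ∀ {y ys p b} → lookup τ y ≡ just b → Done (y ∷ ys) p → Done ys p
      skip-done eq done z z∉ys z≢v un =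
        done z (λ { (here refl) → case trans (sym un) eq of λ () ; (there z∈ys) → z∉ys z∈ys }) z≢v un

      without : ∀ ys {p} → v ∉ ys → IsProbability p → DenseOff lo p → Done ys p → expect p (costs (ys ++ es)) ≤ N
      without []       v∉ pr dense done = after pr (λ y → done y (λ ()))
      without (y ∷ ys) {p} v∉ pr dense done with lookup τ y in eq
      ... | just _  = ℚₚ.≤-trans (ℚₚ.≤-reflexive (expect-cong p (costs-assigned y (ys ++ es) eq)))
                        (without ys (v∉ ∘ there) pr dense (skip-done {y} {ys} {p} eq done))
      ... | nothing = ℚₚ.≤-trans (ℚₚ.≤-reflexive (costs-other p y (ys ++ es) (λ y≡v → v∉ (here (sym y≡v))) eq))
                        (without ys (v∉ ∘ there) (pick-probability y pr) (pick-dense {p = p} y pr dense) (pick-done {y} {ys} {p} dense done))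

      -- At the event of `v` only the picks of earlier rounds are used, hence `lo` inside the cut;
      -- picks made in the current round count from the next round on.
      within : ∀ ys {p} → v ∈ ys → AllPairs _≢_ ys → IsProbability p → DenseOff lo p → Done ys p →
               expect p (costs (ys ++ es)) ≤ mix ρ (1ℚ - cut d lo) N
      within (.v ∷ ys) {p} (here refl) (v≢ ∷ _) pr dense done =
        ℚₚ.≤-trans (ℚₚ.≤-reflexive (costs-self p (ys ++ es)))
          (mix-mono 0≤ρ ρ≤1 (guessed-bound pr 0≤lo lo≤1 dense)
            (without ys (λ v∈ → All.lookup v≢ v∈ refl) pr dense
              (λ y y∉ys y≢v → done y (λ { (here y≡v) → y≢v y≡v ; (there y∈) → y∉ys y∈ }) y≢v)))
      within (y ∷ ys) {p} (there v∈) (y≢ ∷ un-ys) pr dense done with lookup τ y in eq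
      ... | just _  = ℚₚ.≤-trans (ℚₚ.≤-reflexive (expect-cong p (costs-assigned y (ys ++ es) eq)))
                        (within ys v∈ un-ys pr dense (skip-done {y} {ys} {p} eq done))
      ... | nothing = ℚₚ.≤-trans (ℚₚ.≤-reflexive (costs-other p y (ys ++ es) (λ y≡v → All.lookup y≢ v∈ y≡v) eq))
                        (within ys v∈ un-ys (pick-probability y pr) (pick-dense {p = p} y pr dense) (pick-done {y} {ys} {p} dense done))

    module _ {vs : List (Fin n)} (complete : ∀ y → y ∈ vs) (unique : AllPairs _≢_ vs) where

      rounds-bound : ∀ m {r p} → 0ℚ ≤ r → r ≤ 1ℚ → IsProbability p → DenseOff r p →
                     expect p (costs (rounds vs m)) ≤ unforced m r
      rounds-bound zero {p = p} 0≤r r≤1 pr dense = ℚₚ.≤-reflexive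
        (trans (expect-cong p (λ B → cong (λ m → unassigned? m 0ℚ 1ℚ) (state-v B))) (expect-const p 1ℚ))
      rounds-bound (suc m) {r} 0≤r r≤1 pr dense =
        Round.within {lo = r} {later r} 0≤r r≤1 ℚₚ.≤-refl (rounds vs m) (unforced m (later r))
          (rounds-bound m (0≤later 0≤r r≤1) (later≤1 0≤r r≤1))
          vs (complete v) unique pr dense (λ y y∉ → contradiction (complete y) y∉)

      zeros : IsProbability (replicate n 0ℚ)
      zeros = probabilities λ y → subst (λ q → 0ℚ ≤ q × q ≤ 1ℚ) (sym (Vecₚ.lookup-replicate y 0ℚ)) (ℚₚ.≤-refl , 0≤1)

      zeros-dense : DenseOff 0ℚ (replicate n 0ℚ)
      zeros-dense y _ _ = proj₁ (range zeros y)

      state-none : state (replicate n false) ≡ τ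
      state-none = trans (cong (fill τ α) (trans (cong (λ b → replicate n false [ v ]≔ b) (sym (Vecₚ.lookup-replicate v false)))
                                                 (Vecₚ.[]≔-lookup (replicate n false) v)))
                         (fill-none τ α)

      from-zeros : ∀ es → cost es τ α v ≡ expect (replicate n 0ℚ) (costs es)
      from-zeros es = trans (cong (λ τ′ → cost es τ′ α v) (sym state-none)) (sym (expect-zeros (costs es)))

      -- Taking both `lo` and `hi` to be 0 gives no credit for the rest `ys` of an interrupted
      -- round.
      cost-without : ∀ ys m → v ∉ ys → cost (ys ++ rounds vs m) τ α v ≤ unforced m 0ℚ
      cost-without ys m v∉ = subst (_≤ _) (sym (from-zeros (ys ++ rounds vs m)))
        (Round.without {lo = 0ℚ} {0ℚ} ℚₚ.≤-refl 0≤1 (0≤later ℚₚ.≤-refl 0≤1) (rounds vs m) (unforced m 0ℚ)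
          (rounds-bound m ℚₚ.≤-refl 0≤1) ys v∉ zeros zeros-dense (λ y _ → zeros-dense y))

      -- If the interrupted round still contains `v`, picking it there is counted as a certain
      -- guess, since `cut d 0` is estimated by 0.
      cost-within : ∀ ys m → v ∈ ys → AllPairs _≢_ ys → cost (ys ++ rounds vs m) τ α v ≤ mix ρ 1ℚ (unforced m 0ℚ)
      cost-within ys m v∈ un-ys = subst (_≤ _) (sym (from-zeros (ys ++ rounds vs m))) (ℚₚ.≤-trans
        (Round.within {lo = 0ℚ} {0ℚ} ℚₚ.≤-refl 0≤1 (0≤later ℚₚ.≤-refl 0≤1) (rounds vs m) (unforced m 0ℚ)
          (rounds-bound m ℚₚ.≤-refl 0≤1) ys v∈ un-ys zeros zeros-dense (λ y _ → zeros-dense y))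
        (mix-mono 0≤ρ ρ≤1 (≤-by (proj₁ (cut-range d ℚₚ.≤-refl 0≤1)) (lemma (cut d 0ℚ))) ℚₚ.≤-refl))
        where
        lemma : ∀ a → 1ℚ ≡ 1ℚ - a + a
        lemma = solve-∀ ℚ-ring

  occurrences-∉ : ∀ {v : Fin n} ys → v ∉ ys → ∀ es → occurrences v (ys ++ es) ≡ occurrences v es
  occurrences-∉ []       v∉ es = refl
  occurrences-∉ {v} (y ∷ ys) v∉ es with y Fin.≟ v
  ... | yes refl = contradiction (here refl) v∉
  ... | no _     = occurrences-∉ ys (v∉ ∘ there) es

  occurrences-∈ : ∀ {v : Fin n} {ys} → v ∈ ys → AllPairs _≢_ ys → ∀ es → occurrences v (ys ++ es) ≡ suc (occurrences v es)
  occurrences-∈ {v} {y ∷ ys} v∈ (y≢ ∷ un-ys) es with y Fin.≟ v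
  occurrences-∈ {v} {y ∷ ys} v∈         (y≢ ∷ un-ys) es | yes refl =
    cong suc (occurrences-∉ ys (λ v∈ys → All.lookup y≢ v∈ys refl) es)
  occurrences-∈ {v} {y ∷ ys} (here eq)  (y≢ ∷ un-ys) es | no y≢v = contradiction (sym eq) y≢v
  occurrences-∈ {v} {y ∷ ys} (there v∈) (y≢ ∷ un-ys) es | no _   = occurrences-∈ v∈ un-ys es

  module _ {vs : List (Fin n)} (complete : ∀ y → y ∈ vs) (unique : AllPairs _≢_ vs)
           (0≤σ-ρ : 0ℚ ≤ σ - ρ) (limit-bound : ∀ m → unforced m 0ℚ ≤ σ - ρ + (1ℚ - ρ) ^^ m) where

    occurrences-rounds : ∀ v m → occurrences v (rounds vs m) ≡ m
    occurrences-rounds v zero    = refl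
    occurrences-rounds v (suc m) =
      trans (occurrences-∈ (complete v) unique (rounds vs m)) (cong suc (occurrences-rounds v m))

    bounded-rounds : ∀ ys m → AllPairs _≢_ ys → Bounded (ys ++ rounds vs m)
    bounded-rounds ys m un-ys τ α v sol un frz with any? (v Fin.≟_) ys
    ... | no v∉ rewrite occurrences-∉ ys v∉ (rounds vs m) | occurrences-rounds v m = begin
      cost (ys ++ rounds vs m) τ α v  ≤⟨ Frozen.cost-without sol un frz complete unique ys m v∉ ⟩
      unforced m 0ℚ  ≤⟨ limit-bound m ⟩
      σ - ρ + (1ℚ - ρ) ^^ m  ≤⟨ ≤-by 0≤ρ (lemma σ ρ ((1ℚ - ρ) ^^ m)) ⟩
      σ + (1ℚ - ρ) ^^ m  ∎
      where
      open ℚₚ.≤-Reasoning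
      lemma : ∀ s r y → s + y ≡ s - r + y + r
      lemma = solve-∀ ℚ-ring
    ... | yes v∈ rewrite occurrences-∈ v∈ un-ys (rounds vs m) | occurrences-rounds v m = begin
      cost (ys ++ rounds vs m) τ α v  ≤⟨ Frozen.cost-within sol un frz complete unique ys m v∈ un-ys ⟩
      mix ρ 1ℚ (unforced m 0ℚ)  ≤⟨ mix-mono 0≤ρ ρ≤1 ℚₚ.≤-refl (limit-bound m) ⟩
      -- `ρ + (1 - ρ) (σ - ρ) = σ - ρ (σ - ρ)`: the slack ρ in `limit-bound` pays for the
      -- interrupted round.
      mix ρ 1ℚ (σ - ρ + (1ℚ - ρ) ^^ m)  ≤⟨ ≤-by (0≤* 0≤ρ 0≤σ-ρ) (lemma σ ρ ((1ℚ - ρ) ^^ m)) ⟩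
      σ + (1ℚ - ρ) * (1ℚ - ρ) ^^ m  ∎
      where
      open ℚₚ.≤-Reasoning
      lemma : ∀ s r y → s + (1ℚ - r) * y ≡ r * 1ℚ + (1ℚ - r) * (s - r + y) + r * (s - r)
      lemma = solve-∀ ℚ-ring

    bounded-tails : ∀ m → BoundedTails (rounds vs m)
    bounded-tails-++ : ∀ ys m → AllPairs _≢_ ys → BoundedTails (rounds vs m) → BoundedTails (ys ++ rounds vs m)

    bounded-tails zero    = tt
    bounded-tails (suc m) = bounded-tails-++ vs m unique (bounded-tails m)

    bounded-tails-++ []       m _             tails = tails
    bounded-tails-++ (y ∷ ys) m (_ ∷ un-ys) tails =
      bounded-rounds ys m un-ys , bounded-tails-++ ys m un-ys tails

-- A Riemann sum for the probability of being forced

cut-mono : ∀ k {r r′} → 0ℚ ≤ r → r ≤ r′ → r′ ≤ 1ℚ → cut k r ≤ cut k r′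
cut-mono zero    0≤r r≤r′ r′≤1 = ℚₚ.≤-refl
cut-mono (suc k) {r} {r′} 0≤r r≤r′ r′≤1 = ^^-mono 3 0≤t (ℚₚ.≤-trans
  (mix-monoˡ r≤r′ (proj₂ (cut-range k 0≤r r≤1)))
  (mix-mono (ℚₚ.≤-trans 0≤r r≤r′) r′≤1 ℚₚ.≤-refl (cut-mono k 0≤r r≤r′ r′≤1)))
  where
  r≤1 = ℚₚ.≤-trans r≤r′ r′≤1
  0≤t : 0ℚ ≤ mix r 1ℚ (cut k r)
  0≤t = 0≤mix 0≤r r≤1 0≤1 (proj₁ (cut-range k 0≤r r≤1))

abstract
  _≤ᵈ_ : ∀ p q → Dec (p ≤ q)
  _≤ᵈ_ = ℚₚ._≤?_

threshold : ℚ → ℚ → ℚ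
threshold g r = indicator (does (g ≤ᵈ r))

threshold-≤ : ∀ {g r} → g ≤ r → threshold g r ≡ 1ℚ
threshold-≤ {g} {r} g≤r with g ≤ᵈ r
... | yes _  = refl
... | no g≰r = contradiction g≤r g≰r

threshold-> : ∀ {g r} → ¬ g ≤ r → threshold g r ≡ 0ℚ
threshold-> {g} {r} g≰r with g ≤ᵈ r
... | yes g≤r = contradiction g≤r g≰r
... | no _    = refl

module Riemann (d : ℕ) (ρ : ℚ) (0≤ρ : 0ℚ ≤ ρ) (ρ≤1 : ρ ≤ 1ℚ) where

  open Forcing d ρ

  0≤1-ρ : 0ℚ ≤ 1ℚ - ρ
  0≤1-ρ = p≤q⇒0≤q-p ρ≤1

  -- The law of the probability r at a geometrically distributed round,
  -- integrated against h.
  integral : ℕ → (ℚ → ℚ) → ℚ → ℚ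
  integral zero    h r = 0ℚ
  integral (suc m) h r = mix ρ (h r) (integral m h (later r))

  later-≥ : ∀ {r} → r ≤ 1ℚ → r ≤ later r
  later-≥ {r} r≤1 = ≤-by (0≤* (p≤q⇒0≤q-p r≤1) 0≤ρ) (lemma r ρ)
    where
    lemma : ∀ q r → q * 1ℚ + (1ℚ - q) * r ≡ q + (1ℚ - q) * r
    lemma = solve-∀ ℚ-ring

  later-range : ∀ {r} → 0ℚ ≤ r → r ≤ 1ℚ → 0ℚ ≤ later r × later r ≤ 1ℚ
  later-range {r} 0≤r r≤1 = 0≤mix 0≤r r≤1 0≤1 0≤ρ ,
    ℚₚ.≤-trans (mix-mono 0≤r r≤1 ℚₚ.≤-refl ρ≤1) (ℚₚ.≤-reflexive (mix-const r 1ℚ))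

  unforced≡ : ∀ m r → unforced m r ≡ 1ℚ - integral m (cut d) r
  unforced≡ zero    r = refl
  unforced≡ (suc m) r = trans (cong (mix ρ (1ℚ - cut d r)) (unforced≡ m (later r))) (lemma ρ (cut d r) (integral m (cut d) (later r)))
    where
    lemma : ∀ r a b → r * (1ℚ - a) + (1ℚ - r) * (1ℚ - b) ≡ 1ℚ - (r * a + (1ℚ - r) * b)
    lemma = solve-∀ ℚ-ring

  integral-mono : ∀ m {h h′ r} → (∀ r → 0ℚ ≤ r → r ≤ 1ℚ → h r ≤ h′ r) → 0ℚ ≤ r → r ≤ 1ℚ →
                  integral m h r ≤ integral m h′ r
  integral-mono zero    le 0≤r r≤1 = ℚₚ.≤-refl
  integral-mono (suc m) le 0≤r r≤1 = mix-mono 0≤ρ ρ≤1 (le _ 0≤r r≤1)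
    (integral-mono m le (proj₁ (later-range 0≤r r≤1)) (proj₂ (later-range 0≤r r≤1)))

  integral-linear : ∀ m h c h′ r → integral m (λ r → h r + c * h′ r) r ≡ integral m h r + c * integral m h′ r
  integral-linear zero    h c h′ r = lemma c
    where
    lemma : ∀ c → 0ℚ ≡ 0ℚ + c * 0ℚ
    lemma = solve-∀ ℚ-ring
  integral-linear (suc m) h c h′ r = trans (cong (mix ρ (h r + c * h′ r)) (integral-linear m h c h′ (later r)))
    (lemma ρ c (h r) (h′ r) (integral m h (later r)) (integral m h′ (later r)))
    where
    lemma : ∀ r c a a′ b b′ → r * (a + c * a′) + (1ℚ - r) * (b + c * b′) ≡
                              r * a + (1ℚ - r) * b + c * (r * a′ + (1ℚ - r) * b′)
    lemma = solve-∀ ℚ-ring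

  integral-above : ∀ m {g r} → g ≤ r → r ≤ 1ℚ → 0ℚ ≤ r → integral m (threshold g) r ≡ 1ℚ - (1ℚ - ρ) ^^ m
  integral-above zero    g≤r r≤1 0≤r = refl
  integral-above (suc m) {g} {r} g≤r r≤1 0≤r = trans
    (cong₂ (mix ρ) (threshold-≤ g≤r) (integral-above m (ℚₚ.≤-trans g≤r (later-≥ r≤1)) (proj₂ (later-range 0≤r r≤1)) (proj₁ (later-range 0≤r r≤1))))
    (lemma ρ ((1ℚ - ρ) ^^ m))
    where
    lemma : ∀ r y → r * 1ℚ + (1ℚ - r) * (1ℚ - y) ≡ 1ℚ - (1ℚ - r) * y
    lemma = solve-∀ ℚ-ring

  -- `1 - r` is the probability of not having been picked so far. Multiplied by it, the estimate
  -- reproduces itself from round to round, because `1 - later r = (1 - r) (1 - ρ)`. The round in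
  -- which the threshold is passed overshoots `g` by at most ρ.
  integral-below : ∀ m {g r} → ¬ g ≤ r → 0ℚ ≤ r → r ≤ 1ℚ →
                   1ℚ - g - ρ - (1ℚ - r) * (1ℚ - ρ) ^^ m ≤ (1ℚ - r) * integral m (threshold g) r
  integral-below zero {g} {r} g≰r 0≤r r≤1 =
    ≤-by (0≤+ (p≤q⇒0≤q-p (ℚₚ.<⇒≤ (ℚₚ.≰⇒> g≰r))) 0≤ρ) (lemma g ρ r)
    where
    lemma : ∀ g p r → (1ℚ - r) * 0ℚ ≡ 1ℚ - g - p - (1ℚ - r) * 1ℚ + (g - r + p)
    lemma = solve-∀ ℚ-ring
  integral-below (suc m) {g} {r} g≰r 0≤r r≤1 rewrite threshold-> g≰r = by-cases (g ≤ᵈ later r)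
    where
    y = (1ℚ - ρ) ^^ m
    I = integral m (threshold g) (later r)
    by-cases : Dec (g ≤ later r) → 1ℚ - g - ρ - (1ℚ - r) * ((1ℚ - ρ) * y) ≤ (1ℚ - r) * mix ρ 0ℚ I
    by-cases (yes g≤) rewrite integral-above m g≤ (proj₂ (later-range 0≤r r≤1)) (proj₁ (later-range 0≤r r≤1)) =
      ≤-by (0≤+ (p≤q⇒0≤q-p (ℚₚ.<⇒≤ (ℚₚ.≰⇒> g≰r))) (0≤* 0≤r 0≤ρ)) (lemma g ρ r y)
      where
      lemma : ∀ g p r y → (1ℚ - r) * (p * 0ℚ + (1ℚ - p) * (1ℚ - y)) ≡
                          1ℚ - g - p - (1ℚ - r) * ((1ℚ - p) * y) + (g - r + r * p)
      lemma = solve-∀ ℚ-ring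
    by-cases (no g≰) = ≤-by (p≤q⇒0≤q-p (integral-below m g≰ (proj₁ (later-range 0≤r r≤1)) (proj₂ (later-range 0≤r r≤1))))
                            (lemma g ρ r y I)
      where
      lemma : ∀ g p r y I → (1ℚ - r) * (p * 0ℚ + (1ℚ - p) * I) ≡
              1ℚ - g - p - (1ℚ - r) * ((1ℚ - p) * y) +
              ((1ℚ - (r * 1ℚ + (1ℚ - r) * p)) * I - (1ℚ - g - p - (1ℚ - (r * 1ℚ + (1ℚ - r) * p)) * y))
      lemma = solve-∀ ℚ-ring

  -- A variable picked at a geometric time sees a nearly uniform value of r in [0,1]. The error ρ
  -- comes from the jump across `g`, the error `(1 - ρ) ^^ m` from never being picked.
  integral-threshold : ∀ m {g} → 0ℚ ≤ g → 1ℚ - g - (ρ + (1ℚ - ρ) ^^ m) ≤ integral m (threshold g) 0ℚ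
  integral-threshold m {g} 0≤g with g ≤ᵈ 0ℚ
  ... | yes g≤0 = ℚₚ.≤-trans (≤-by (0≤+ 0≤g 0≤ρ) (lemma g ρ ((1ℚ - ρ) ^^ m)))
                    (ℚₚ.≤-reflexive (sym (integral-above m g≤0 0≤1 ℚₚ.≤-refl)))
    where
    lemma : ∀ g r y → 1ℚ - y ≡ 1ℚ - g - (r + y) + (g + r)
    lemma = solve-∀ ℚ-ring
  ... | no g≰0 = subst₂ _≤_ (lemma g ρ ((1ℚ - ρ) ^^ m)) (ℚₚ.*-identityˡ _) (integral-below m g≰0 ℚₚ.≤-refl 0≤1)
    where
    lemma : ∀ g r y → 1ℚ - g - r - (1ℚ - 0ℚ) * y ≡ 1ℚ - g - (r + y)
    lemma = solve-∀ ℚ-ring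

  module Grid (κ : ℚ) (0≤κ : 0ℚ ≤ κ) where

    grid : ℕ → ℚ
    grid j = natℚ j * κ

    0≤grid : ∀ j → 0ℚ ≤ grid j
    0≤grid j = 0≤* (0≤natℚ j) 0≤κ

    grid-suc : ∀ j → grid j ≤ grid (suc j)
    grid-suc j rewrite natℚ-suc j = ≤-by 0≤κ (lemma (natℚ j) κ)
      where
      lemma : ∀ a k → (1ℚ + a) * k ≡ a * k + k
      lemma = solve-∀ ℚ-ring

    value : ℕ → ℚ
    value j = cut d (grid j)

    -- A minorant of `cut d` built from thresholds, the only functions for which the integral has
    -- been estimated.
    staircase : ℕ → ℚ → ℚ
    staircase zero    r = 0ℚ + value zero * threshold (grid zero) r
    staircase (suc j) r = staircase j r + (value (suc j) - value j) * threshold (grid (suc j)) r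

    staircase≤ : ∀ j {r} → grid j ≤ 1ℚ → 0ℚ ≤ r → r ≤ 1ℚ → staircase j r ≤ cut d r × staircase j r ≤ value j
    staircase≤ zero {r} g≤1 0≤r r≤1 with grid zero ≤ᵈ r
    ... | yes g≤r = subst (_≤ cut d r) (lemma (value 0)) (cut-mono d (0≤grid 0) g≤r r≤1) , ℚₚ.≤-reflexive (sym (lemma (value 0)))
      where
      lemma : ∀ a → a ≡ 0ℚ + a * 1ℚ
      lemma = solve-∀ ℚ-ring
    ... | no _    = subst (_≤ cut d r) (lemma (value 0)) (proj₁ (cut-range d 0≤r r≤1)) ,
                    subst (_≤ value 0) (lemma (value 0)) (proj₁ (cut-range d (0≤grid 0) g≤1))
      where
      lemma : ∀ a → 0ℚ ≡ 0ℚ + a * 0ℚ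
      lemma = solve-∀ ℚ-ring
    staircase≤ (suc j) {r} g≤1 0≤r r≤1 with grid (suc j) ≤ᵈ r | staircase≤ j (ℚₚ.≤-trans (grid-suc j) g≤1) 0≤r r≤1
    ... | yes g≤r | _ , le = ℚₚ.≤-trans le′ (cut-mono d (0≤grid (suc j)) g≤r r≤1) , le′
      where
      lemma : ∀ a b s → b ≡ s + (b - a) * 1ℚ + (a - s)
      lemma = solve-∀ ℚ-ring
      le′ : staircase j r + (value (suc j) - value j) * 1ℚ ≤ value (suc j)
      le′ = ≤-by (p≤q⇒0≤q-p le) (lemma (value j) (value (suc j)) (staircase j r))
    ... | no _ | le₁ , le₂ = subst (_≤ cut d r) (lemma (staircase j r) (value (suc j) - value j)) le₁ ,
                             subst (_≤ value (suc j)) (lemma (staircase j r) (value (suc j) - value j))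
                               (ℚₚ.≤-trans le₂ (cut-mono d (0≤grid j) (grid-suc j) g≤1))
      where
      lemma : ∀ s a → s ≡ s + a * 0ℚ
      lemma = solve-∀ ℚ-ring

    riemann : ℕ → ℚ
    riemann zero    = 0ℚ
    riemann (suc j) = value j + riemann j

    -- Summation by parts: the increments of `value`, weighted with `1 - grid`, form the left
    -- Riemann sum and a boundary term, while the errors of the thresholds telescope to a multiple
    -- of `value j`.
    integral-staircase : ∀ m j → grid j ≤ 1ℚ →
      κ * riemann (suc j) + value j * (1ℚ - grid (suc j)) - (ρ + (1ℚ - ρ) ^^ m) * value j ≤ integral m (staircase j) 0ℚ
    integral-staircase m zero g≤1 = begin
      κ * (value 0 + 0ℚ) + value 0 * (1ℚ - grid 1) - e * value 0  ≡⟨ cong₂ (λ a b → κ * (value 0 + 0ℚ) + value 0 * (1ℚ - a * κ) - b) (trans (natℚ-suc 0) (cong (1ℚ +_) natℚ-zero)) refl ⟩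
      κ * (value 0 + 0ℚ) + value 0 * (1ℚ - (1ℚ + 0ℚ) * κ) - e * value 0
                                                                    ≡⟨ lemma κ (value 0) e ⟩
      0ℚ + value 0 * (1ℚ - 0ℚ * κ - e)  ≡⟨ cong (λ a → 0ℚ + value 0 * (1ℚ - a * κ - e)) (sym natℚ-zero) ⟩
      0ℚ + value 0 * (1ℚ - grid 0 - e)  ≤⟨ ℚₚ.+-monoʳ-≤ 0ℚ (*-monoʳ (proj₁ (cut-range d (0≤grid 0) g≤1)) (integral-threshold m (0≤grid 0))) ⟩
      0ℚ + value 0 * integral m (threshold (grid 0)) 0ℚ  ≡⟨ cong (_+ value 0 * integral m (threshold (grid 0)) 0ℚ) (sym (zeros m 0ℚ)) ⟩
      integral m (λ _ → 0ℚ) 0ℚ + value 0 * integral m (threshold (grid 0)) 0ℚ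
                                                                    ≡⟨ sym (integral-linear m (λ _ → 0ℚ) (value 0) (threshold (grid 0)) 0ℚ) ⟩
      integral m (staircase 0) 0ℚ  ∎
      where
      open ℚₚ.≤-Reasoning
      e = ρ + (1ℚ - ρ) ^^ m
      lemma : ∀ k a e → k * (a + 0ℚ) + a * (1ℚ - (1ℚ + 0ℚ) * k) - e * a ≡ 0ℚ + a * (1ℚ - 0ℚ * k - e)
      lemma = solve-∀ ℚ-ring
      zeros : ∀ m r → integral m (λ _ → 0ℚ) r ≡ 0ℚ
      zeros zero    r = refl
      zeros (suc m) r = trans (cong (mix ρ 0ℚ) (zeros m (later r))) (mix-const ρ 0ℚ)
    integral-staircase m (suc j) g≤1 = begin
      κ * (value (suc j) + riemann (suc j)) + value (suc j) * (1ℚ - grid (suc (suc j))) - e * value (suc j)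
        ≡⟨ cong (λ a → κ * (value (suc j) + riemann (suc j)) + value (suc j) * (1ℚ - a * κ) - e * value (suc j)) (natℚ-suc (suc j)) ⟩
      κ * (value (suc j) + riemann (suc j)) + value (suc j) * (1ℚ - (1ℚ + natℚ (suc j)) * κ) - e * value (suc j)
        ≡⟨ lemma κ (value j) (value (suc j)) e (riemann (suc j)) (natℚ (suc j)) ⟩
      κ * riemann (suc j) + value j * (1ℚ - grid (suc j)) - e * value j + (value (suc j) - value j) * (1ℚ - grid (suc j) - e)
        ≤⟨ ℚₚ.+-mono-≤ (integral-staircase m j (ℚₚ.≤-trans (grid-suc j) g≤1))
             (*-monoʳ (p≤q⇒0≤q-p (cut-mono d (0≤grid j) (grid-suc j) g≤1)) (integral-threshold m (0≤grid (suc j)))) ⟩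
      integral m (staircase j) 0ℚ + (value (suc j) - value j) * integral m (threshold (grid (suc j))) 0ℚ
        ≡⟨ sym (integral-linear m (staircase j) (value (suc j) - value j) (threshold (grid (suc j))) 0ℚ) ⟩
      integral m (staircase (suc j)) 0ℚ ∎
      where
      open ℚₚ.≤-Reasoning
      e = ρ + (1ℚ - ρ) ^^ m
      lemma : ∀ k a b e s i → k * (b + s) + b * (1ℚ - (1ℚ + i) * k) - e * b ≡
              k * s + a * (1ℚ - i * k) - e * a + (b - a) * (1ℚ - i * k - e)
      lemma = solve-∀ ℚ-ring

    unforced-bound : ∀ K → grid (suc K) ≡ 1ℚ → ∀ m → unforced m 0ℚ ≤ 1ℚ - κ * riemann (suc K) + ρ + (1ℚ - ρ) ^^ m
    unforced-bound K grid≡1 m = begin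
      unforced m 0ℚ  ≡⟨ unforced≡ m 0ℚ ⟩
      1ℚ - integral m (cut d) 0ℚ  ≤⟨ ℚₚ.+-monoʳ-≤ 1ℚ (ℚₚ.neg-antimono-≤ (ℚₚ.≤-trans (integral-staircase m K g≤1)
                                             (integral-mono m (λ r 0≤r r≤1 → proj₁ (staircase≤ K g≤1 0≤r r≤1)) ℚₚ.≤-refl 0≤1))) ⟩
      1ℚ - (κ * riemann (suc K) + value K * (1ℚ - grid (suc K)) - e * value K)
                                        ≡⟨ cong (λ g → 1ℚ - (κ * riemann (suc K) + value K * (1ℚ - g) - e * value K)) grid≡1 ⟩
      1ℚ - (κ * riemann (suc K) + value K * (1ℚ - 1ℚ) - e * value K)
                                        ≤⟨ ≤-by (0≤* 0≤e (p≤q⇒0≤q-p (proj₂ (cut-range d (0≤grid K) g≤1)))) (lemma (κ * riemann (suc K)) (value K) ρ ((1ℚ - ρ) ^^ m)) ⟩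
      1ℚ - κ * riemann (suc K) + ρ + (1ℚ - ρ) ^^ m ∎
      where
      open ℚₚ.≤-Reasoning
      e = ρ + (1ℚ - ρ) ^^ m
      0≤e : 0ℚ ≤ e
      0≤e = 0≤+ 0≤ρ (0≤^^ m 0≤1-ρ)
      g≤1 : grid K ≤ 1ℚ
      g≤1 = ℚₚ.≤-trans (grid-suc K) (ℚₚ.≤-reflexive grid≡1)
      lemma : ∀ s v r y → 1ℚ - s + r + y ≡ 1ℚ - (s + v * (1ℚ - 1ℚ) - (r + y) * v) + (r + y) * (1ℚ - v)
      lemma = solve-∀ ℚ-ring

-- Fixed-point evaluation of the Riemann sum

module Approximation (K S : ℕ) {{_ : ℕ.NonZero K}} {{_ : ℕ.NonZero (S ℕ.* S)}} where

  -- `S` times `cut k (j / K)`, rounded down at every level. Exact denominators would be cubed from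
  -- level to level; rounding down preserves a lower bound.
  approx : ℕ → ℕ → ℕ
  cube/ : ℕ → ℕ

  approx zero    j = 0
  approx (suc k) j = cube/ ((j ℕ.* S ℕ.+ (K ℕ.∸ j) ℕ.* approx k j) ℕ./ K)

  cube/ u = u ℕ.* u ℕ.* u ℕ./ (S ℕ.* S)

  approxSum : ℕ → ℕ → ℕ
  approxSum d zero    = 0
  approxSum d (suc j) = approx d j ℕ.+ approxSum d j

  module _ {κ ι : ℚ} (0≤κ : 0ℚ ≤ κ) (0≤ι : 0ℚ ≤ ι) (κK : natℚ K * κ ≡ 1ℚ) (ιS : natℚ S * ι ≡ 1ℚ)
           (d : ℕ) {ρ : ℚ} (0≤ρ : 0ℚ ≤ ρ) (ρ≤1 : ρ ≤ 1ℚ) where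

    open Riemann.Grid d ρ 0≤ρ ρ≤1 κ 0≤κ

    grid≤1 : ∀ {j} → j ℕ.≤ K → grid j ≤ 1ℚ
    grid≤1 j≤K = ℚₚ.≤-trans (*-monoˡ 0≤κ (natℚ-mono j≤K)) (ℚₚ.≤-reflexive κK)

    approx-cut : ∀ k {j} → j ℕ.≤ K → ι * natℚ (approx k j) ≤ cut k (grid j)
    approx-cut zero    {j} j≤K = ℚₚ.≤-reflexive (trans (cong (ι *_) natℚ-zero) (ℚₚ.*-zeroʳ ι))
    approx-cut (suc k) {j} j≤K = begin
      ι * natℚ (cube/ u)
        ≡⟨ trans (sym (ℚₚ.*-identityʳ _)) (trans (cong (λ a → ι * natℚ (cube/ u) * (a * a)) (sym ιS)) (lemma₁ ι (natℚ (cube/ u)) (natℚ S))) ⟩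
      ι * (ι * ι) * (natℚ (cube/ u) * (natℚ S * natℚ S))
        ≡⟨ cong (ι * (ι * ι) *_) (sym (trans (natℚ-* (cube/ u) (S ℕ.* S)) (cong (natℚ (cube/ u) *_) (natℚ-* S S)))) ⟩
      ι * (ι * ι) * natℚ (cube/ u ℕ.* (S ℕ.* S))
        ≤⟨ *-monoʳ (0≤* 0≤ι (0≤* 0≤ι 0≤ι)) (natℚ-mono (ℕ.m/n*n≤m (u ℕ.* u ℕ.* u) (S ℕ.* S))) ⟩
      ι * (ι * ι) * natℚ (u ℕ.* u ℕ.* u)
        ≡⟨ trans (cong (ι * (ι * ι) *_) (trans (natℚ-* (u ℕ.* u) u) (cong (_* natℚ u) (natℚ-* u u)))) (lemma₂ ι (natℚ u)) ⟩
      (ι * natℚ u) ^^ 3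
        ≤⟨ *-mono 0≤x (0≤^^ 2 0≤t) x≤t (*-mono 0≤x (0≤^^ 1 0≤t) x≤t (*-monoˡ 0≤1 x≤t)) ⟩
      t ^^ 3 ∎
      where
      open ℚₚ.≤-Reasoning
      q = approx k j
      N = j ℕ.* S ℕ.+ (K ℕ.∸ j) ℕ.* q
      u = N ℕ./ K
      t = mix (grid j) 1ℚ (cut k (grid j))
      0≤x : 0ℚ ≤ ι * natℚ u
      0≤x = 0≤* 0≤ι (0≤natℚ u)
      lemma₁ : ∀ i c s → i * c * (s * i * (s * i)) ≡ i * (i * i) * (c * (s * s))
      lemma₁ = solve-∀ ℚ-ring
      lemma₂ : ∀ i u → i * (i * i) * (u * u * u) ≡ i * u * (i * u * (i * u * 1ℚ))
      lemma₂ = solve-∀ ℚ-ring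
      x≤t : ι * natℚ u ≤ t
      x≤t = begin
        ι * natℚ u
          ≡⟨ trans (sym (ℚₚ.*-identityʳ _)) (trans (cong (ι * natℚ u *_) (sym κK)) (lemma₃ ι (natℚ u) (natℚ K) κ)) ⟩
        ι * κ * (natℚ u * natℚ K)
          ≡⟨ cong (ι * κ *_) (sym (natℚ-* u K)) ⟩
        ι * κ * natℚ (u ℕ.* K)
          ≤⟨ *-monoʳ (0≤* 0≤ι 0≤κ) (natℚ-mono (ℕ.m/n*n≤m N K)) ⟩
        ι * κ * natℚ N
          ≡⟨ cong (ι * κ *_) (trans (natℚ-+ (j ℕ.* S) _) (cong₂ _+_ (natℚ-* j S)
               (trans (natℚ-* (K ℕ.∸ j) q) (cong (_* natℚ q) (natℚ-∸ j≤K))))) ⟩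
        ι * κ * (natℚ j * natℚ S + (natℚ K - natℚ j) * natℚ q)
          ≡⟨ lemma₄ ι κ (natℚ j) (natℚ S) (natℚ K) (natℚ q) ⟩
        grid j * (natℚ S * ι) + (natℚ K * κ - grid j) * (ι * natℚ q)
          ≡⟨ cong₂ (λ a b → grid j * a + (b - grid j) * (ι * natℚ q)) ιS κK ⟩
        mix (grid j) 1ℚ (ι * natℚ q)
          ≤⟨ mix-mono (0≤grid j) (grid≤1 j≤K) ℚₚ.≤-refl (approx-cut k j≤K) ⟩
        t ∎
        where
        lemma₃ : ∀ i u K k → i * u * (K * k) ≡ i * k * (u * K)
        lemma₃ = solve-∀ ℚ-ring
        lemma₄ : ∀ i k j s K q → i * k * (j * s + (K - j) * q) ≡ j * k * (s * i) + (K * k - j * k) * (i * q)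
        lemma₄ = solve-∀ ℚ-ring

      0≤t : 0ℚ ≤ t
      0≤t = ℚₚ.≤-trans 0≤x x≤t

    approx-riemann : ∀ {j} → j ℕ.≤ K → ι * natℚ (approxSum d j) ≤ riemann j
    approx-riemann {zero}  _ = ℚₚ.≤-reflexive (trans (cong (ι *_) natℚ-zero) (ℚₚ.*-zeroʳ ι))
    approx-riemann {suc j} j<K = begin
      ι * natℚ (approx d j ℕ.+ approxSum d j)  ≡⟨ cong (ι *_) (natℚ-+ (approx d j) _) ⟩
      ι * (natℚ (approx d j) + natℚ (approxSum d j))  ≡⟨ ℚₚ.*-distribˡ-+ ι _ _ ⟩
      ι * natℚ (approx d j) + ι * natℚ (approxSum d j)  ≤⟨ ℚₚ.+-mono-≤ (approx-cut d (ℕₚ.<⇒≤ j<K)) (approx-riemann (ℕₚ.<⇒≤ j<K)) ⟩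
      value j + riemann j  ∎
      where open ℚₚ.≤-Reasoning


-- Bounds the decay only by `1 / (1 + m ρ)`, which is enough because the number of rounds is a
-- constant of any size.
bernoulli : ∀ {ρ} m → 0ℚ ≤ ρ → ρ ≤ 1ℚ → (1ℚ - ρ) ^^ m * (1ℚ + natℚ m * ρ) ≤ 1ℚ
bernoulli {ρ} zero    0≤ρ ρ≤1 rewrite natℚ-zero = ℚₚ.≤-reflexive (lemma ρ)
  where
  lemma : ∀ r → 1ℚ * (1ℚ + 0ℚ * r) ≡ 1ℚ
  lemma = solve-∀ ℚ-ring
bernoulli {ρ} (suc m) 0≤ρ ρ≤1 rewrite natℚ-suc m = ℚₚ.≤-trans
  (≤-by (0≤* (0≤^^ m (p≤q⇒0≤q-p ρ≤1)) (0≤* (0≤+ 0≤1 (0≤natℚ m)) (0≤* 0≤ρ 0≤ρ))) (lemma ρ ((1ℚ - ρ) ^^ m) (natℚ m)))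
  (bernoulli m 0≤ρ ρ≤1)
  where
  lemma : ∀ r y i → y * (1ℚ + i * r) ≡ (1ℚ - r) * y * (1ℚ + (1ℚ + i) * r) + y * ((1ℚ + i) * (r * r))
  lemma = solve-∀ ℚ-ring

^^-+ : ∀ x a b → x ^^ (a ℕ.+ b) ≡ x ^^ a * x ^^ b
^^-+ x zero    b = sym (ℚₚ.*-identityˡ (x ^^ b))
^^-+ x (suc a) b = trans (cong (x *_) (^^-+ x a b)) (sym (ℚₚ.*-assoc x (x ^^ a) (x ^^ b)))

reciprocal : ∀ {ρ} → 0ℚ ≤ ρ → ∃[ w ] (0ℚ ≤ w × w ≤ 1ℚ × (1ℚ + ρ) * w ≡ 1ℚ)
reciprocal {ρ} 0≤ρ = w , 0≤w , w≤1 , inverse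
  where
  1≤1+ρ : 1ℚ ≤ 1ℚ + ρ
  1≤1+ρ = ≤-by 0≤ρ refl
  instance
    1+ρ-positive : ℚ.Positive (1ℚ + ρ)
    1+ρ-positive = ℚ.positive (ℚₚ.<-≤-trans (ℚₚ.positive⁻¹ 1ℚ) 1≤1+ρ)
    1+ρ-nonZero : ℚ.NonZero (1ℚ + ρ)
    1+ρ-nonZero = ℚₚ.pos⇒nonZero (1ℚ + ρ)
  w : ℚ
  w = ℚ.1/ (1ℚ + ρ)
  inverse : (1ℚ + ρ) * w ≡ 1ℚ
  inverse = ℚₚ.*-inverseʳ (1ℚ + ρ)
  0≤w : 0ℚ ≤ w
  0≤w = ℚₚ.<⇒≤ (ℚₚ.positive⁻¹ w {{ℚₚ.1/pos⇒pos (1ℚ + ρ)}})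
  w≤1 : w ≤ 1ℚ
  w≤1 = ℚₚ.≤-trans (ℚₚ.≤-trans (ℚₚ.≤-reflexive (sym (ℚₚ.*-identityˡ w))) (*-monoˡ 0≤w 1≤1+ρ)) (ℚₚ.≤-reflexive inverse)

-- The number ½ is a variable h here to keep its powers from being evaluated.
module Estimate (h : ℚ) (½≡h : ½ ≡ h) where

  0≤h^ : ∀ m → 0ℚ ≤ h ^^ m
  0≤h^ m = 0≤^^ m (subst (0ℚ ≤_) ½≡h 0≤½)

  h≤1 : h ≤ 1ℚ
  h≤1 = subst (_≤ 1ℚ) ½≡h (ℚₚ.≤ᵇ⇒≤ tt)

  scale : ∀ m → natℚ (2 ^ m) * h ^^ m ≡ 1ℚ
  scale m = trans (cong₂ (λ a x → a * x ^^ m) (natℚ-2^ m) (sym ½≡h)) (trans (ℚₚ.*-comm (2ℚ ^^ m) (½ ^^ m)) (halves m))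

  powers : ∀ a b → natℚ (2 ^ a) * h ^^ (a ℕ.+ b) ≡ h ^^ b
  powers a b = begin
    natℚ (2 ^ a) * h ^^ (a ℕ.+ b)  ≡⟨ cong (natℚ (2 ^ a) *_) (^^-+ h a b) ⟩
    natℚ (2 ^ a) * (h ^^ a * h ^^ b)  ≡⟨ sym (ℚₚ.*-assoc (natℚ (2 ^ a)) (h ^^ a) (h ^^ b)) ⟩
    natℚ (2 ^ a) * h ^^ a * h ^^ b  ≡⟨ cong (_* h ^^ b) (scale a) ⟩
    1ℚ * h ^^ b  ≡⟨ ℚₚ.*-identityˡ _ ⟩
    h ^^ b  ∎
    where open ≡-Reasoning

  ρ₀ : ℚ
  ρ₀ = h ^^ 16

  0≤ρ₀ : 0ℚ ≤ ρ₀
  0≤ρ₀ = 0≤h^ 16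

  ρ₀≤1 : ρ₀ ≤ 1ℚ
  ρ₀≤1 = ^^≤1 16 (subst (0ℚ ≤_) ½≡h 0≤½) h≤1

  -- For `R = 2^32` and `ρ₀ = 2^-16` the product `R ρ₀` is `2^16 = 1 / ρ₀`, so Bernoulli's bound is
  -- below `ρ₀`.
  residue : ∀ {R} → R ≡ 2 ^ 16 ℕ.* 2 ^ 16 → (1ℚ - ρ₀) ^^ R ≤ ρ₀
  residue {R} R≡ = begin
    y  ≡⟨ sym (trans (cong (y *_) (scale 16)) (ℚₚ.*-identityʳ y)) ⟩
    y * (natℚ (2 ^ 16) * ρ₀)  ≤⟨ *-monoʳ (0≤^^ R (p≤q⇒0≤q-p ρ₀≤1)) (*-monoˡ 0≤ρ₀ 2^16≤) ⟩
    y * ((1ℚ + natℚ R * ρ₀) * ρ₀)  ≡⟨ sym (ℚₚ.*-assoc y _ _) ⟩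
    y * (1ℚ + natℚ R * ρ₀) * ρ₀  ≤⟨ *-monoˡ 0≤ρ₀ (bernoulli R 0≤ρ₀ ρ₀≤1) ⟩
    1ℚ * ρ₀  ≡⟨ ℚₚ.*-identityˡ _ ⟩
    ρ₀  ∎
    where
    open ℚₚ.≤-Reasoning
    y = (1ℚ - ρ₀) ^^ R
    2^16≤ : natℚ (2 ^ 16) ≤ 1ℚ + natℚ R * ρ₀
    2^16≤ = ≤-by 0≤1 (trans (ℚₚ.+-comm 1ℚ (natℚ R * ρ₀)) (cong (_+ 1ℚ) (begin-equality
      natℚ R * ρ₀  ≡⟨ cong (_* ρ₀) (trans (cong natℚ R≡) (natℚ-* (2 ^ 16) (2 ^ 16))) ⟩
      natℚ (2 ^ 16) * natℚ (2 ^ 16) * ρ₀  ≡⟨ ℚₚ.*-assoc (natℚ (2 ^ 16)) _ ρ₀ ⟩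
      natℚ (2 ^ 16) * (natℚ (2 ^ 16) * ρ₀)  ≡⟨ cong (natℚ (2 ^ 16) *_) (scale 16) ⟩
      natℚ (2 ^ 16) * 1ℚ  ≡⟨ ℚₚ.*-identityʳ _ ⟩
      natℚ (2 ^ 16)  ∎)))

  module _ (d : ℕ) where

    open Forcing d ρ₀
    open Approximation (2 ^ 12) (2 ^ 24)
    open Riemann.Grid d ρ₀ 0≤ρ₀ ρ₀≤1 (h ^^ 12) (0≤h^ 12)

    record Good (σ : ℚ) : Set where
      field
        ½≤σ       : ½ ≤ σ
        0≤σ-ρ     : 0ℚ ≤ σ - ρ₀
        unforced≤ : ∀ m → unforced m 0ℚ ≤ σ - ρ₀ + (1ℚ - ρ₀) ^^ m
        σ≤        : natℚ 245 * (σ + ρ₀) ≤ natℚ 136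

    -- In units of `2^-20`, `s` is σ, `t` is a lower bound for the Riemann sum, `2^5` is `2 ρ₀` and
    -- `2^4` is `ρ₀`. One `ρ₀` is the error of the Riemann sum, the other the slack for interrupted
    -- rounds. The factor `2^16` of `t` arises because `approxSum` counts units of `2^-12 2^-24`.
    good : ∀ s t → s ℕ.+ t ≡ 2 ^ 20 ℕ.+ 2 ^ 5 → 2 ^ 19 ℕ.≤ s → 245 ℕ.* (s ℕ.+ 2 ^ 4) ℕ.≤ 136 ℕ.* 2 ^ 20 →
           t ℕ.* 2 ^ 16 ℕ.≤ approxSum d (2 ^ 12) → Good (natℚ s * h ^^ 20)
    good s t s+t 2^19≤s s≤ t≤ = record
      { ½≤σ = ½≤σ ; 0≤σ-ρ = p≤q⇒0≤q-p (ℚₚ.≤-trans ρ₀≤½ ½≤σ) ; unforced≤ = unforced≤ ; σ≤ = σ≤ }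
      where
      open ℚₚ.≤-Reasoning
      σ κ ι : ℚ
      σ = natℚ s * h ^^ 20
      κ = h ^^ 12
      ι = h ^^ 24
      h^1 : h ^^ 1 ≡ ½
      h^1 = trans (ℚₚ.*-identityʳ h) (sym ½≡h)
      ρ₀≤½ : ρ₀ ≤ ½
      ρ₀≤½ = begin
        h * h ^^ 15  ≤⟨ *-monoʳ (subst (0ℚ ≤_) ½≡h 0≤½) (^^≤1 15 (subst (0ℚ ≤_) ½≡h 0≤½) h≤1) ⟩
        h * 1ℚ  ≡⟨ h^1 ⟩
        ½  ∎
      ½≤σ : ½ ≤ σ
      ½≤σ = begin
        ½  ≡⟨ sym (trans (powers 19 1) h^1) ⟩
        natℚ (2 ^ 19) * h ^^ 20  ≤⟨ *-monoˡ (0≤h^ 20) (natℚ-mono 2^19≤s) ⟩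
        σ  ∎
      κι : h ^^ 20 ≡ κ * ι * natℚ (2 ^ 16)
      κι = trans (sym (powers 16 20)) (trans (ℚₚ.*-comm (natℚ (2 ^ 16)) (h ^^ 36)) (cong (_* natℚ (2 ^ 16)) (^^-+ h 12 24)))
      unit : 1ℚ + ρ₀ + ρ₀ ≡ (natℚ (2 ^ 20) + natℚ (2 ^ 5)) * h ^^ 20
      unit = sym (trans (ℚₚ.*-distribʳ-+ (h ^^ 20) (natℚ (2 ^ 20)) (natℚ (2 ^ 5)))
        (trans (cong₂ _+_ (scale 20) (trans (powers 5 15) 2ρ₀)) (sym (ℚₚ.+-assoc 1ℚ ρ₀ ρ₀))))
        where
        lemma : ∀ x → x ≡ ½ * x + ½ * x
        lemma = solve-∀ ℚ-ring
        2ρ₀ : h ^^ 15 ≡ ρ₀ + ρ₀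
        2ρ₀ = trans (lemma (h ^^ 15)) (cong (λ a → a * h ^^ 15 + a * h ^^ 15) ½≡h)
      riemann≥ : 1ℚ + ρ₀ + ρ₀ ≤ σ + κ * riemann (2 ^ 12)
      riemann≥ = begin
        1ℚ + ρ₀ + ρ₀  ≡⟨ unit ⟩
        (natℚ (2 ^ 20) + natℚ (2 ^ 5)) * h ^^ 20  ≡⟨ cong (_* h ^^ 20) (trans (sym (natℚ-+ (2 ^ 20) (2 ^ 5))) (trans (cong natℚ (sym s+t)) (natℚ-+ s t))) ⟩
        (natℚ s + natℚ t) * h ^^ 20  ≡⟨ ℚₚ.*-distribʳ-+ (h ^^ 20) (natℚ s) (natℚ t) ⟩
        σ + natℚ t * h ^^ 20  ≡⟨ cong (λ a → σ + natℚ t * a) κι ⟩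
        σ + natℚ t * (κ * ι * natℚ (2 ^ 16))  ≡⟨ cong (σ +_) (lemma κ ι (natℚ t) (natℚ (2 ^ 16))) ⟩
        σ + κ * (ι * (natℚ t * natℚ (2 ^ 16)))  ≡⟨ cong (λ a → σ + κ * (ι * a)) (sym (natℚ-* t (2 ^ 16))) ⟩
        σ + κ * (ι * natℚ (t ℕ.* 2 ^ 16))  ≤⟨ ℚₚ.+-monoʳ-≤ σ (*-monoʳ (0≤h^ 12) (ℚₚ.≤-trans (*-monoʳ (0≤h^ 24) (natℚ-mono t≤))
                                                             (approx-riemann (0≤h^ 12) (0≤h^ 24) (scale 12) (scale 24) d 0≤ρ₀ ρ₀≤1 ℕₚ.≤-refl))) ⟩
        σ + κ * riemann (2 ^ 12)  ∎
        where
        lemma : ∀ k i t a → t * (k * i * a) ≡ k * (i * (t * a))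
        lemma = solve-∀ ℚ-ring

      unforced≤ : ∀ m → unforced m 0ℚ ≤ σ - ρ₀ + (1ℚ - ρ₀) ^^ m
      unforced≤ m = ℚₚ.≤-trans (unforced-bound (2 ^ 12 ℕ.∸ 1) (scale 12) m)
        (≤-by (p≤q⇒0≤q-p riemann≥) (lemma σ (κ * riemann (2 ^ 12)) ρ₀ ((1ℚ - ρ₀) ^^ m)))
        where
        lemma : ∀ s x r y → s - r + y ≡ 1ℚ - x + r + y + (s + x - (1ℚ + r + r))
        lemma = solve-∀ ℚ-ring

      σ≤ : natℚ 245 * (σ + ρ₀) ≤ natℚ 136
      σ≤ = begin
        natℚ 245 * (σ + ρ₀)  ≡⟨ cong (λ a → natℚ 245 * (σ + a)) (sym (powers 4 16)) ⟩
        natℚ 245 * (σ + natℚ (2 ^ 4) * h ^^ 20)  ≡⟨ lemma (natℚ 245) (natℚ s) (natℚ (2 ^ 4)) (h ^^ 20) ⟩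
        natℚ 245 * (natℚ s + natℚ (2 ^ 4)) * h ^^ 20  ≡⟨ cong (_* h ^^ 20) (sym (trans (natℚ-* 245 (s ℕ.+ 2 ^ 4)) (cong (natℚ 245 *_) (natℚ-+ s (2 ^ 4))))) ⟩
        natℚ (245 ℕ.* (s ℕ.+ 2 ^ 4)) * h ^^ 20  ≤⟨ *-monoˡ (0≤h^ 20) (natℚ-mono s≤) ⟩
        natℚ (136 ℕ.* 2 ^ 20) * h ^^ 20  ≡⟨ cong (_* h ^^ 20) (natℚ-* 136 (2 ^ 20)) ⟩
        natℚ 136 * natℚ (2 ^ 20) * h ^^ 20  ≡⟨ ℚₚ.*-assoc (natℚ 136) _ (h ^^ 20) ⟩
        natℚ 136 * (natℚ (2 ^ 20) * h ^^ 20)  ≡⟨ cong (natℚ 136 *_) (scale 20) ⟩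
        natℚ 136 * 1ℚ  ≡⟨ ℚₚ.*-identityʳ _ ⟩
        natℚ 136  ∎
        where
        lemma : ∀ c s a x → c * (s * x + a * x) ≡ c * (s + a) * x
        lemma = solve-∀ ℚ-ring

-- Executions of programs

module Execution {k} (goal : Store k → ℚ) where

  -- Termination within the given number of steps together with the expected value of `goal` at the
  -- end. `always` serves the steps whose result does not depend on the coin, `either` those that
  -- flip it.
  data Achieves : Config k → ℕ → ℚ → Set where
    halted : ∀ {σ t} → Achieves ([] , σ) t (goal σ)
    always : ∀ {C t p} → (∀ b → Achieves (step C b) t p) → Achieves C (suc t) p
    either : ∀ {C t p q} → Achieves (step C false) t p → Achieves (step C true) t q → Achieves C (suc t) (½ * (p + q))

  weaken : ∀ {C t t′ p} → t ℕ.≤ t′ → Achieves C t p → Achieves C t′ p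
  weaken le       halted       = halted
  weaken (s≤s le) (always h)   = always (λ b → weaken le (h b))
  weaken (s≤s le) (either f g) = either (weaken le f) (weaken le g)

  infix 4 _⊢_⇓_within_

  -- Coin-free execution in continuation form: any statement about the commands that follow is
  -- transported backwards, so that sequencing becomes composition of functions.
  record _⊢_⇓_within_ (σ : Store k) (c : Cmd k) (σ′ : Store k) (t : ℕ) : Set where
    constructor runs
    field continue : ∀ {κ s p} → Achieves (κ , σ′) s p → Achieves (c ∷ κ , σ) (t ℕ.+ s) p

  open _⊢_⇓_within_ public

  slack : ∀ {σ c σ′ t t′} → t ℕ.≤ t′ → σ ⊢ c ⇓ σ′ within t → σ ⊢ c ⇓ σ′ within t′
  slack le f = runs λ a → weaken (ℕₚ.+-monoˡ-≤ _ le) (continue f a)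

  reassociate : ∀ t₁ t₂ {s C p} → Achieves C (t₁ ℕ.+ (t₂ ℕ.+ s)) p → Achieves C (t₁ ℕ.+ t₂ ℕ.+ s) p
  reassociate t₁ t₂ {s} {C} {p} = subst (λ t → Achieves C t p) (sym (ℕₚ.+-assoc t₁ t₂ s))

  assign : ∀ {σ x e} → σ ⊢ x ≔ e ⇓ σ [ x ]≔ ⟦ e ⟧ σ within 1
  assign = runs λ a → always (λ b → a)

  infixr 5 _then_
  _then_ : ∀ {σ c σ₁ d σ₂ t₁ t₂} → σ ⊢ c ⇓ σ₁ within t₁ → σ₁ ⊢ d ⇓ σ₂ within t₂ →
           σ ⊢ c ⨾ d ⇓ σ₂ within suc (t₁ ℕ.+ t₂)
  _then_ {t₁ = t₁} {t₂} f g = runs λ a → always (λ b → reassociate t₁ t₂ (continue f (continue g a)))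

  branch : ∀ {σ e c d κ s p} v → isTrue (⟦ e ⟧ σ) ≡ v → Achieves ((if v then c else d) ∷ κ , σ) s p →
           Achieves (ifte e c d ∷ κ , σ) (suc s) p
  branch {σ} {e} {c} {d} {κ} {s} {p} v eq a =
    always (λ b → subst (λ v → Achieves ((if v then c else d) ∷ κ , σ) s p) (sym eq) a)

  loop : ∀ {σ e c κ s p} v → isTrue (⟦ e ⟧ σ) ≡ v → Achieves ((if v then c ∷ while e c ∷ κ else κ) , σ) s p →
         Achieves (while e c ∷ κ , σ) (suc s) p
  loop {σ} {e} {c} {κ} {s} {p} v eq a =
    always (λ b → subst (λ v → Achieves ((if v then c ∷ while e c ∷ κ else κ) , σ) s p) (sym eq) a)

  if-true : ∀ {σ e c d σ′ t} → isTrue (⟦ e ⟧ σ) ≡ true → σ ⊢ c ⇓ σ′ within t → σ ⊢ ifte e c d ⇓ σ′ within suc t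
  if-true eq f = runs λ a → branch true eq (continue f a)

  if-false : ∀ {σ e c d σ′ t} → isTrue (⟦ e ⟧ σ) ≡ false → σ ⊢ d ⇓ σ′ within t → σ ⊢ ifte e c d ⇓ σ′ within suc t
  if-false eq f = runs λ a → branch false eq (continue f a)

  while-done : ∀ {σ e c} → isTrue (⟦ e ⟧ σ) ≡ false → σ ⊢ while e c ⇓ σ within 1
  while-done eq = runs λ a → loop false eq a

  while-step : ∀ {σ e c σ₁ σ₂ t₁ t₂} → isTrue (⟦ e ⟧ σ) ≡ true → σ ⊢ c ⇓ σ₁ within t₁ →
               σ₁ ⊢ while e c ⇓ σ₂ within t₂ → σ ⊢ while e c ⇓ σ₂ within suc (t₁ ℕ.+ t₂)
  while-step {t₁ = t₁} {t₂} eq f g = runs λ a → loop true eq (reassociate t₁ t₂ (continue f (continue g a)))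

  value : ℕ → Config k → ℚ
  value zero    (κ , σ) = goal σ
  value (suc T) C       = ½ * (value T (step C false) + value T (step C true))

  average : ∀ x → ½ * (x + x) ≡ x
  average = solve-∀ ℚ-ring
  value-halted : ∀ T σ → value T ([] , σ) ≡ goal σ
  value-halted zero    σ = refl
  value-halted (suc T) σ = trans (cong₂ (λ x y → ½ * (x + y)) (value-halted T σ) (value-halted T σ)) (average (goal σ))

  achieves-value : ∀ {C t T p} → Achieves C t p → t ℕ.≤ T → value T C ≡ p
  achieves-value {T = T} (halted {σ}) le = value-halted T σ
  achieves-value (always h) (s≤s le) =
    trans (cong₂ (λ x y → ½ * (x + y)) (achieves-value (h false) le) (achieves-value (h true) le)) (average _)
  achieves-value (either f g) (s≤s le) = cong₂ (λ x y → ½ * (x + y)) (achieves-value f le) (achieves-value g le)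

  runFrom : ∀ {T} → Config k → Vec Bool T → Config k
  runFrom = Vec.foldl (λ _ → Config k) step

  runFrom-halted : ∀ {T} σ (ω : Vec Bool T) → runFrom ([] , σ) ω ≡ ([] , σ)
  runFrom-halted σ []      = refl
  runFrom-halted σ (b ∷ ω) = runFrom-halted σ ω

  achieves-halts : ∀ {C t T p} → Achieves C t p → t ℕ.≤ T → (ω : Vec Bool T) → Halted (runFrom C ω)
  achieves-halts (halted {σ}) le ω = cong proj₁ (runFrom-halted σ ω)
  achieves-halts (always h) (s≤s le) (b ∷ ω) = achieves-halts (h b) le ω
  achieves-halts (either f g) (s≤s le) (false ∷ ω) = achieves-halts f le ω
  achieves-halts (either f g) (s≤s le) (true ∷ ω)  = achieves-halts g le ω

-- Lists as arrays indexed by the length of another list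

size : Tree → ℕ
size nil        = 0
size (cons _ a) = suc (size a)

getᵗ : Tree → Tree → Tree
getᵗ nil        t = hdᵗ t
getᵗ (cons _ a) t = getᵗ a (tlᵗ t)

setᵗ : Tree → Tree → Tree → Tree
setᵗ nil        w t = cons w (tlᵗ t)
setᵗ (cons _ a) w t = cons (hdᵗ t) (setᵗ a w (tlᵗ t))

dropᵗ : Tree → Tree → Tree
dropᵗ nil        t = t
dropᵗ (cons _ a) t = dropᵗ a (tlᵗ t)

reverseᵗ : Tree → Tree → Tree
reverseᵗ nil        t = t
reverseᵗ (cons h r) t = reverseᵗ r (cons h t)

prefixᵗ : Tree → Tree → Tree → Tree
prefixᵗ nil        t r = r
prefixᵗ (cons _ a) t r = prefixᵗ a (tlᵗ t) (cons (hdᵗ t) r)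

hd-dropᵗ : ∀ a t → hdᵗ (dropᵗ a t) ≡ getᵗ a t
hd-dropᵗ nil        t = refl
hd-dropᵗ (cons _ a) t = hd-dropᵗ a (tlᵗ t)

-- `access` walks a list zipper, stacking the traversed prefix in reverse; restoring it around the
-- new entry yields the updated array.
reverse-prefixᵗ : ∀ a w t r → reverseᵗ (prefixᵗ a t r) (cons w (tlᵗ (dropᵗ a t))) ≡ reverseᵗ r (setᵗ a w t)
reverse-prefixᵗ nil        w t r = refl
reverse-prefixᵗ (cons _ a) w t r = reverse-prefixᵗ a w (tlᵗ t) (cons (hdᵗ t) r)

size-prefixᵗ : ∀ a t r → size (prefixᵗ a t r) ≡ size a ℕ.+ size r
size-prefixᵗ nil        t r = refl
size-prefixᵗ (cons _ a) t r = trans (size-prefixᵗ a (tlᵗ t) (cons (hdᵗ t) r)) (ℕₚ.+-suc (size a) (size r))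

one : ∀ {k} → Expr k
one = cons nil nil

oneᵗ : Tree
oneᵗ = cons nil nil

-- Variable F# holds the formula and T# the current partial assignment; a# to
-- r# are the registers of `access`, cs# to stk# those of `refuteᶜ`.
Var : Set
Var = Fin 17

F# a# w# e# t# r# T# l# z# cs# C# ok# fd# stk# u# rc# U# : Var
F#   = # 0
a#   = # 1
w#   = # 2
e#   = # 3
t#   = # 4
r#   = # 5
T#   = # 6
l#   = # 7
z#   = # 8
cs#  = # 9
C#   = # 10
ok#  = # 11
fd#  = # 12
stk# = # 13
u#   = # 14
rc#  = # 15
U#   = # 16

-- With index a# and array t#: e# receives the entry, which is replaced by w#.
access descend ascend : Cmd 17
descend = while (` a#) (r# ≔ cons (hd (` t#)) (` r#) ⨾ t# ≔ tl (` t#) ⨾ a# ≔ tl (` a#))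
ascend  = while (` r#) (t# ≔ cons (hd (` r#)) (` t#) ⨾ r# ≔ tl (` r#))
access  = descend ⨾ e# ≔ hd (` t#) ⨾ t# ≔ cons (` w#) (tl (` t#)) ⨾ ascend

accessTime : ℕ → ℕ
accessTime m = suc (m ℕ.* 6 ℕ.+ 1 ℕ.+ suc (1 ℕ.+ suc (1 ℕ.+ (m ℕ.* 4 ℕ.+ 1))))

module Access (goal : Store 17 → ℚ) where

  open Execution goal

  descend-runs : ∀ F a w e t r {rest : Vec Tree 11} →
    (F ∷ a ∷ w ∷ e ∷ t ∷ r ∷ rest) ⊢ descend ⇓ (F ∷ nil ∷ w ∷ e ∷ dropᵗ a t ∷ prefixᵗ a t r ∷ rest) within (size a ℕ.* 6 ℕ.+ 1)
  descend-runs F nil        w e t r = while-done refl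
  descend-runs F (cons _ a) w e t r =
    while-step refl (assign then assign then assign) (descend-runs F a w e (tlᵗ t) (cons (hdᵗ t) r))

  ascend-runs : ∀ F a w e t r {rest : Vec Tree 11} →
    (F ∷ a ∷ w ∷ e ∷ t ∷ r ∷ rest) ⊢ ascend ⇓ (F ∷ a ∷ w ∷ e ∷ reverseᵗ r t ∷ nil ∷ rest) within (size r ℕ.* 4 ℕ.+ 1)
  ascend-runs F a w e t nil        = while-done refl
  ascend-runs F a w e t (cons h r) = while-step refl (assign then assign) (ascend-runs F a w e (cons h t) r)

  access-runs : ∀ F a w e t {rest : Vec Tree 11} →
    (F ∷ a ∷ w ∷ e ∷ t ∷ nil ∷ rest) ⊢ access ⇓ (F ∷ nil ∷ w ∷ getᵗ a t ∷ setᵗ a w t ∷ nil ∷ rest) within accessTime (size a)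
  access-runs F a w e t {rest} =
    descend-runs F a w e t nil then assign then assign then
    subst₂ (λ e′ t′ → (F ∷ nil ∷ w ∷ hdᵗ (dropᵗ a t) ∷ cons w (tlᵗ (dropᵗ a t)) ∷ prefixᵗ a t nil ∷ rest) ⊢ ascend ⇓
                      (F ∷ nil ∷ w ∷ e′ ∷ t′ ∷ nil ∷ rest) within (size a ℕ.* 4 ℕ.+ 1))
      (hd-dropᵗ a t) (reverse-prefixᵗ a w t nil)
      (subst (λ m → (F ∷ nil ∷ w ∷ hdᵗ (dropᵗ a t) ∷ cons w (tlᵗ (dropᵗ a t)) ∷ prefixᵗ a t nil ∷ rest) ⊢ ascend ⇓
                    (F ∷ nil ∷ w ∷ hdᵗ (dropᵗ a t) ∷ reverseᵗ (prefixᵗ a t nil) (cons w (tlᵗ (dropᵗ a t))) ∷ nil ∷ rest) within (m ℕ.* 4 ℕ.+ 1))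
             (trans (size-prefixᵗ a t nil) (ℕₚ.+-identityʳ (size a)))
             (ascend-runs F nil w (hdᵗ (dropᵗ a t)) (cons w (tlᵗ (dropᵗ a t))) (prefixᵗ a t nil)))

-- The refutation procedure as a program

skip : Cmd 17
skip = z# ≔ ` z#

falsifiedᶜ : Cmd 17
falsifiedᶜ =
  ifte (hd (` e#)) (z# ≔ nil)
  (ifte (` e#) (ifte (hd (` l#)) (z# ≔ nil) (z# ≔ one))
               (ifte (hd (` l#)) (z# ≔ one) (z# ≔ nil)))

-- The language has no procedures: the code of the callee is inlined, and the caller's registers are
-- saved on the stack. The result moves to `z#` before `fd#` is restored.
callᶜ : Cmd 17 → Cmd 17
callᶜ body =
  stk# ≔ cons (` T#) (cons (` cs#) (cons (` C#) (cons (` ok#) (cons (` fd#) (` stk#))))) ⨾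
  T# ≔ ` t# ⨾ t# ≔ nil ⨾ body ⨾ z# ≔ ` fd# ⨾
  T# ≔ hd (` stk#) ⨾ stk# ≔ tl (` stk#) ⨾ cs# ≔ hd (` stk#) ⨾ stk# ≔ tl (` stk#) ⨾
  C# ≔ hd (` stk#) ⨾ stk# ≔ tl (` stk#) ⨾ ok# ≔ hd (` stk#) ⨾ stk# ≔ tl (` stk#) ⨾
  fd# ≔ hd (` stk#) ⨾ stk# ≔ tl (` stk#)

-- One `access` on a copy of the assignment serves twice: `e#` receives the old entry, which tells
-- whether the literal is false, and `t#` becomes the assignment with the literal made true, the
-- argument of the recursive call.
literalᶜ : Cmd 17 → Cmd 17
literalᶜ body =
  l# ≔ hd (` C#) ⨾ C# ≔ tl (` C#) ⨾ a# ≔ tl (` l#) ⨾ w# ≔ hd (` l#) ⨾ t# ≔ ` T# ⨾ access ⨾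
  falsifiedᶜ ⨾ w# ≔ nil ⨾ l# ≔ nil ⨾ e# ≔ nil ⨾
  ifte (` z#) skip (callᶜ body) ⨾ t# ≔ nil ⨾ ifte (` z#) (z# ≔ nil) (ok# ≔ nil)

clauseᶜ : Cmd 17 → Cmd 17
clauseᶜ body =
  C# ≔ hd (` cs#) ⨾ cs# ≔ tl (` cs#) ⨾ ok# ≔ one ⨾ while (` C#) (literalᶜ body) ⨾
  ifte (` ok#) (fd# ≔ one) skip ⨾ ok# ≔ nil

-- The depth is a constant of the algorithm, so unfolding the recursion into the program text gives
-- one fixed program.
refuteᶜ : ℕ → Cmd 17
refuteᶜ zero    = fd# ≔ nil ⨾ C# ≔ nil ⨾ ok# ≔ nil ⨾ cs# ≔ nil
refuteᶜ (suc k) = fd# ≔ nil ⨾ C# ≔ nil ⨾ ok# ≔ nil ⨾ cs# ≔ ` F# ⨾ while (` cs#) (clauseᶜ (refuteᶜ k))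

infixr 5 _⊕_
_⊕_ : ℕ → ℕ → ℕ
s ⊕ t = suc (s ℕ.+ t)

loopTime : ℕ → ℕ → ℕ
loopTime zero    t = 1
loopTime (suc m) t = t ⊕ loopTime m t

loopTime-mono : ∀ {m m′} t → m ℕ.≤ m′ → loopTime m t ℕ.≤ loopTime m′ t
loopTime-mono {m′ = zero}  t z≤n = ℕₚ.≤-refl
loopTime-mono {m′ = suc _} t z≤n = s≤s z≤n
loopTime-mono t (s≤s le) = s≤s (ℕₚ.+-monoʳ-≤ t (loopTime-mono t le))

accessTime-mono : ∀ {m m′} → m ℕ.≤ m′ → accessTime m ℕ.≤ accessTime m′
accessTime-mono le = s≤s (ℕₚ.+-mono-≤ (ℕₚ.+-monoˡ-≤ 1 (ℕₚ.*-monoˡ-≤ 6 le))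
  (s≤s (ℕₚ.+-monoʳ-≤ 1 (s≤s (ℕₚ.+-monoʳ-≤ 1 (ℕₚ.+-monoˡ-≤ 1 (ℕₚ.*-monoˡ-≤ 4 le)))))))

callTime literalTime clauseTime : ℕ → ℕ → ℕ
callTime A t    = 1 ⊕ 1 ⊕ 1 ⊕ t ⊕ 1 ⊕ 1 ⊕ 1 ⊕ 1 ⊕ 1 ⊕ 1 ⊕ 1 ⊕ 1 ⊕ 1 ⊕ 1 ⊕ 1
literalTime A t = 1 ⊕ 1 ⊕ 1 ⊕ 1 ⊕ 1 ⊕ A ⊕ 4 ⊕ 1 ⊕ 1 ⊕ 1 ⊕ suc (callTime A t) ⊕ 1 ⊕ 2
clauseTime A t  = 1 ⊕ 1 ⊕ 1 ⊕ loopTime 4 (literalTime A t) ⊕ 2 ⊕ 1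

refuteTime : ℕ → ℕ → ℕ → ℕ
refuteTime A m zero    = 1 ⊕ 1 ⊕ 1 ⊕ 1
refuteTime A m (suc k) = 1 ⊕ 1 ⊕ 1 ⊕ 1 ⊕ loopTime m (clauseTime A (refuteTime A m k))

isTrue-bit : ∀ c → isTrue (bit c) ≡ c
isTrue-bit true  = refl
isTrue-bit false = refl

-- Both bits have head `nil`, so the head distinguishes unassigned from assigned entries. Once all
-- variables are assigned, the array is already in the output format.
entry : Maybe Bool → Tree
entry nothing  = cons oneᵗ nil
entry (just b) = bit b

encode : ∀ {n} → PA n → Tree
encode []      = nil
encode (m ∷ τ) = cons (entry m) (encode τ)

get-encode : ∀ {n} (τ : PA n) x {a} → size a ≡ toℕ x → getᵗ a (encode τ) ≡ entry (lookup τ x)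
get-encode (m ∷ τ) zero    {nil}      eq = refl
get-encode (m ∷ τ) (suc x) {cons _ a} eq = get-encode τ x (ℕₚ.suc-injective eq)

set-encode : ∀ {n} (τ : PA n) x b {a} → size a ≡ toℕ x → setᵗ a (bit b) (encode τ) ≡ encode (τ [ x ↦ b ])
set-encode (m ∷ τ) zero    b {nil}      eq = refl
set-encode (m ∷ τ) (suc x) b {cons _ a} eq = cong (cons (entry m)) (set-encode τ x b (ℕₚ.suc-injective eq))

size-unary : ∀ {n} (x : Fin n) → size (unary x) ≡ toℕ x
size-unary zero    = refl
size-unary (suc x) = cong suc (size-unary x)

encode-literal : ∀ {n} (l : Literal n) → ⌜ l ⌝ˡ ≡ cons (bit (sign l)) (unary (var l))
encode-literal (pos x) = refl
encode-literal (neg x) = refl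

encodeClause : ∀ {n} → Clause n → Tree
encodeClause = list ∘ map ⌜_⌝ˡ

flagged : (F T z cs C ok fd stk : Tree) → Vec Tree 3 → Store 17
flagged F T z cs C ok fd stk rest =
  F ∷ nil ∷ nil ∷ nil ∷ nil ∷ nil ∷ T ∷ nil ∷ z ∷ cs ∷ C ∷ ok ∷ fd ∷ stk ∷ rest

state : (F T cs C ok fd stk : Tree) → Vec Tree 3 → Store 17
state F T = flagged F T nil

module RefutationRuns (goal : Store 17 → ℚ) {n} (cls : List (Clause n)) (short : All (λ C → length C ℕ.≤ 4) cls)
                      (m : ℕ) (few : length cls ℕ.≤ m) where

  open Execution goal
  open Access goal
  open Refutation cls

  F : Tree
  F = list (map encodeClause cls)

  A : ℕ
  A = accessTime n

  access-bounded : ∀ {F} a w e t {rest : Vec Tree 11} → size a ℕ.≤ n →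
    (F ∷ a ∷ w ∷ e ∷ t ∷ nil ∷ rest) ⊢ access ⇓ (F ∷ nil ∷ w ∷ getᵗ a t ∷ setᵗ a w t ∷ nil ∷ rest) within A
  access-bounded {F} a w e t le = slack (accessTime-mono le) (access-runs F a w e t)

  falsified-runs : ∀ {F a w t r T v z} m b {rest : Vec Tree 8} →
    (F ∷ a ∷ w ∷ entry m ∷ t ∷ r ∷ T ∷ cons (bit b) v ∷ z ∷ rest) ⊢ falsifiedᶜ ⇓
    (F ∷ a ∷ w ∷ entry m ∷ t ∷ r ∷ T ∷ cons (bit b) v ∷ bit (falsifies m b) ∷ rest) within 4
  falsified-runs nothing      b     = slack (s≤s (s≤s z≤n)) (if-true refl assign)
  falsified-runs (just true)  true  = if-false refl (if-true refl (if-true refl assign))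
  falsified-runs (just true)  false = if-false refl (if-true refl (if-false refl assign))
  falsified-runs (just false) true  = if-false refl (if-false refl (if-true refl assign))
  falsified-runs (just false) false = if-false refl (if-false refl (if-false refl assign))

  Refutes : ℕ → ℕ → Cmd 17 → Set
  Refutes k t body = ∀ τ cs C ok fd stk rest →
    state F (encode τ) cs C ok fd stk rest ⊢ body ⇓ state F (encode τ) nil nil nil (bit (refute k τ)) stk rest within t

  module Body (k t : ℕ) (body : Cmd 17) (body-runs : Refutes k t body) (τ : PA n) (stk : Tree) (rest : Vec Tree 3) where

    T : Tree
    T = encode τ

    call-runs : ∀ τ′ cs C ok fd →
      (F ∷ nil ∷ nil ∷ nil ∷ encode τ′ ∷ nil ∷ T ∷ nil ∷ nil ∷ cs ∷ C ∷ ok ∷ fd ∷ stk ∷ rest) ⊢ callᶜ body ⇓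
      (F ∷ nil ∷ nil ∷ nil ∷ nil ∷ nil ∷ T ∷ nil ∷ bit (refute k τ′) ∷ cs ∷ C ∷ ok ∷ fd ∷ stk ∷ rest) within callTime A t
    call-runs τ′ cs C ok fd =
      assign then assign then assign then body-runs τ′ cs C ok fd (cons T (cons cs (cons C (cons ok (cons fd stk))))) rest then
      assign then assign then assign then assign then assign then assign then assign then assign then assign then assign then assign

    -- The two branches leave different trees in `t#`, hence the existential; the following command
    -- clears that register.
    decide-runs : ∀ v τ′ cs C ok fd → Σ[ t′ ∈ Tree ]
      (F ∷ nil ∷ nil ∷ nil ∷ encode τ′ ∷ nil ∷ T ∷ nil ∷ bit v ∷ cs ∷ C ∷ ok ∷ fd ∷ stk ∷ rest) ⊢ ifte (` z#) skip (callᶜ body) ⇓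
      (F ∷ nil ∷ nil ∷ nil ∷ t′ ∷ nil ∷ T ∷ nil ∷ bit (v ∨ refute k τ′) ∷ cs ∷ C ∷ ok ∷ fd ∷ stk ∷ rest) within suc (callTime A t)
    decide-runs true  τ′ cs C ok fd = _ , slack (s≤s (s≤s z≤n)) (if-true refl assign)
    decide-runs false τ′ cs C ok fd = _ , if-false refl (call-runs τ′ cs C ok fd)

    conclude-runs : ∀ v okb cs C fd →
      (F ∷ nil ∷ nil ∷ nil ∷ nil ∷ nil ∷ T ∷ nil ∷ bit v ∷ cs ∷ C ∷ bit okb ∷ fd ∷ stk ∷ rest) ⊢ ifte (` z#) (z# ≔ nil) (ok# ≔ nil) ⇓
      state F T cs C (bit (okb ∧ v)) fd stk rest within 2
    conclude-runs true  true  cs C fd = if-true refl assign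
    conclude-runs true  false cs C fd = if-true refl assign
    conclude-runs false true  cs C fd = if-false refl assign
    conclude-runs false false cs C fd = if-false refl assign

    literal-runs : ∀ l okb cs C fd →
      state F T cs (cons (cons (bit (sign l)) (unary (var l))) C) (bit okb) fd stk rest ⊢ literalᶜ body ⇓
      state F T cs C (bit (okb ∧ refuteLit k τ l)) fd stk rest within literalTime A t
    literal-runs l okb cs C fd =
      assign then assign then assign then assign then assign then
      subst₂ (λ e t → before ⊢ access ⇓ (F ∷ nil ∷ bit (sign l) ∷ e ∷ t ∷ nil ∷ T ∷ L ∷ nil ∷ cs ∷ C ∷ bit okb ∷ fd ∷ stk ∷ rest) within A)
        (get-encode τ (var l) (size-unary (var l))) (set-encode τ (var l) (sign l) (size-unary (var l)))
        (access-bounded (unary (var l)) (bit (sign l)) nil T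
          (subst (ℕ._≤ n) (sym (size-unary (var l))) (ℕₚ.<⇒≤ (Fin.toℕ<n (var l))))) then
      falsified-runs (lookup τ (var l)) (sign l) then assign then assign then assign then
      proj₂ (decide-runs (falseIn τ l) (τ [ var l ↦ sign l ]) cs C (bit okb) fd) then assign then
      conclude-runs (refuteLit k τ l) okb cs C fd
      where
      L = cons (bit (sign l)) (unary (var l))
      before = F ∷ unary (var l) ∷ bit (sign l) ∷ nil ∷ T ∷ nil ∷ T ∷ L ∷ nil ∷ cs ∷ C ∷ bit okb ∷ fd ∷ stk ∷ rest

    literals-run : ∀ C okb cs fd →
      state F T cs (encodeClause C) (bit okb) fd stk rest ⊢ while (` C#) (literalᶜ body) ⇓
      state F T cs nil (bit (okb ∧ every (refuteLit k τ) C)) fd stk rest within loopTime (length C) (literalTime A t)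
    literals-run []      okb cs fd rewrite Bool.∧-identityʳ okb = while-done refl
    literals-run (l ∷ C) okb cs fd rewrite encode-literal l | sym (Bool.∧-assoc okb (refuteLit k τ l) (every (refuteLit k τ) C)) =
      while-step refl (literal-runs l okb cs (encodeClause C) fd) (literals-run C (okb ∧ refuteLit k τ l) cs fd)

    found-runs : ∀ v fdb cs →
      state F T cs nil (bit v) (bit fdb) stk rest ⊢ ifte (` ok#) (fd# ≔ one) skip ⇓
      state F T cs nil (bit v) (bit (fdb ∨ v)) stk rest within 2
    found-runs true  fdb cs rewrite Bool.∨-zeroʳ fdb = if-true refl assign
    found-runs false fdb cs rewrite Bool.∨-identityʳ fdb = if-false refl assign

    clause-runs : ∀ C fdb cs → length C ℕ.≤ 4 →
      state F T (cons (encodeClause C) cs) nil nil (bit fdb) stk rest ⊢ clauseᶜ body ⇓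
      state F T cs nil nil (bit (fdb ∨ every (refuteLit k τ) C)) stk rest within clauseTime A t
    clause-runs C fdb cs C≤4 =
      assign then assign then assign then
      slack (loopTime-mono (literalTime A t) C≤4) (literals-run C true cs (bit fdb)) then
      found-runs (every (refuteLit k τ) C) fdb cs then assign

    clauses-run : ∀ Cs fdb → All (λ C → length C ℕ.≤ 4) Cs →
      state F T (list (map encodeClause Cs)) nil nil (bit fdb) stk rest ⊢ while (` cs#) (clauseᶜ body) ⇓
      state F T nil nil nil (bit (fdb ∨ some (every (refuteLit k τ)) Cs)) stk rest within loopTime (length Cs) (clauseTime A t)
    clauses-run []       fdb [] rewrite Bool.∨-identityʳ fdb = while-done refl
    clauses-run (C ∷ Cs) fdb (C≤4 ∷ Cs≤4)
      rewrite sym (Bool.∨-assoc fdb (every (refuteLit k τ) C) (some (every (refuteLit k τ)) Cs)) =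
      while-step refl (clause-runs C fdb (list (map encodeClause Cs)) C≤4)
        (clauses-run Cs (fdb ∨ every (refuteLit k τ) C) Cs≤4)

  refute-runs : ∀ k → Refutes k (refuteTime A m k) (refuteᶜ k)
  refute-runs zero    τ cs C ok fd stk rest = assign then assign then assign then assign
  refute-runs (suc k) τ cs C ok fd stk rest =
    assign then assign then assign then assign then
    slack (loopTime-mono _ few) (Body.clauses-run k (refuteTime A m k) (refuteᶜ k) (refute-runs k) τ stk rest cls false short)

-- The algorithm as a program

setᶜ : Expr 17 → Expr 17 → Cmd 17
setᶜ i v = a# ≔ i ⨾ w# ≔ v ⨾ t# ≔ ` T# ⨾ access ⨾ T# ≔ ` t# ⨾ t# ≔ nil ⨾ e# ≔ nil ⨾ w# ≔ nil

-- Reading also overwrites the entry, but only in the copy `t#`; `T#` stays intact.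
peekᶜ : Cmd 17
peekᶜ = a# ≔ ` u# ⨾ t# ≔ ` T# ⨾ access ⨾ z# ≔ hd (` e#) ⨾ e# ≔ nil ⨾ t# ≔ nil

tryᶜ : ℕ → Expr 17 → Cmd 17
tryᶜ d v = stk# ≔ cons (` T#) (` stk#) ⨾ setᶜ (` u#) v ⨾ refuteᶜ d ⨾ T# ≔ hd (` stk#) ⨾ stk# ≔ tl (` stk#)

guessᶜ : Cmd 17
guessᶜ = flip z# ⨾ setᶜ (` u#) (` z#) ⨾ z# ≔ nil

pickᶜ : ℕ → Cmd 17
pickᶜ d = z# ≔ nil ⨾ tryᶜ d one ⨾
          ifte (` fd#) (setᶜ (` u#) nil) (tryᶜ d nil ⨾ ifte (` fd#) (setᶜ (` u#) one) guessᶜ) ⨾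
          fd# ≔ nil

withProbability½^ : ℕ → Cmd 17 → Cmd 17
withProbability½^ zero    c = c
withProbability½^ (suc b) c = flip z# ⨾ ifte (` z#) (withProbability½^ b c) skip

eventᶜ : ℕ → ℕ → Cmd 17
eventᶜ d b = peekᶜ ⨾ ifte (` z#) (withProbability½^ b (pickᶜ d)) skip

completeᶜ : Cmd 17
completeᶜ = peekᶜ ⨾ ifte (` z#) guessᶜ skip

-- `U#` has length n, and after each `tl` the length of `u#` is the index of the variable to visit,
-- so `u#` serves as loop counter and array index at once.
sweepᶜ : Cmd 17 → Cmd 17
sweepᶜ c = u# ≔ ` U# ⨾ while (` u#) (u# ≔ tl (` u#) ⨾ c)

-- The input does not contain n. Marking every occurring variable as unassigned extends the array to
-- length n, as every variable occurs in some clause.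
initialiseᶜ : Cmd 17
initialiseᶜ =
  cs# ≔ ` F# ⨾
  while (` cs#)
    (C# ≔ hd (` cs#) ⨾ cs# ≔ tl (` cs#) ⨾
     while (` C#) (l# ≔ hd (` C#) ⨾ C# ≔ tl (` C#) ⨾ setᶜ (tl (` l#)) (cons one nil) ⨾ l# ≔ nil)) ⨾
  U# ≔ ` T#

numeral : ℕ → Expr 17
numeral zero    = nil
numeral (suc m) = cons nil (numeral m)

algorithm : ℕ → ℕ → ℕ → Program
algorithm d b R .aux  = 16
algorithm d b R .body =
  initialiseᶜ ⨾ rc# ≔ numeral R ⨾
  while (` rc#) (rc# ≔ tl (` rc#) ⨾ sweepᶜ (eventᶜ d b)) ⨾
  sweepᶜ completeᶜ ⨾ F# ≔ ` T#

setTime peekTime guessTime : ℕ → ℕ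
setTime A   = 1 ⊕ 1 ⊕ 1 ⊕ A ⊕ 1 ⊕ 1 ⊕ 1 ⊕ 1
peekTime A  = 1 ⊕ 1 ⊕ A ⊕ 1 ⊕ 1 ⊕ 1
guessTime A = 1 ⊕ setTime A ⊕ 1

tryTime pickTime eventTime : ℕ → ℕ → ℕ
tryTime A t   = 1 ⊕ setTime A ⊕ t ⊕ 1 ⊕ 1
pickTime A t  = 1 ⊕ tryTime A t ⊕ suc (tryTime A t ⊕ suc (guessTime A)) ⊕ 1
eventTime A t = peekTime A ⊕ suc t

withTime : ℕ → ℕ → ℕ
withTime zero    t = t
withTime (suc b) t = 1 ⊕ suc (withTime b t)

sweepTime : ℕ → ℕ → ℕ
sweepTime n t = 1 ⊕ loopTime n (1 ⊕ t)

initialiseTime : ℕ → ℕ → ℕ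
initialiseTime A m = 1 ⊕ loopTime m (1 ⊕ 1 ⊕ loopTime 4 (1 ⊕ 1 ⊕ setTime A ⊕ 1)) ⊕ 1

algorithmTime : ℕ → ℕ → ℕ → ℕ → ℕ → ℕ
algorithmTime d b R n m =
  initialiseTime A m ⊕ 1 ⊕
  loopTime R (1 ⊕ sweepTime n (eventTime A (withTime b (pickTime A (refuteTime A m d))))) ⊕
  sweepTime n (eventTime A (guessTime A)) ⊕ 1
  where A = accessTime n

chance : ℕ → ℚ → ℚ → ℚ
chance zero    p q = p
chance (suc b) p q = ½ * (q + chance b p q)

chance≡mix : ∀ b p q → chance b p q ≡ mix (½ ^^ b) p q
chance≡mix zero    p q = lemma p q
  where
  lemma : ∀ p q → p ≡ 1ℚ * p + (1ℚ - 1ℚ) * q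
  lemma = solve-∀ ℚ-ring
chance≡mix (suc b) p q = trans (cong (λ a → ½ * (q + a)) (chance≡mix b p q)) (lemma (½ ^^ b) p q)
  where
  lemma : ∀ r p q → ½ * (q + (r * p + (1ℚ - r) * q)) ≡ ½ * r * p + (1ℚ - ½ * r) * q
  lemma = solve-∀ ℚ-ring

-- Variables that were picked in no round are set by fair coins at the end.
completion : ∀ {n} → (PA n → ℚ) → List (Fin n) → PA n → ℚ
completion φ []       τ = φ τ
completion φ (x ∷ es) τ = unassigned? (lookup τ x) (completion φ es τ)
  (½ * (completion φ es (τ [ x ↦ false ]) + completion φ es (τ [ x ↦ true ])))

-- The variables in the order of a sweep, which runs through the suffixes of a list.
descending : ∀ {n} j → j ℕ.≤ n → List (Fin n)
descending zero    le = []
descending (suc j) le = Fin.fromℕ< le ∷ descending j (ℕₚ.≤-trans (ℕₚ.n≤1+n j) le)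
  where import Data.Fin as Fin

module AlgorithmRuns (goal : Store 17 → ℚ) {n} (cls : List (Clause n)) (short : All (λ C → length C ℕ.≤ 4) cls)
                     (m : ℕ) (few : length cls ℕ.≤ m) (d b : ℕ) where

  open Execution goal
  open Access goal
  open Refutation cls
  open RefutationRuns goal cls short m few

  B : ℕ
  B = refuteTime A m d

  clean : Tree → Tree → Tree → Tree → Store 17
  clean T u rc U = state F T nil nil nil nil nil (u ∷ rc ∷ U ∷ [])

  sequence : ∀ {c c′ κ σ t p} → Achieves (c ∷ c′ ∷ κ , σ) t p → Achieves ((c ⨾ c′) ∷ κ , σ) (suc t) p
  sequence a = always (λ _ → a)

  retime : ∀ {C t t′ p} → t ≡ t′ → Achieves C t p → Achieves C t′ p
  retime refl a = a

  set-runs : ∀ {F T l z cs C ok fd stk} {rest : Vec Tree 3} i v →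
    let σ = F ∷ nil ∷ nil ∷ nil ∷ nil ∷ nil ∷ T ∷ l ∷ z ∷ cs ∷ C ∷ ok ∷ fd ∷ stk ∷ rest
        a = ⟦ i ⟧ σ
        w = ⟦ v ⟧ (F ∷ a ∷ nil ∷ nil ∷ nil ∷ nil ∷ T ∷ l ∷ z ∷ cs ∷ C ∷ ok ∷ fd ∷ stk ∷ rest)
    in size a ℕ.≤ n →
       σ ⊢ setᶜ i v ⇓ (F ∷ nil ∷ nil ∷ nil ∷ nil ∷ nil ∷ setᵗ a w T ∷ l ∷ z ∷ cs ∷ C ∷ ok ∷ fd ∷ stk ∷ rest) within setTime A
  set-runs i v le =
    assign then assign then assign then access-bounded _ _ _ _ le then assign then assign then assign then assign

  module At (x : Fin n) (u : Tree) (size-u : size u ≡ toℕ x) (rc U : Tree) where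

    size≤ : size u ℕ.≤ n
    size≤ = subst (ℕ._≤ n) (sym size-u) (ℕₚ.<⇒≤ (Fin.toℕ<n x))

    set-value : ∀ {T τ z fd stk} v c → ⟦ v ⟧ (F ∷ u ∷ nil ∷ nil ∷ nil ∷ nil ∷ T ∷ nil ∷ z ∷ nil ∷ nil ∷ nil ∷ fd ∷ stk ∷ u ∷ rc ∷ U ∷ []) ≡ bit c →
      T ≡ encode τ →
      (flagged F T z nil nil nil fd stk (u ∷ rc ∷ U ∷ [])) ⊢ setᶜ (` u#) v ⇓
      (flagged F (encode (τ [ x ↦ c ])) z nil nil nil fd stk (u ∷ rc ∷ U ∷ [])) within setTime A
    set-value {τ = τ} {z} {fd} {stk} v c eq refl =
      subst (λ T → (flagged F (encode τ) z nil nil nil fd stk (u ∷ rc ∷ U ∷ [])) ⊢ setᶜ (` u#) v ⇓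
                   (flagged F T z nil nil nil fd stk (u ∷ rc ∷ U ∷ [])) within setTime A)
            (trans (cong (λ w → setᵗ u w (encode τ)) eq) (set-encode τ x c size-u))
            (set-runs (` u#) v size≤)

    peek-runs : ∀ τ {w} → w ≡ hdᵗ (entry (lookup τ x)) →
      clean (encode τ) u rc U ⊢ peekᶜ ⇓
      (flagged F (encode τ) w nil nil nil nil nil (u ∷ rc ∷ U ∷ [])) within peekTime A
    peek-runs τ refl rewrite sym (get-encode τ x size-u) =
      assign then assign then access-bounded u nil nil (encode τ) size≤ then assign then assign then assign

    try-runs : ∀ τ fd v c → (∀ σ → ⟦ v ⟧ σ ≡ bit c) →
      state F (encode τ) nil nil nil fd nil (u ∷ rc ∷ U ∷ []) ⊢ tryᶜ d v ⇓
      state F (encode τ) nil nil nil (bit (refute d (τ [ x ↦ c ]))) nil (u ∷ rc ∷ U ∷ []) within tryTime A B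
    try-runs τ fd v c eq =
      assign then set-value v c (eq _) refl then
      refute-runs d (τ [ x ↦ c ]) nil nil nil fd (cons (encode τ) nil) (u ∷ rc ∷ U ∷ []) then assign then assign

    module _ {κ : List (Cmd 17)} {s : ℕ} {f : Bool → ℚ} (τ : PA n)
             (picked-achieves : ∀ c → Achieves (κ , clean (encode (τ [ x ↦ c ])) u rc U) s (f c)) where

      guess-achieves : ∀ z →
        Achieves (guessᶜ ∷ κ , (flagged F (encode τ) z nil nil nil nil nil (u ∷ rc ∷ U ∷ [])))
                 (guessTime A ℕ.+ s) (½ * (f false + f true))
      guess-achieves z = sequence (either (with-bit false) (with-bit true))
        where
        with-bit : ∀ c → Achieves ((setᶜ (` u#) (` z#) ⨾ z# ≔ nil) ∷ κ ,
          (flagged F (encode τ) (bit c) nil nil nil nil nil (u ∷ rc ∷ U ∷ []))) ((setTime A ⊕ 1) ℕ.+ s) (f c)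
        with-bit c = continue (set-value (` z#) c refl refl then assign) (picked-achieves c)

    module _ {κ : List (Cmd 17)} {s : ℕ} {f : Bool → ℚ} (τ : PA n)
             (picked-achieves : ∀ c → Achieves (κ , clean (encode (τ [ x ↦ c ])) u rc U) s (f c))
             {final : PA n → ℚ} where

      open Algorithm cls d (½ ^^ b) final using (picked)

      pick-achieves : ∀ z →
        Achieves (pickᶜ d ∷ κ , (flagged F (encode τ) z nil nil nil nil nil (u ∷ rc ∷ U ∷ [])))
                 (pickTime A B ℕ.+ s) (picked τ x f)
      pick-achieves z =
        retime (timing (tryTime A B) (guessTime A) s) (sequence (continue assign (sequence (continue (try-runs τ nil one true (λ _ → refl)) (sequence (branch (refute d (τ [ x ↦ true ])) (isTrue-bit (refute d (τ [ x ↦ true ]))) (first-test (refute d (τ [ x ↦ true ])) refl)))))))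
        where
        timing : ∀ T G s → suc (suc (suc (T ℕ.+ suc (suc (suc (T ℕ.+ suc (G ℕ.+ suc s))))))) ≡
                           suc (suc (suc (T ℕ.+ suc (suc (suc (T ℕ.+ suc G)) ℕ.+ 1)))) ℕ.+ s
        timing = ℕ-Solver.solve-∀
        set≤guess : setTime A ℕ.≤ guessTime A
        set≤guess = ℕₚ.≤-trans (ℕₚ.m≤m+n (setTime A) 1) (ℕₚ.m≤n+m _ 3)
        cleaned : ∀ c fd → Achieves (fd# ≔ nil ∷ κ , state F (encode (τ [ x ↦ c ])) nil nil nil fd nil (u ∷ rc ∷ U ∷ [])) (suc s) (f c)
        cleaned c fd = continue assign (picked-achieves c)
        second-test : ∀ v → refute d (τ [ x ↦ false ]) ≡ v →
          Achieves ((if v then setᶜ (` u#) one else guessᶜ) ∷ fd# ≔ nil ∷ κ , state F (encode τ) nil nil nil (bit v) nil (u ∷ rc ∷ U ∷ []))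
                   (guessTime A ℕ.+ suc s) (if v then f true else ½ * (f false + f true))
        second-test true  eq = weaken (ℕₚ.+-monoˡ-≤ (suc s) set≤guess) (continue (set-value one true refl refl) (cleaned true oneᵗ))
        second-test false eq = guess-achieves τ (λ c → cleaned c nil) nil
        first-test : ∀ v → refute d (τ [ x ↦ true ]) ≡ v →
          Achieves ((if v then setᶜ (` u#) nil else (tryᶜ d nil ⨾ ifte (` fd#) (setᶜ (` u#) one) guessᶜ)) ∷ fd# ≔ nil ∷ κ ,
                    state F (encode τ) nil nil nil (bit v) nil (u ∷ rc ∷ U ∷ []))
                   (suc (tryTime A B ℕ.+ suc (guessTime A ℕ.+ suc s)))
                   (if v then f false else if refute d (τ [ x ↦ false ]) then f true else ½ * (f false + f true))
        first-test true  eq = weaken (ℕₚ.≤-trans (ℕₚ.+-monoˡ-≤ (suc s) set≤guess) (ℕₚ.m≤n⇒m≤1+n (ℕₚ.≤-trans (ℕₚ.n≤1+n _) (ℕₚ.m≤n+m (suc (guessTime A ℕ.+ suc s)) (tryTime A B))))) (continue (set-value nil false refl refl) (cleaned false oneᵗ))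
        first-test false eq = sequence (continue (try-runs τ nil nil false (λ _ → refl))
          (branch (refute d (τ [ x ↦ false ])) (isTrue-bit (refute d (τ [ x ↦ false ]))) (second-test (refute d (τ [ x ↦ false ])) refl)))

-- Initialising the array of variables

touch : ∀ {n} → Clause n → Tree → Tree
touch []      T = T
touch (l ∷ C) T = touch C (setᵗ (unary (var l)) (entry nothing) T)

touchAll : ∀ {n} → List (Clause n) → Tree → Tree
touchAll []       T = T
touchAll (C ∷ Cs) T = touchAll Cs (touch C T)

size-set : ∀ {n} (x : Fin n) w T → size T ℕ.≤ n → size (setᵗ (unary x) w T) ℕ.≤ n
size-set zero    w nil        le       = s≤s z≤n
size-set zero    w (cons _ T) le       = le
size-set (suc x) w nil        le       = s≤s (size-set x w nil z≤n)
size-set (suc x) w (cons _ T) (s≤s le) = s≤s (size-set x w T le)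

get-set : ∀ a w T → getᵗ a (setᵗ a w T) ≡ w
get-set nil        w T = refl
get-set (cons _ a) w T = get-set a w (tlᵗ T)

get-set-stable : ∀ {n} (x y : Fin n) w T → getᵗ (unary x) T ≡ w → getᵗ (unary x) (setᵗ (unary y) w T) ≡ w
get-set-stable zero    zero    w T eq = refl
get-set-stable zero    (suc y) w T eq = eq
get-set-stable (suc x) zero    w T eq = eq
get-set-stable (suc x) (suc y) w T eq = get-set-stable x y w (tlᵗ T) eq

size-touchAll : ∀ {n} (Cs : List (Clause n)) T → size T ℕ.≤ n → size (touchAll Cs T) ℕ.≤ n
size-touchAll []       T le = le
size-touchAll (C ∷ Cs) T le = size-touchAll Cs (touch C T) (size-touch C T le)
  where
  size-touch : ∀ {n} (C : Clause n) T → size T ℕ.≤ n → size (touch C T) ℕ.≤ n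
  size-touch []      T le = le
  size-touch (l ∷ C) T le = size-touch C _ (size-set (var l) (entry nothing) T le)

touch-stable : ∀ {n} (C : Clause n) (x : Fin n) T → getᵗ (unary x) T ≡ entry nothing → getᵗ (unary x) (touch C T) ≡ entry nothing
touch-stable []      x T eq = eq
touch-stable (l ∷ C) x T eq = touch-stable C x (setᵗ (unary (var l)) (entry nothing) T) (get-set-stable x (var l) (entry nothing) T eq)

touchAll-stable : ∀ {n} (Cs : List (Clause n)) (x : Fin n) T → getᵗ (unary x) T ≡ entry nothing → getᵗ (unary x) (touchAll Cs T) ≡ entry nothing
touchAll-stable []       x T eq = eq
touchAll-stable (C ∷ Cs) x T eq = touchAll-stable Cs x (touch C T) (touch-stable C x T eq)

touch-occurs : ∀ {n} {C : Clause n} (x : Fin n) T → Any (λ l → var l ≡ x) C → getᵗ (unary x) (touch C T) ≡ entry nothing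
touch-occurs {C = l ∷ C} x T (here refl) = touch-stable C x (setᵗ (unary (var l)) (entry nothing) T) (get-set (unary x) (entry nothing) T)
touch-occurs {C = l ∷ C} x T (there a)   = touch-occurs x (setᵗ (unary (var l)) (entry nothing) T) a

touchAll-occurs : ∀ {n} {Cs : List (Clause n)} (x : Fin n) T → Any (Any (λ l → var l ≡ x)) Cs → getᵗ (unary x) (touchAll Cs T) ≡ entry nothing
touchAll-occurs {Cs = C ∷ Cs} x T (here a)  = touchAll-stable Cs x (touch C T) (touch-occurs x T a)
touchAll-occurs {Cs = C ∷ Cs} x T (there a) = touchAll-occurs x (touch C T) a

unset : ∀ n → PA n
unset n = replicate n nothing

-- Reading past the end of a list yields `nil`, which differs from `entry nothing`; so the list is
-- no shorter than n, and the bound on its size makes it no longer.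
all-touched : ∀ n T → size T ℕ.≤ n → (∀ (x : Fin n) → getᵗ (unary x) T ≡ entry nothing) → T ≡ encode (unset n)
all-touched zero    nil        le       h = refl
all-touched (suc n) nil        le       h = case h zero of λ ()
all-touched (suc n) (cons e T) (s≤s le) h = cong₂ cons (h zero) (all-touched n T le (h ∘ suc))

size-encode : ∀ {n} (τ : PA n) → size (encode τ) ≡ n
size-encode []      = refl
size-encode (m ∷ τ) = cong suc (size-encode τ)

constant : ℕ → Tree
constant zero    = nil
constant (suc m) = cons nil (constant m)

size-constant : ∀ m → size (constant m) ≡ m
size-constant zero    = refl
size-constant (suc m) = cong suc (size-constant m)

numeral-constant : ∀ m σ → ⟦ numeral m ⟧ σ ≡ constant m
numeral-constant zero    σ = refl
numeral-constant (suc m) σ = cong (cons nil) (numeral-constant m σ)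

-- The run of the whole program

module WholeRun (goal : Store 17 → ℚ) {n} (cls : List (Clause n)) (short : All (λ C → length C ℕ.≤ 4) cls)
                (m : ℕ) (few : length cls ℕ.≤ m)
                (occ : ∀ x → Any (Any (λ l → var l ≡ x)) cls) (d b : ℕ) where

  open Execution goal
  open Access goal
  open Refutation cls
  open RefutationRuns goal cls short m few
  open AlgorithmRuns goal cls short m few d b

  vs : List (Fin n)
  vs = descending n ℕₚ.≤-refl

  outcome : PA n → ℚ
  outcome τ = goal (state (encode τ) (encode τ) nil nil nil nil nil (nil ∷ nil ∷ encode (unset n) ∷ []))

  open Algorithm cls d (½ ^^ b) (completion outcome vs)

  P : ℕ
  P = pickTime A B

  module Visit (x : Fin n) (u : Tree) (size-u : size u ≡ toℕ x) (rc U : Tree) {κ : List (Cmd 17)} {s : ℕ} where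

    open At x u size-u rc U

    flag : PA n → Tree → Store 17
    flag τ z = flagged F (encode τ) z nil nil nil nil nil (u ∷ rc ∷ U ∷ [])

    with-achieves : ∀ {τ c t p q} → 1 ℕ.≤ t → (∀ z → Achieves (c ∷ κ , flag τ z) (t ℕ.+ s) p) →
      Achieves (κ , flag τ nil) s q →
      ∀ b z → Achieves (withProbability½^ b c ∷ κ , flag τ z) (withTime b t ℕ.+ s) (chance b p q)
    with-achieves 1≤t hp hq zero    z = hp z
    with-achieves {τ} {c} {t} {p} {q} 1≤t hp hq (suc b) z =
      sequence (either
        (branch {e = ` z#} {c = withProbability½^ b c} {d = skip} false refl (weaken (ℕₚ.+-monoˡ-≤ s (1≤withTime b)) (continue assign hq)))
        (branch {e = ` z#} {c = withProbability½^ b c} {d = skip} true refl (with-achieves {τ} {c} 1≤t hp hq b oneᵗ)))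
      where
      1≤withTime : ∀ b → 1 ℕ.≤ withTime b t
      1≤withTime zero    = 1≤t
      1≤withTime (suc b) = s≤s z≤n

    peek-then : ∀ {τ c t p q} → 1 ℕ.≤ t → (∀ z → Achieves (c ∷ κ , flag τ z) (t ℕ.+ s) p) →
      Achieves (κ , flag τ nil) s q →
      Achieves ((peekᶜ ⨾ ifte (` z#) c skip) ∷ κ , clean (encode τ) u rc U) (eventTime A t ℕ.+ s) (unassigned? (lookup τ x) q p)
    peek-then {τ} {c} {t} {p} {q} 1≤t hp hq = by-status (lookup τ x) refl
      where
      timing : ∀ P t s → suc (P ℕ.+ suc (t ℕ.+ s)) ≡ suc (P ℕ.+ suc t) ℕ.+ s
      timing = ℕ-Solver.solve-∀
      by-status : ∀ m → lookup τ x ≡ m →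
        Achieves ((peekᶜ ⨾ ifte (` z#) c skip) ∷ κ , clean (encode τ) u rc U) (eventTime A t ℕ.+ s) (unassigned? m q p)
      by-status nothing eq = retime (timing (peekTime A) t s) (sequence
        (continue (peek-runs τ (cong (hdᵗ ∘ entry) (sym eq))) (branch {e = ` z#} {c = c} {d = skip} true refl (hp oneᵗ))))
      by-status (just v) eq = retime (timing (peekTime A) t s) (sequence
        (continue (peek-runs τ (trans (hd-bit v) (cong (hdᵗ ∘ entry) (sym eq)))) (branch {e = ` z#} {c = c} {d = skip} false refl
          (weaken (ℕₚ.+-monoˡ-≤ s 1≤t) (continue assign hq)))))
        where
        hd-bit : ∀ v → nil ≡ hdᵗ (bit v)
        hd-bit true  = refl
        hd-bit false = refl

    event-achieves : ∀ es → (∀ τ → Achieves (κ , clean (encode τ) u rc U) s (success es τ)) →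
      ∀ τ → Achieves (eventᶜ d b ∷ κ , clean (encode τ) u rc U) (eventTime A (withTime b P) ℕ.+ s) (success (x ∷ es) τ)
    event-achieves es h τ = subst (Achieves _ _)
      (cong (unassigned? (lookup τ x) (success es τ)) (chance≡mix b (picked τ x (λ c → success es (τ [ x ↦ c ]))) (success es τ)))
      (peek-then {τ} {withProbability½^ b (pickᶜ d)} (1≤withTime b)
        (with-achieves {τ} {pickᶜ d} (s≤s z≤n) (pick-achieves τ (λ c → h (τ [ x ↦ c ])) {completion outcome vs}) (h τ) b) (h τ))
      where
      1≤withTime : ∀ b → 1 ℕ.≤ withTime b P
      1≤withTime zero    = s≤s z≤n
      1≤withTime (suc b) = s≤s z≤n

    complete-achieves : ∀ es → (∀ τ → Achieves (κ , clean (encode τ) u rc U) s (completion outcome es τ)) →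
      ∀ τ → Achieves (completeᶜ ∷ κ , clean (encode τ) u rc U) (eventTime A (guessTime A) ℕ.+ s) (completion outcome (x ∷ es) τ)
    complete-achieves es h τ =
      peek-then {τ} {guessᶜ} (s≤s z≤n) (guess-achieves τ (λ c → h (τ [ x ↦ c ]))) (h τ)

  module Sweep (c : Cmd 17) (E : ℕ) (value : List (Fin n) → PA n → ℚ)
    (visit : ∀ x u (eq : size u ≡ toℕ x) rc U {κ s} es → (∀ τ → Achieves (κ , clean (encode τ) u rc U) s (value es τ)) →
             ∀ τ → Achieves (c ∷ κ , clean (encode τ) u rc U) (E ℕ.+ s) (value (x ∷ es) τ)) where

    sweep-loop : ∀ {κ s} rc U es → (∀ τ → Achieves (κ , clean (encode τ) nil rc U) s (value es τ)) →
      ∀ j le u → size u ≡ j → ∀ τ →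
      Achieves (while (` u#) (u# ≔ tl (` u#) ⨾ c) ∷ κ , clean (encode τ) u rc U) (loopTime j (1 ⊕ E) ℕ.+ s) (value (descending j le ++ es) τ)
    sweep-loop rc U es h zero    le nil        eq τ =
      loop {e = ` u#} {c = u# ≔ tl (` u#) ⨾ c} false refl (h τ)
    sweep-loop {κ} {s} rc U es h (suc j) le (cons v u) eq τ =
      loop {e = ` u#} {c = u# ≔ tl (` u#) ⨾ c} true refl (retime (timing E (loopTime j (1 ⊕ E)) s) (sequence (continue assign
        (visit (Fin.fromℕ< le) u (trans (ℕₚ.suc-injective eq) (sym (Fin.toℕ-fromℕ< le))) rc U (descending j _ ++ es)
          (sweep-loop rc U es h j _ u (ℕₚ.suc-injective eq)) τ))))
      where
      import Data.Fin as Fin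
      timing : ∀ E L s → suc (suc (E ℕ.+ (L ℕ.+ s))) ≡ suc (suc E) ℕ.+ L ℕ.+ s
      timing = ℕ-Solver.solve-∀

    sweep-achieves : ∀ {κ s} rc U es → size U ≡ n → (∀ τ → Achieves (κ , clean (encode τ) nil rc U) s (value es τ)) →
      ∀ u τ → Achieves (sweepᶜ c ∷ κ , clean (encode τ) u rc U) (sweepTime n E ℕ.+ s) (value (vs ++ es) τ)
    sweep-achieves rc U es size-U h u τ =
      sequence (continue assign (sweep-loop rc U es h n ℕₚ.≤-refl U size-U τ))

  U₀ : Tree
  U₀ = encode (unset n)

  module Events = Sweep (eventᶜ d b) (eventTime A (withTime b P)) success
    (λ x u eq rc U → Visit.event-achieves x u eq rc U)
  module Completions = Sweep completeᶜ (eventTime A (guessTime A)) (completion outcome)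
    (λ x u eq rc U → Visit.complete-achieves x u eq rc U)

  roundTime : ℕ
  roundTime = 1 ⊕ sweepTime n (eventTime A (withTime b P))

  rounds-achieve : ∀ {κ s} → (∀ τ → Achieves (κ , clean (encode τ) nil nil U₀) s (completion outcome vs τ)) →
    ∀ j rc → size rc ≡ j → ∀ τ →
    Achieves (while (` rc#) (rc# ≔ tl (` rc#) ⨾ sweepᶜ (eventᶜ d b)) ∷ κ , clean (encode τ) nil rc U₀) (loopTime j roundTime ℕ.+ s) (success (rounds vs j) τ)
  rounds-achieve h zero    nil         eq τ =
    loop {e = ` rc#} {c = rc# ≔ tl (` rc#) ⨾ sweepᶜ (eventᶜ d b)} false refl (h τ)
  rounds-achieve {κ} {s} h (suc j) (cons v rc) eq τ =
    loop {e = ` rc#} {c = rc# ≔ tl (` rc#) ⨾ sweepᶜ (eventᶜ d b)} true refl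
      (retime (timing (sweepTime n (eventTime A (withTime b P))) (loopTime j roundTime) s) (sequence (continue assign
        (Events.sweep-achieves rc U₀ (rounds vs j) (size-encode (unset n)) (rounds-achieve h j rc (ℕₚ.suc-injective eq)) nil τ))))
    where
    timing : ∀ E L s → suc (suc (E ℕ.+ (L ℕ.+ s))) ≡ suc (suc E) ℕ.+ L ℕ.+ s
    timing = ℕ-Solver.solve-∀

  touch-runs : ∀ C T cs → state F T cs (encodeClause C) nil nil nil (nil ∷ nil ∷ nil ∷ []) ⊢
    while (` C#) (l# ≔ hd (` C#) ⨾ C# ≔ tl (` C#) ⨾ setᶜ (tl (` l#)) (cons one nil) ⨾ l# ≔ nil) ⇓
    state F (touch C T) cs nil nil nil nil (nil ∷ nil ∷ nil ∷ []) within loopTime (length C) (1 ⊕ 1 ⊕ setTime A ⊕ 1)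
  touch-runs []      T cs = while-done refl
  touch-runs (l ∷ C) T cs rewrite encode-literal l =
    while-step refl (assign then assign then set-runs (tl (` l#)) (cons one nil)
      (subst (ℕ._≤ n) (sym (size-unary (var l))) (ℕₚ.<⇒≤ (Fin.toℕ<n (var l)))) then assign)
      (touch-runs C (setᵗ (unary (var l)) (entry nothing) T) cs)

  touchAll-runs : ∀ Cs T → All (λ C → length C ℕ.≤ 4) Cs →
    state F T (list (map encodeClause Cs)) nil nil nil nil (nil ∷ nil ∷ nil ∷ []) ⊢
    while (` cs#) (C# ≔ hd (` cs#) ⨾ cs# ≔ tl (` cs#) ⨾
      while (` C#) (l# ≔ hd (` C#) ⨾ C# ≔ tl (` C#) ⨾ setᶜ (tl (` l#)) (cons one nil) ⨾ l# ≔ nil)) ⇓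
    state F (touchAll Cs T) nil nil nil nil nil (nil ∷ nil ∷ nil ∷ []) within loopTime (length Cs) (1 ⊕ 1 ⊕ loopTime 4 (1 ⊕ 1 ⊕ setTime A ⊕ 1))
  touchAll-runs []       T []           = while-done refl
  touchAll-runs (C ∷ Cs) T (C≤4 ∷ Cs≤4) =
    while-step refl (assign then assign then slack (loopTime-mono _ C≤4) (touch-runs C T (list (map encodeClause Cs))))
      (touchAll-runs Cs (touch C T) Cs≤4)

  initialise-runs : state F nil nil nil nil nil nil (nil ∷ nil ∷ nil ∷ []) ⊢ initialiseᶜ ⇓ clean U₀ nil nil U₀ within initialiseTime A m
  initialise-runs = subst (λ T → state F nil nil nil nil nil nil (nil ∷ nil ∷ nil ∷ []) ⊢ initialiseᶜ ⇓ clean T nil nil T within initialiseTime A m)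
    (all-touched n (touchAll cls nil) (size-touchAll cls nil z≤n) (λ x → touchAll-occurs x nil (occ x)))
    (assign then slack (loopTime-mono _ few) (touchAll-runs cls nil short) then assign)

  set-rounds : ∀ R → clean U₀ nil nil U₀ ⊢ rc# ≔ numeral R ⇓ clean U₀ nil (constant R) U₀ within 1
  set-rounds R = subst (λ r → clean U₀ nil nil U₀ ⊢ rc# ≔ numeral R ⇓ clean U₀ nil r U₀ within 1)
    (numeral-constant R (clean U₀ nil nil U₀)) assign

  complete-all : ∀ τ → Achieves (sweepᶜ completeᶜ ∷ (F# ≔ ` T#) ∷ [] , clean (encode τ) nil nil U₀)
                              (sweepTime n (eventTime A (guessTime A)) ℕ.+ 1) (completion outcome vs τ)
  complete-all τ = subst (λ es → Achieves (sweepᶜ completeᶜ ∷ (F# ≔ ` T#) ∷ [] , clean (encode τ) nil nil U₀)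
                                          (sweepTime n (eventTime A (guessTime A)) ℕ.+ 1) (completion outcome es τ))
    (++-identityʳ vs)
    (Completions.sweep-achieves nil U₀ [] (size-encode (unset n)) (λ τ → continue assign (halted {t = 0})) nil τ)

  algorithm-achieves : ∀ R → Achieves (body (algorithm d b R) ∷ [] , F ∷ replicate 16 nil)
    (algorithmTime d b R n m) (success (rounds vs R) (unset n))
  algorithm-achieves R =
    sequence (continue initialise-runs (sequence (continue (set-rounds R) (sequence
      (rounds-achieve (λ τ → sequence (complete-all τ)) R (constant R) (size-constant R) (unset n))))))

-- Polynomial time

n<2^n : ∀ n → n ℕ.< 2 ^ n
n<2^n zero    = s≤s z≤n
n<2^n (suc n) = ℕₚ.≤-trans (ℕₚ.+-mono-≤ (ℕₚ.m^n>0 2 n) (n<2^n n)) (ℕₚ.≤-reflexive (cong (2 ^ n ℕ.+_) (sym (ℕₚ.+-identityʳ (2 ^ n)))))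

-- A base of at least 2 lets constants and sums be absorbed by a larger exponent, so a single
-- exponent records the bound.
Polynomial : (ℕ → ℕ) → Set
Polynomial g = ∃[ k ] ∀ n → g n ℕ.≤ (2 ℕ.+ n) ^ k

polynomial-const : ∀ c → Polynomial (λ _ → c)
polynomial-const c = c , λ n → ℕₚ.≤-trans (ℕₚ.<⇒≤ (n<2^n c)) (ℕₚ.^-monoˡ-≤ c (ℕₚ.m≤m+n 2 n))

polynomial-id : Polynomial (λ n → n)
polynomial-id = 1 , λ n → ℕₚ.≤-trans (ℕₚ.m≤n+m n 2) (ℕₚ.≤-reflexive (sym (ℕₚ.^-identityʳ (2 ℕ.+ n))))

polynomial-* : ∀ {g h} → Polynomial g → Polynomial h → Polynomial (λ n → g n ℕ.* h n)
polynomial-* (k , g≤) (l , h≤) = k ℕ.+ l , λ n →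
  ℕₚ.≤-trans (ℕₚ.*-mono-≤ (g≤ n) (h≤ n)) (ℕₚ.≤-reflexive (sym (ℕₚ.^-distribˡ-+-* (2 ℕ.+ n) k l)))

polynomial-+ : ∀ {g h} → Polynomial g → Polynomial h → Polynomial (λ n → g n ℕ.+ h n)
polynomial-+ {g} {h} (k , g≤) (l , h≤) = suc (k ℕ.+ l) , λ n → begin
  g n ℕ.+ h n  ≤⟨ ℕₚ.+-mono-≤ (below n k (k ℕ.+ l) (ℕₚ.m≤m+n k l) (g≤ n)) (below n l (k ℕ.+ l) (ℕₚ.m≤n+m l k) (h≤ n)) ⟩
  (2 ℕ.+ n) ^ (k ℕ.+ l) ℕ.+ (2 ℕ.+ n) ^ (k ℕ.+ l)  ≡⟨ cong ((2 ℕ.+ n) ^ (k ℕ.+ l) ℕ.+_) (sym (ℕₚ.+-identityʳ _)) ⟩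
  2 ℕ.* (2 ℕ.+ n) ^ (k ℕ.+ l)  ≤⟨ ℕₚ.*-monoˡ-≤ ((2 ℕ.+ n) ^ (k ℕ.+ l)) (ℕₚ.m≤m+n 2 n) ⟩
  (2 ℕ.+ n) ^ suc (k ℕ.+ l)  ∎
  where
  open ℕₚ.≤-Reasoning
  below : ∀ n k l {x} → k ℕ.≤ l → x ℕ.≤ (2 ℕ.+ n) ^ k → x ℕ.≤ (2 ℕ.+ n) ^ l
  below n k l k≤l x≤ = ℕₚ.≤-trans x≤ (ℕₚ.^-monoʳ-≤ (2 ℕ.+ n) k≤l)

polynomial-suc : ∀ {g} → Polynomial g → Polynomial (suc ∘ g)
polynomial-suc g = polynomial-+ (polynomial-const 1) g

infixr 5 _⊞_
_⊞_ : ∀ {g h} → Polynomial g → Polynomial h → Polynomial (λ n → g n ⊕ h n)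
g ⊞ h = polynomial-suc (polynomial-+ g h)

polynomial-≤ : ∀ {g h} → (∀ n → g n ℕ.≤ h n) → Polynomial h → Polynomial g
polynomial-≤ g≤h (k , h≤) = k , λ n → ℕₚ.≤-trans (g≤h n) (h≤ n)

loopTime≡ : ∀ m t → loopTime m t ≡ m ℕ.* suc t ℕ.+ 1
loopTime≡ zero    t = refl
loopTime≡ (suc m) t = cong suc (trans (cong (t ℕ.+_) (loopTime≡ m t)) (sym (ℕₚ.+-assoc t (m ℕ.* suc t) 1)))

polynomial-loop : ∀ {g h} → Polynomial g → Polynomial h → Polynomial (λ n → loopTime (g n) (h n))
polynomial-loop {g} {h} pg ph = polynomial-≤ (λ n → ℕₚ.≤-reflexive (loopTime≡ (g n) (h n)))
  (polynomial-+ (polynomial-* pg (polynomial-suc ph)) (polynomial-const 1))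

fixed : ∀ m → Polynomial (λ _ → m)
fixed = polynomial-const

polynomial-access : Polynomial accessTime
polynomial-access = polynomial-+ (polynomial-* polynomial-id (fixed 6)) (fixed 1) ⊞ fixed 1 ⊞ fixed 1 ⊞ polynomial-+ (polynomial-* polynomial-id (fixed 4)) (fixed 1)

polynomial-set : Polynomial (setTime ∘ accessTime)
polynomial-set = fixed 1 ⊞ fixed 1 ⊞ fixed 1 ⊞ polynomial-access ⊞ fixed 1 ⊞ fixed 1 ⊞ fixed 1 ⊞ fixed 1

polynomial-peek : Polynomial (peekTime ∘ accessTime)
polynomial-peek = fixed 1 ⊞ fixed 1 ⊞ polynomial-access ⊞ fixed 1 ⊞ fixed 1 ⊞ fixed 1

polynomial-guess : Polynomial (guessTime ∘ accessTime)
polynomial-guess = fixed 1 ⊞ polynomial-set ⊞ fixed 1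

module _ {t : ℕ → ℕ} (pt : Polynomial t) where

  polynomial-call : Polynomial (λ n → callTime (accessTime n) (t n))
  polynomial-call = fixed 1 ⊞ fixed 1 ⊞ fixed 1 ⊞ pt ⊞ fixed 1 ⊞ fixed 1 ⊞ fixed 1 ⊞ fixed 1 ⊞ fixed 1 ⊞ fixed 1 ⊞ fixed 1 ⊞ fixed 1 ⊞ fixed 1 ⊞ fixed 1 ⊞ fixed 1

  polynomial-literal : Polynomial (λ n → literalTime (accessTime n) (t n))
  polynomial-literal = fixed 1 ⊞ fixed 1 ⊞ fixed 1 ⊞ fixed 1 ⊞ fixed 1 ⊞ polynomial-access ⊞ fixed 4 ⊞ fixed 1 ⊞ fixed 1 ⊞ fixed 1 ⊞
                       polynomial-suc polynomial-call ⊞ fixed 1 ⊞ fixed 2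

  polynomial-clause : Polynomial (λ n → clauseTime (accessTime n) (t n))
  polynomial-clause = fixed 1 ⊞ fixed 1 ⊞ fixed 1 ⊞ polynomial-loop (fixed 4) polynomial-literal ⊞ fixed 2 ⊞ fixed 1

  polynomial-try : Polynomial (λ n → tryTime (accessTime n) (t n))
  polynomial-try = fixed 1 ⊞ polynomial-set ⊞ pt ⊞ fixed 1 ⊞ fixed 1

  polynomial-pick : Polynomial (λ n → pickTime (accessTime n) (t n))
  polynomial-pick = fixed 1 ⊞ polynomial-try ⊞ polynomial-suc (polynomial-try ⊞ polynomial-suc polynomial-guess) ⊞ fixed 1

  polynomial-event : Polynomial (λ n → eventTime (accessTime n) (t n))
  polynomial-event = polynomial-peek ⊞ polynomial-suc pt

  polynomial-with : ∀ b → Polynomial (λ n → withTime b (t n))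
  polynomial-with zero    = pt
  polynomial-with (suc b) = fixed 1 ⊞ polynomial-suc (polynomial-with b)

  polynomial-sweep : Polynomial (λ n → sweepTime n (t n))
  polynomial-sweep = fixed 1 ⊞ polynomial-loop polynomial-id (fixed 1 ⊞ pt)

module _ {m : ℕ → ℕ} (pm : Polynomial m) where

  polynomial-refute : ∀ k → Polynomial (λ n → refuteTime (accessTime n) (m n) k)
  polynomial-refute zero    = fixed 1 ⊞ fixed 1 ⊞ fixed 1 ⊞ fixed 1
  polynomial-refute (suc k) = fixed 1 ⊞ fixed 1 ⊞ fixed 1 ⊞ fixed 1 ⊞ polynomial-loop pm (polynomial-clause (polynomial-refute k))

  polynomial-initialise : Polynomial (λ n → initialiseTime (accessTime n) (m n))
  polynomial-initialise = fixed 1 ⊞ polynomial-loop pm (fixed 1 ⊞ fixed 1 ⊞ polynomial-loop (fixed 4) (fixed 1 ⊞ fixed 1 ⊞ polynomial-set ⊞ fixed 1)) ⊞ fixed 1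

  polynomial-algorithm : ∀ d b R → Polynomial (λ n → algorithmTime d b R n (m n))
  polynomial-algorithm d b R =
    polynomial-initialise ⊞ fixed 1 ⊞
    polynomial-loop (fixed R) (fixed 1 ⊞ polynomial-sweep (polynomial-event (polynomial-with (polynomial-pick (polynomial-refute d)) b))) ⊞
    polynomial-sweep (polynomial-event polynomial-guess) ⊞ fixed 1

log : ∀ n → ∃[ L ] (2 ℕ.+ n ℕ.≤ 2 ^ L × 2 ^ L ℕ.≤ 2 ℕ.* (2 ℕ.+ n))
log zero = 1 , ℕₚ.≤-refl , ℕₚ.m≤m+n 2 2
log (suc n) with log n
... | L , lo , hi with 3 ℕ.+ n ℕ.≤? 2 ^ L
...   | yes le = L , le , ℕₚ.≤-trans hi (ℕₚ.*-monoʳ-≤ 2 (ℕₚ.n≤1+n (2 ℕ.+ n)))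
...   | no ≰   = suc L , ℕₚ.≤-trans 3+n≤ (ℕₚ.*-monoʳ-≤ 2 lo) , ℕₚ.*-monoʳ-≤ 2 (ℕₚ.<⇒≤ (ℕₚ.≰⇒> ≰))
  where
  3+n≤ : 3 ℕ.+ n ℕ.≤ 2 ℕ.* (2 ℕ.+ n)
  3+n≤ = ℕₚ.≤-trans (ℕₚ.m≤m+n (3 ℕ.+ n) (1 ℕ.+ n)) (ℕₚ.≤-reflexive (lemma n))
    where
    lemma : ∀ n → 3 ℕ.+ n ℕ.+ (1 ℕ.+ n) ≡ 2 ℕ.* (2 ℕ.+ n)
    lemma = ℕ-Solver.solve-∀

exponent : ℕ → ℕ → ℕ
exponent k n = proj₁ (log n) ℕ.* k

polynomial≤2^exponent : ∀ {g} (pg : Polynomial g) n → g n ℕ.≤ 2 ^ exponent (proj₁ pg) n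
polynomial≤2^exponent {g} (k , g≤) n = begin
  g n  ≤⟨ g≤ n ⟩
  (2 ℕ.+ n) ^ k  ≤⟨ ℕₚ.^-monoˡ-≤ k (proj₁ (proj₂ (log n))) ⟩
  (2 ^ proj₁ (log n)) ^ k  ≡⟨ ℕₚ.^-*-assoc 2 (proj₁ (log n)) k ⟩
  2 ^ (proj₁ (log n) ℕ.* k)  ∎
  where open ℕₚ.≤-Reasoning

square≤2^ : ∀ L → L ℕ.* L ℕ.≤ 2 ℕ.* 2 ^ L
square≤2^ zero    = z≤n
square≤2^ (suc L) = begin
  suc L ℕ.* suc L  ≡⟨ lemma L ⟩
  L ℕ.* L ℕ.+ (L ℕ.+ suc L)  ≤⟨ ℕₚ.+-mono-≤ (square≤2^ L) (ℕₚ.+-mono-≤ (ℕₚ.<⇒≤ (n<2^n L)) (n<2^n L)) ⟩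
  2 ℕ.* 2 ^ L ℕ.+ (2 ^ L ℕ.+ 2 ^ L)  ≡⟨ lemma′ (2 ^ L) ⟩
  2 ℕ.* 2 ^ suc L  ∎
  where
  open ℕₚ.≤-Reasoning
  lemma : ∀ L → suc L ℕ.* suc L ≡ L ℕ.* L ℕ.+ (L ℕ.+ suc L)
  lemma = ℕ-Solver.solve-∀
  lemma′ : ∀ a → 2 ℕ.* a ℕ.+ (a ℕ.+ a) ≡ 2 ℕ.* (2 ℕ.* a)
  lemma′ = ℕ-Solver.solve-∀

product≤squares : ∀ a b → a ℕ.* b ℕ.≤ a ℕ.* a ℕ.+ b ℕ.* b
product≤squares a b with ℕₚ.≤-total a b
... | inj₁ a≤b = ℕₚ.≤-trans (ℕₚ.*-monoˡ-≤ b a≤b) (ℕₚ.m≤n+m (b ℕ.* b) (a ℕ.* a))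
... | inj₂ b≤a = ℕₚ.≤-trans (ℕₚ.*-monoʳ-≤ a b≤a) (ℕₚ.m≤m+n (a ℕ.* a) (b ℕ.* b))

-- With `c = 8jk` and `L` the logarithm, `c L ≤ c² + L²`, and `L² ≤ 2 * 2^L` is at most `4 (2 + n)`.
-- The factor 8 leaves room for `4 n` plus the n that bounds the constants.
exponent-sublinear : ∀ k → Sublinear (exponent k)
exponent-sublinear k j = N , λ n N≤n → ℕₚ.*-cancelˡ-≤ 8 (begin
  8 ℕ.* (j ℕ.* exponent k n)  ≡⟨ lemma j (L n) k ⟩
  c ℕ.* L n  ≤⟨ product≤squares c (L n) ⟩
  c ℕ.* c ℕ.+ L n ℕ.* L n  ≤⟨ ℕₚ.+-monoʳ-≤ (c ℕ.* c) (ℕₚ.≤-trans (square≤2^ (L n)) (ℕₚ.*-monoʳ-≤ 2 (proj₂ (proj₂ (log n))))) ⟩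
  c ℕ.* c ℕ.+ 2 ℕ.* (2 ℕ.* (2 ℕ.+ n))  ≡⟨ lemma′ (c ℕ.* c) n ⟩
  N ℕ.+ 4 ℕ.* n  ≤⟨ ℕₚ.+-monoˡ-≤ (4 ℕ.* n) N≤n ⟩
  n ℕ.+ 4 ℕ.* n  ≤⟨ ℕₚ.m≤m+n _ (3 ℕ.* n) ⟩
  n ℕ.+ 4 ℕ.* n ℕ.+ 3 ℕ.* n  ≡⟨ lemma″ n ⟩
  8 ℕ.* n  ∎)
  where
  open ℕₚ.≤-Reasoning
  c = 8 ℕ.* j ℕ.* k
  N = c ℕ.* c ℕ.+ 8
  L : ℕ → ℕ
  L n = proj₁ (log n)
  lemma : ∀ j L k → 8 ℕ.* (j ℕ.* (L ℕ.* k)) ≡ 8 ℕ.* j ℕ.* k ℕ.* L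
  lemma = ℕ-Solver.solve-∀
  lemma′ : ∀ c n → c ℕ.+ 2 ℕ.* (2 ℕ.* (2 ℕ.+ n)) ≡ c ℕ.+ 8 ℕ.+ 4 ℕ.* n
  lemma′ = ℕ-Solver.solve-∀
  lemma″ : ∀ n → n ℕ.+ 4 ℕ.* n ℕ.+ 3 ℕ.* n ≡ 8 ℕ.* n
  lemma″ = ℕ-Solver.solve-∀

-- The number of clauses

unique⊆⇒length≤ : ∀ {A : Set} {xs ys : List A} → AllPairs _≢_ xs → (∀ {x} → x ∈ xs → x ∈ ys) → length xs ℕ.≤ length ys
unique⊆⇒length≤ {xs = []}     []         ⊆ys = z≤n
unique⊆⇒length≤ {xs = x ∷ xs} (x≢ ∷ unq) ⊆ys with ∈-∃++ (⊆ys (here refl))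
... | as , bs , refl = begin
  suc (length xs)  ≤⟨ s≤s (unique⊆⇒length≤ unq ⊆as++bs) ⟩
  suc (length (as ++ bs))  ≡⟨ cong suc (length-++ as) ⟩
  suc (length as ℕ.+ length bs) ≡⟨ sym (ℕₚ.+-suc (length as) (length bs)) ⟩
  length as ℕ.+ suc (length bs) ≡⟨ sym (length-++ as) ⟩
  length (as ++ x ∷ bs)  ∎
  where
  open ℕₚ.≤-Reasoning
  ⊆as++bs : ∀ {z} → z ∈ xs → z ∈ as ++ bs
  ⊆as++bs z∈ with ∈-++⁻ as (⊆ys (there z∈))
  ... | inj₁ z∈as            = ∈-++⁺ˡ z∈as
  ... | inj₂ (here z≡x)      = contradiction (sym z≡x) (All.lookup x≢ z∈)
  ... | inj₂ (there z∈bs)    = ∈-++⁺ʳ as z∈bs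

literals : ∀ n → List (Literal n)
literals n = map pos (allFin n) ++ map neg (allFin n)

∈-literals : ∀ {n} (l : Literal n) → l ∈ literals n
∈-literals (pos x) = ∈-++⁺ˡ (∈-map⁺ pos (∈-allFin x))
∈-literals (neg x) = ∈-++⁺ʳ _ (∈-map⁺ neg (∈-allFin x))

words : ∀ n → ℕ → List (Clause n)
words n zero    = [] ∷ []
words n (suc k) = [] ∷ cartesianProductWith _∷_ (literals n) (words n k)

∈-words : ∀ {n} k (C : Clause n) → length C ℕ.≤ k → C ∈ words n k
∈-words zero    []      le       = here refl
∈-words (suc k) []      le       = here refl
∈-words (suc k) (l ∷ C) (s≤s le) = there (∈-cartesianProductWith⁺ _∷_ (∈-literals l) (∈-words k C le))

wordCount : ℕ → ℕ → ℕ
wordCount zero    n = 1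
wordCount (suc k) n = suc ((n ℕ.+ n) ℕ.* wordCount k n)

length-cartesianProductWith : ∀ {A B C : Set} (f : A → B → C) xs ys → length (cartesianProductWith f xs ys) ≡ length xs ℕ.* length ys
length-cartesianProductWith f []       ys = refl
length-cartesianProductWith f (x ∷ xs) ys =
  trans (length-++ (map (f x) ys)) (cong₂ ℕ._+_ (length-map (f x) ys) (length-cartesianProductWith f xs ys))

length-words : ∀ n k → length (words n k) ≡ wordCount k n
length-words n zero    = refl
length-words n (suc k) = cong suc (trans (length-cartesianProductWith _∷_ (literals n) (words n k))
  (cong₂ ℕ._*_ (trans (length-++ (map pos (allFin n))) (cong₂ ℕ._+_ (length-fins pos) (length-fins neg))) (length-words n k)))
  where
  length-fins : ∀ {A : Set} (f : Fin n → A) → length (map f (allFin n)) ≡ n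
  length-fins f = trans (length-map f (allFin n)) (length-tabulate id)

polynomial-words : ∀ k → Polynomial (wordCount k)
polynomial-words zero    = polynomial-const 1
polynomial-words (suc k) = polynomial-suc (polynomial-* (polynomial-+ polynomial-id polynomial-id) (polynomial-words k))

-- Clauses that are different as sets are different as lists, and each is a word of length at most 4
-- over the `2n` literals.
clause-count : ∀ {n} (F : CNF n) → Is 4 -CNF F → length (clauses F) ℕ.≤ wordCount 4 n
clause-count {n} F short = ℕₚ.≤-trans
  (unique⊆⇒length≤ (AllPairs.map (λ ¬↭ eq → ¬↭ (↭-reflexive eq)) (distinct F))
    (λ {C} C∈ → ∈-words 4 C (All.lookup short C∈)))
  (ℕₚ.≤-reflexive (length-words n 4))

-- Parameters

record Admissible (d : ℕ) (ρ : ℚ) (R : ℕ) (σ : ℚ) : Set where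
  open Forcing d ρ
  field
    0≤ρ       : 0ℚ ≤ ρ
    ρ≤1       : ρ ≤ 1ℚ
    ½≤σ       : ½ ≤ σ
    0≤σ-ρ     : 0ℚ ≤ σ - ρ
    unforced≤ : ∀ m → unforced m 0ℚ ≤ σ - ρ + (1ℚ - ρ) ^^ m
    residue   : (1ℚ - ρ) ^^ R ≤ ρ
    σ≤        : natℚ 245 * (σ + ρ) ≤ natℚ 136

Parameters : Set
Parameters = Σ[ d ∈ ℕ ] Σ[ b ∈ ℕ ] Σ[ R ∈ ℕ ] Σ[ σ ∈ ℚ ] Admissible d (½ ^^ b) R σ

parameters-from : ∀ h → ½ ≡ h → ∀ d s t R → R ≡ 2 ^ 16 ℕ.* 2 ^ 16 →
  s ℕ.+ t ≡ 2 ^ 20 ℕ.+ 2 ^ 5 → 2 ^ 19 ℕ.≤ s → 245 ℕ.* (s ℕ.+ 2 ^ 4) ℕ.≤ 136 ℕ.* 2 ^ 20 →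
  t ℕ.* 2 ^ 16 ℕ.≤ Approximation.approxSum (2 ^ 12) (2 ^ 24) d (2 ^ 12) → Parameters
parameters-from h ½≡h d s t R R≡ s+t s≥ s≤ t≤ = d , 16 , R , natℚ s * h ^^ 20 ,
  subst (λ ρ → Admissible d ρ R (natℚ s * h ^^ 20)) (cong (_^^ 16) (sym ½≡h)) (record
    { 0≤ρ = 0≤ρ₀ ; ρ≤1 = ρ₀≤1 ; ½≤σ = Good.½≤σ g ; 0≤σ-ρ = Good.0≤σ-ρ g
    ; unforced≤ = Good.unforced≤ g ; residue = residue R≡ ; σ≤ = Good.σ≤ g })
  where
  open Estimate h ½≡h
  g = good d s t s+t s≥ s≤ t≤

-- The limit 582043/2^20 < 0.55508 slightly exceeds 1 - S₄ ≈ 0.55482, the PPSZ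
-- exponent for unique 4-SAT; 136/245 < log₂ 1.46928.
abstract
  parameters : Parameters
  parameters = parameters-from ½ refl 200 582043 466565 (2 ^ 16 ℕ.* 2 ^ 16) refl refl
    (ℕₚ.≤ᵇ⇒≤ (2 ^ 19) 582043 tt)
    (ℕₚ.≤ᵇ⇒≤ (245 ℕ.* (582043 ℕ.+ 2 ^ 4)) (136 ℕ.* 2 ^ 20) tt)
    (ℕₚ.≤ᵇ⇒≤ (466565 ℕ.* 2 ^ 16) (Approximation.approxSum (2 ^ 12) (2 ^ 24) 200 (2 ^ 12)) tt)

-- Completing a partial assignment by fair coins

descending-below : ∀ {n} j (le : j ℕ.≤ n) → All (λ x → toℕ x ℕ.< j) (descending j le)
descending-below zero    le = []
descending-below (suc j) le = s≤s (ℕₚ.≤-reflexive (Fin.toℕ-fromℕ< le)) ∷ All.map ℕₚ.m≤n⇒m≤1+n (descending-below j _)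

descending-unique : ∀ {n} j (le : j ℕ.≤ n) → AllPairs _≢_ (descending j le)
descending-unique zero    le = []
descending-unique (suc j) le =
  All.map (λ x<j eq → ℕₚ.<-irrefl (trans (cong toℕ (sym eq)) (Fin.toℕ-fromℕ< le)) x<j) (descending-below j _) ∷
  descending-unique j _

descending-complete : ∀ {n} j (le : j ℕ.≤ n) (x : Fin n) → toℕ x ℕ.< j → x ∈ descending j le
descending-complete (suc j) le x (s≤s x≤j) with ℕₚ.m≤n⇒m<n∨m≡n x≤j
... | inj₁ x<j = there (descending-complete j _ x x<j)
... | inj₂ x≡j = here (Fin.toℕ-injective (trans x≡j (sym (Fin.toℕ-fromℕ< le))))

number : ∀ {n} → PA n → ℚ
number []      = 0ℚ
number (m ∷ τ) = unassigned? m 0ℚ 1ℚ + number τ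

∑-tabulate : ∀ {n} {A : Set} (τ : PA n) (h : Fin n → A) g → (∀ v → g (h v) ≡ unassigned? (lookup τ v) 0ℚ 1ℚ) →
             ∑ (tabulate h) g ≡ number τ
∑-tabulate []      h g eq = refl
∑-tabulate (m ∷ τ) h g eq = cong₂ _+_ (eq zero) (∑-tabulate τ (h ∘ suc) g (eq ∘ suc))

unassigned≡number : ∀ {n} (τ : PA n) → unassigned τ ≡ number τ
unassigned≡number τ = ∑-tabulate τ id _ (λ _ → refl)

number-↦ : ∀ {n} (τ : PA n) x b → lookup τ x ≡ nothing → number τ ≡ 1ℚ + number (τ [ x ↦ b ])
number-↦ (nothing ∷ τ) zero    b eq = cong (1ℚ +_) (sym (ℚₚ.+-identityˡ (number τ)))
number-↦ (m ∷ τ)       (suc x) b eq = trans (cong (unassigned? m 0ℚ 1ℚ +_) (number-↦ τ x b eq))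
                                            (lemma (unassigned? m 0ℚ 1ℚ) (number (τ [ x ↦ b ])))
  where
  lemma : ∀ a b → a + (1ℚ + b) ≡ 1ℚ + (a + b)
  lemma = solve-∀ ℚ-ring

0≤number : ∀ {n} (τ : PA n) → 0ℚ ≤ number τ
0≤number []            = ℚₚ.≤-refl
0≤number (just _ ∷ τ)  = 0≤+ ℚₚ.≤-refl (0≤number τ)
0≤number (nothing ∷ τ) = 0≤+ 0≤1 (0≤number τ)

1+m≤2^m : ∀ m → 1ℚ + natℚ m ≤ 2ℚ ^^ m
1+m≤2^m zero    rewrite natℚ-zero = ℚₚ.≤-refl
1+m≤2^m (suc m) rewrite natℚ-suc m =
  ℚₚ.≤-trans (≤-by (0≤natℚ m) (lemma (natℚ m))) (*-monoʳ 0≤2 (1+m≤2^m m))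
  where
  lemma : ∀ a → (1ℚ + 1ℚ) * (1ℚ + a) ≡ 1ℚ + (1ℚ + a) + a
  lemma = solve-∀ ℚ-ring

assignment-encode : ∀ {n} (τ : PA n) α → (∀ x → lookup τ x ≢ nothing) → α ⊒ τ → assignment n (encode τ) ≡ α
assignment-encode []            []      _        _   = refl
assignment-encode (nothing ∷ τ) (a ∷ α) assigned _   = contradiction refl (assigned zero)
assignment-encode (just b ∷ τ)  (a ∷ α) assigned α⊒τ = cong₂ _∷_
  (trans (isTrue-bit b) (sym (⊒-lookup α⊒τ zero b refl)))
  (assignment-encode τ α (assigned ∘ suc) (mk⊒ (⊒-lookup α⊒τ ∘ suc)))

module _ {n} (cls : List (Clause n)) (φ : PA n → ℚ) (0≤φ : ∀ τ → 0ℚ ≤ φ τ)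
         (φ-Sol : ∀ {τ α} → Refutation.Sol cls τ α → (∀ x → lookup τ x ≢ nothing) → 1ℚ ≤ φ τ) where

  open Refutation cls

  0≤completion : ∀ es τ → 0ℚ ≤ completion φ es τ
  0≤completion []       τ = 0≤φ τ
  0≤completion (x ∷ es) τ with lookup τ x
  ... | just _  = 0≤completion es τ
  ... | nothing = 0≤* 0≤½ (0≤+ (0≤completion es _) (0≤completion es _))

  completion-≥half : ∀ es τ x c → ½ * completion φ es (τ [ x ↦ c ]) ≤
                     ½ * (completion φ es (τ [ x ↦ false ]) + completion φ es (τ [ x ↦ true ]))
  completion-≥half es τ x false = *-monoʳ 0≤½ (≤-by {completion φ es (τ [ x ↦ false ])} (0≤completion es (τ [ x ↦ true ])) refl)
  completion-≥half es τ x true  = *-monoʳ 0≤½ (≤-by {completion φ es (τ [ x ↦ true ])} (0≤completion es (τ [ x ↦ false ]))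
    (ℚₚ.+-comm (completion φ es (τ [ x ↦ false ])) (completion φ es (τ [ x ↦ true ]))))

  -- It suffices to follow the coins that agree with the solution α: each halves the probability and
  -- lowers the number of unassigned variables by one, so the index of the chord drops by one. With
  -- all variables assigned, `1 + m ≤ 2^m` finishes.
  completion-chord : ∀ es {τ α} → Sol τ α → (∀ x → lookup τ x ≡ nothing → x ∈ es) → ∀ m →
                     1ℚ + natℚ m - number τ ≤ 2ℚ ^^ m * completion φ es τ
  completion-chord [] {τ} sol covers m = begin
    1ℚ + natℚ m - number τ  ≤⟨ ≤-by (0≤number τ) (lemma (1ℚ + natℚ m) (number τ)) ⟩
    1ℚ + natℚ m  ≤⟨ 1+m≤2^m m ⟩
    2ℚ ^^ m  ≡⟨ sym (ℚₚ.*-identityʳ (2ℚ ^^ m)) ⟩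
    2ℚ ^^ m * 1ℚ  ≤⟨ *-monoʳ (0≤^^ m 0≤2) (φ-Sol sol (λ x eq → case covers x eq of λ ())) ⟩
    2ℚ ^^ m * φ τ  ∎
    where
    open ℚₚ.≤-Reasoning
    lemma : ∀ a b → a ≡ a - b + b
    lemma = solve-∀ ℚ-ring
  completion-chord (x ∷ es) {τ} {α} sol covers = by-status (lookup τ x) refl
    where
    open ℚₚ.≤-Reasoning
    Goal : Maybe Bool → ℕ → Set
    Goal s m = 1ℚ + natℚ m - number τ ≤ 2ℚ ^^ m *
      unassigned? s (completion φ es τ) (½ * (completion φ es (τ [ x ↦ false ]) + completion φ es (τ [ x ↦ true ])))
    by-status : ∀ s → lookup τ x ≡ s → ∀ m → Goal (lookup τ x) m
    by-status (just b) eq m = subst (λ s → Goal s m) (sym eq) (completion-chord es sol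
      (λ y uny → case covers y uny of λ { (here refl) → case trans (sym eq) uny of λ () ; (there y∈) → y∈ }) m)
    by-status nothing eq zero = subst (λ s → Goal s 0) (sym eq) (begin
      1ℚ + natℚ 0 - number τ  ≡⟨ cong₂ (λ a b → 1ℚ + a - b) natℚ-zero (number-↦ τ x true eq) ⟩
      1ℚ + 0ℚ - (1ℚ + number (τ [ x ↦ true ]))  ≤⟨ ≤-by (0≤number (τ [ x ↦ true ])) (lemma (number (τ [ x ↦ true ]))) ⟩
      0ℚ  ≤⟨ 0≤* 0≤1 (0≤* 0≤½ (0≤+ (0≤completion es _) (0≤completion es _))) ⟩
      _  ∎)
      where
      lemma : ∀ a → 0ℚ ≡ 1ℚ + 0ℚ - (1ℚ + a) + a
      lemma = solve-∀ ℚ-ring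
    by-status nothing eq (suc m) = subst (λ s → Goal s (suc m)) (sym eq) (begin
      1ℚ + natℚ (suc m) - number τ  ≡⟨ cong₂ (λ a b → 1ℚ + a - b) (natℚ-suc m) (number-↦ τ x c eq) ⟩
      1ℚ + (1ℚ + natℚ m) - (1ℚ + number (τ [ x ↦ c ]))  ≡⟨ lemma (natℚ m) (number (τ [ x ↦ c ])) ⟩
      1ℚ + natℚ m - number (τ [ x ↦ c ])  ≤⟨ completion-chord es (Sol-↦ sol refl) covers′ m ⟩
      2ℚ ^^ m * completion φ es (τ [ x ↦ c ])  ≡⟨ lemma′ (2ℚ ^^ m) (completion φ es (τ [ x ↦ c ])) ⟩
      2ℚ ^^ suc m * (½ * completion φ es (τ [ x ↦ c ]))  ≤⟨ *-monoʳ (0≤^^ (suc m) 0≤2) (completion-≥half es τ x c) ⟩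
      _  ∎)
      where
      c = lookup α x
      lemma : ∀ a b → 1ℚ + (1ℚ + a) - (1ℚ + b) ≡ 1ℚ + a - b
      lemma = solve-∀ ℚ-ring
      lemma′ : ∀ a b → a * b ≡ (1ℚ + 1ℚ) * a * (½ * b)
      lemma′ = solve-∀ ℚ-ring
      covers′ : ∀ y → lookup (τ [ x ↦ c ]) y ≡ nothing → y ∈ es
      covers′ y uny with y Fin.≟ x
      ... | yes refl = case trans (sym (lookup-↦ τ x c)) uny of λ ()
      ... | no y≢x with covers y (trans (sym (lookup-↦′ y≢x τ c)) uny)
      ...   | here y≡x  = contradiction y≡x y≢x
      ...   | there y∈  = y∈

-- The success probability

fraction : ∀ i d → ℚ.toℚᵘ (i / suc d) ℚᵘ.≃ ℚᵘ.mkℚᵘ i d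
fraction i d = ℚₚ.toℚᵘ-fromℚᵘ (ℚᵘ.mkℚᵘ i d)

natℚ≡ : ∀ m → natℚ m ≡ ℤ.+ m / 1
natℚ≡ zero    = natℚ-zero
natℚ≡ (suc m) = trans (natℚ-suc m) (trans (cong (1ℚ +_) (natℚ≡ m)) (ℚₚ.toℚᵘ-injective (begin
  ℚ.toℚᵘ (1ℚ + ℤ.+ m / 1)  ≈⟨ ℚₚ.toℚᵘ-homo-+ 1ℚ (ℤ.+ m / 1) ⟩
  ℚ.toℚᵘ 1ℚ ℚᵘ.+ ℚ.toℚᵘ (ℤ.+ m / 1)  ≈⟨ ℚᵘₚ.+-congʳ (ℚ.toℚᵘ 1ℚ) (fraction (ℤ.+ m) 0) ⟩
  ℚ.toℚᵘ 1ℚ ℚᵘ.+ ℚᵘ.mkℚᵘ (ℤ.+ m) 0  ≈⟨ ℚᵘ.*≡* (lemma (ℤ.+ m)) ⟩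
  ℚᵘ.mkℚᵘ (ℤ.+ suc m) 0  ≈⟨ ℚᵘₚ.≃-sym (fraction (ℤ.+ suc m) 0) ⟩
  ℚ.toℚᵘ (ℤ.+ suc m / 1)  ∎)))
  where
  open ℚᵘₚ.≃-Reasoning
  lemma : ∀ i → (ℤ.1ℤ ℤ.* ℤ.1ℤ ℤ.+ i ℤ.* ℤ.1ℤ) ℤ.* ℤ.1ℤ ≡ (ℤ.1ℤ ℤ.+ i) ℤ.* ℤ.1ℤ
  lemma = ℤ-Solver.solve-∀

/-natℚ : ∀ a d .{{_ : ℕ.NonZero d}} → (ℤ.+ a / d) * natℚ d ≡ natℚ a
/-natℚ a (suc d) = trans (cong ((ℤ.+ a / suc d) *_) (natℚ≡ (suc d))) (trans (ℚₚ.toℚᵘ-injective (begin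
  ℚ.toℚᵘ ((ℤ.+ a / suc d) * (ℤ.+ suc d / 1))  ≈⟨ ℚₚ.toℚᵘ-homo-* (ℤ.+ a / suc d) (ℤ.+ suc d / 1) ⟩
  ℚ.toℚᵘ (ℤ.+ a / suc d) ℚᵘ.* ℚ.toℚᵘ (ℤ.+ suc d / 1)  ≈⟨ ℚᵘₚ.*-cong (fraction (ℤ.+ a) d) (fraction (ℤ.+ suc d) 0) ⟩
  ℚᵘ.mkℚᵘ (ℤ.+ a) d ℚᵘ.* ℚᵘ.mkℚᵘ (ℤ.+ suc d) 0  ≈⟨ ℚᵘ.*≡* (trans (ℤₚ.*-identityʳ _) (cong (λ k → ℤ.+ a ℤ.* ℤ.+ k) (sym (ℕₚ.*-identityʳ (suc d))))) ⟩
  ℚᵘ.mkℚᵘ (ℤ.+ a) 0  ≈⟨ ℚᵘₚ.≃-sym (fraction (ℤ.+ a) 0) ⟩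
  ℚ.toℚᵘ (ℤ.+ a / 1)  ∎)) (sym (natℚ≡ a)))
  where open ℚᵘₚ.≃-Reasoning

natℚ-positive : ∀ m .{{_ : ℕ.NonZero m}} → ℚ.Positive (natℚ m)
natℚ-positive (suc m) = ℚ.positive (ℚₚ.<-≤-trans (ℚₚ.positive⁻¹ 1ℚ) (ℚₚ.≤-trans (≤-by (0≤natℚ m) refl) (ℚₚ.≤-reflexive (sym (natℚ-suc m)))))

/2^ : ∀ a T → (ℤ.+ a / 2 ^ T) {{ℕₚ.m^n≢0 2 T}} ≡ natℚ a * ½ ^^ T
/2^ a T = begin
  q  ≡⟨ sym (ℚₚ.*-identityʳ q) ⟩
  q * 1ℚ  ≡⟨ cong (q *_) (sym (trans (ℚₚ.*-comm (2ℚ ^^ T) (½ ^^ T)) (halves T))) ⟩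
  q * (2ℚ ^^ T * ½ ^^ T)  ≡⟨ sym (ℚₚ.*-assoc q (2ℚ ^^ T) (½ ^^ T)) ⟩
  q * 2ℚ ^^ T * ½ ^^ T  ≡⟨ cong (λ a → q * a * ½ ^^ T) (sym (natℚ-2^ T)) ⟩
  q * natℚ (2 ^ T) * ½ ^^ T  ≡⟨ cong (_* ½ ^^ T) (/-natℚ a (2 ^ T) {{ℕₚ.m^n≢0 2 T}}) ⟩
  natℚ a * ½ ^^ T  ∎
  where
  open ≡-Reasoning
  q = (ℤ.+ a / 2 ^ T) {{ℕₚ.m^n≢0 2 T}}

module Outcome {n} (F : CNF n) where

  satisfies? : ∀ (σ : Store 17) → Dec (assignment n (lookup σ zero) ⊨ F)
  satisfies? σ = assignment n (lookup σ zero) ⊨? F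

  goal : Store 17 → ℚ
  goal σ = indicator (does (satisfies? σ))

  open Execution goal

  count-value : ∀ T C → natℚ (count {T} (λ ω → satisfies? (proj₂ (runFrom C ω)))) * ½ ^^ T ≡ value T C
  count-value zero (κ , σ) with does (satisfies? σ)
  ... | true  = trans (ℚₚ.*-identityʳ _) (trans (natℚ-suc 0) (cong (1ℚ +_) natℚ-zero))
  ... | false = trans (ℚₚ.*-identityʳ _) natℚ-zero
  count-value (suc T) C = begin
    natℚ (a ℕ.+ b) * ½ ^^ suc T  ≡⟨ cong (_* ½ ^^ suc T) (natℚ-+ a b) ⟩
    (natℚ a + natℚ b) * (½ * ½ ^^ T)  ≡⟨ lemma (natℚ a) (natℚ b) (½ ^^ T) ⟩
    ½ * (natℚ a * ½ ^^ T + natℚ b * ½ ^^ T)  ≡⟨ cong₂ (λ x y → ½ * (x + y)) (count-value T (step C false)) (count-value T (step C true)) ⟩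
    value (suc T) C  ∎
    where
    open ≡-Reasoning
    a = count {T} (λ ω → satisfies? (proj₂ (runFrom (step C false) ω)))
    b = count {T} (λ ω → satisfies? (proj₂ (runFrom (step C true) ω)))
    lemma : ∀ x y z → (x + y) * (½ * z) ≡ ½ * (x * z + y * z)
    lemma = solve-∀ ℚ-ring

  successProbability≡value : ∀ d b R T →
    successProbability (algorithm d b R) F T ≡ value T (body (algorithm d b R) ∷ [] , ⌜ F ⌝ ∷ replicate 16 nil)
  successProbability≡value d b R T = trans (/2^ _ T) (count-value T _)

length≡∑ : ∀ {A : Set} (xs : List A) c → ∑ xs (λ _ → c) ≡ natℚ (length xs) * c
length≡∑ []       c = sym (trans (cong (_* c) natℚ-zero) (ℚₚ.*-zeroˡ c))
length≡∑ (x ∷ xs) c = trans (cong (c +_) (length≡∑ xs c))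
  (trans (lemma (natℚ (length xs)) c) (cong (_* c) (sym (natℚ-suc (length xs)))))
  where
  lemma : ∀ a c → c + a * c ≡ (1ℚ + a) * c
  lemma = solve-∀ ℚ-ring

module Satisfied {n} (F : CNF n) (short : Is 4 -CNF F) {d b R σ} (params : Admissible d (½ ^^ b) R σ) where

  open Admissible params
  open Outcome F
  open WholeRun goal (clauses F) short (wordCount 4 n) (clause-count F short) (occurs F) d b using (vs; outcome)
  open Refutation (clauses F)

  ρ w : ℚ
  ρ = ½ ^^ b
  w = proj₁ (reciprocal 0≤ρ)

  0≤w : 0ℚ ≤ w
  0≤w = proj₁ (proj₂ (reciprocal 0≤ρ))

  w≤1 : w ≤ 1ℚ
  w≤1 = proj₁ (proj₂ (proj₂ (reciprocal 0≤ρ)))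

  w-inverse : (1ℚ + ρ) * w ≡ 1ℚ
  w-inverse = proj₂ (proj₂ (proj₂ (reciprocal 0≤ρ)))

  0≤outcome : ∀ τ → 0ℚ ≤ outcome τ
  0≤outcome τ = 0≤indicator _

  outcome-Sol : ∀ {τ α} → Sol τ α → (∀ x → lookup τ x ≢ nothing) → 1ℚ ≤ outcome τ
  outcome-Sol {τ} {α} (α⊨ , α⊒) assigned rewrite assignment-encode τ α assigned α⊒ with α ⊨? F
  ... | yes _  = ℚₚ.≤-refl
  ... | no ¬α⊨ = contradiction α⊨ ¬α⊨

  final : PA n → ℚ
  final = completion outcome vs

  open Process (clauses F) d ρ w 0≤ρ ρ≤1 0≤w w≤1 w-inverse
  open Cost (clauses F) d ρ w 0≤ρ ρ≤1 0≤w w≤1 w-inverse σ ½≤σ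
  open Success (clauses F) d ρ w 0≤ρ ρ≤1 0≤w w≤1 w-inverse σ ½≤σ final
    (0≤completion (clauses F) outcome 0≤outcome outcome-Sol vs)
  open Schedule (clauses F) short d ρ w 0≤ρ ρ≤1 0≤w w≤1 w-inverse σ ½≤σ
  open Algorithm (clauses F) d ρ final using (success)

  vs-complete : ∀ x → x ∈ vs
  vs-complete x = descending-complete n ℕₚ.≤-refl x (Fin.toℕ<n x)

  vs-unique : AllPairs _≢_ vs
  vs-unique = descending-unique n ℕₚ.≤-refl

  final-chord : ∀ τ → sat τ ≡ true → ∀ m → 1ℚ + natℚ m - unassigned τ ≤ 2ℚ ^^ m * final τ
  final-chord τ eq m rewrite unassigned≡number τ =
    completion-chord (clauses F) outcome 0≤outcome outcome-Sol vs (proj₂ (sat⁻ eq)) (λ x _ → vs-complete x) m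

  potential≤ : ∀ es τ → Bounded es → ∀ v {L} → limit (occurrences v es) ≤ L → lookup τ v ≡ nothing →
               ∀ β → law es τ β * potential es τ β v ≤ law es τ β * L
  potential≤ es τ bounded v {L} limit≤ un β = by-Sol (Sol? τ β)
    where
    by-kind : Sol τ β → ∀ k → liquid τ v ≡ k → (if k then limit (occurrences v es) else cost es τ β v) ≤ limit (occurrences v es)
    by-kind s true  liq = ℚₚ.≤-refl
    by-kind s false liq = bounded τ β v s un liq
    by-Sol : Dec (Sol τ β) → law es τ β * potential es τ β v ≤ law es τ β * L
    by-Sol (yes s) = *-monoʳ (0≤law es τ β) (ℚₚ.≤-trans
      (ℚₚ.≤-reflexive (cong (λ m → unassigned? m 0ℚ (if liquid τ v then limit (occurrences v es) else cost es τ β v)) un))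
      (ℚₚ.≤-trans (by-kind s (liquid τ v) refl) limit≤))
    by-Sol (no ¬s) = ℚₚ.≤-reflexive (trans (cong (_* potential es τ β v) (law-¬Sol es τ β ¬s))
      (trans (ℚₚ.*-zeroˡ (potential es τ β v)) (sym (trans (cong (_* L) (law-¬Sol es τ β ¬s)) (ℚₚ.*-zeroˡ L)))))

  module _ {α : Assignment n} (α⊨ : α ⊨ F) where

    es : List (Fin n)
    es = rounds vs R

    blank : PA n
    blank = unset n

    blank-sat : sat blank ≡ true
    blank-sat = sat⁺ {blank} {α} (α⊨ , mk⊒ λ x b eq → case trans (sym (Vecₚ.lookup-replicate x nothing)) eq of λ ())

    es-bounded : Bounded es
    es-bounded = bounded-rounds vs-complete vs-unique 0≤σ-ρ unforced≤ [] R []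

    limit≤ : ∀ v → limit (occurrences v es) ≤ σ + ρ
    limit≤ v = ℚₚ.≤-trans
      (ℚₚ.≤-reflexive (cong limit (occurrences-rounds vs-complete vs-unique 0≤σ-ρ unforced≤ v R)))
      (ℚₚ.+-monoʳ-≤ σ residue)

    -- At the start every variable, liquid or frozen, has potential at most `limit R`, which exceeds
    -- σ by at most ρ, and the law has mass 1.
    total≤ : total es blank ≤ natℚ n * (σ + ρ)
    total≤ = begin
      total es blank  ≤⟨ ∑-mono (allFin n) (λ v → ∑-mono A (potential≤ es blank es-bounded v (limit≤ v) (Vecₚ.lookup-replicate v nothing))) ⟩
      ∑ (allFin n) (λ v → ∑ A (λ β → law es blank β * (σ + ρ)))
                                                ≡⟨ ∑-cong (allFin n) (λ v → trans (∑-*ʳ A (σ + ρ) (law es blank))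
                                                     (trans (cong (_* (σ + ρ)) (trans (∑-law es blank) (cong indicator blank-sat))) (ℚₚ.*-identityˡ _))) ⟩
      ∑ (allFin n) (λ v → σ + ρ)  ≡⟨ length≡∑ (allFin n) (σ + ρ) ⟩
      natℚ (length (allFin n)) * (σ + ρ)  ≡⟨ cong (λ l → natℚ l * (σ + ρ)) (length-tabulate {n = n} id) ⟩
      natℚ n * (σ + ρ)  ∎
      where open ℚₚ.≤-Reasoning

    -- Any integer `m` no smaller than the potential will do: the chord with index `m` is then at
    -- least `2^-m`.
    success≥ : ∀ m → n ℕ.* 136 ℕ.≤ 245 ℕ.* m → ½ ^^ m ≤ success es blank
    success≥ m le = begin
      ½ ^^ m  ≡⟨ sym (ℚₚ.*-identityʳ (½ ^^ m)) ⟩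
      ½ ^^ m * 1ℚ  ≤⟨ *-monoʳ (0≤^^ m 0≤½) 1≤ ⟩
      ½ ^^ m * (2ℚ ^^ m * success es blank)  ≡⟨ sym (ℚₚ.*-assoc (½ ^^ m) (2ℚ ^^ m) _) ⟩
      ½ ^^ m * 2ℚ ^^ m * success es blank  ≡⟨ trans (cong (_* success es blank) (halves m)) (ℚₚ.*-identityˡ _) ⟩
      success es blank  ∎
      where
      open ℚₚ.≤-Reasoning
      lemma : ∀ a x y → a * (x * y) ≡ x * (a * y)
      lemma = solve-∀ ℚ-ring
      lemma′ : ∀ a t → 1ℚ + a - t ≡ 1ℚ + (a - t)
      lemma′ = solve-∀ ℚ-ring
      total≤m : total es blank ≤ natℚ m
      total≤m = ℚₚ.*-cancelˡ-≤-pos (natℚ 245) {{natℚ-positive 245}} (begin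
        natℚ 245 * total es blank  ≤⟨ *-monoʳ (0≤natℚ 245) total≤ ⟩
        natℚ 245 * (natℚ n * (σ + ρ))  ≡⟨ lemma (natℚ 245) (natℚ n) (σ + ρ) ⟩
        natℚ n * (natℚ 245 * (σ + ρ))  ≤⟨ *-monoʳ (0≤natℚ n) σ≤ ⟩
        natℚ n * natℚ 136  ≡⟨ sym (natℚ-* n 136) ⟩
        natℚ (n ℕ.* 136)  ≤⟨ natℚ-mono le ⟩
        natℚ (245 ℕ.* m)  ≡⟨ natℚ-* 245 m ⟩
        natℚ 245 * natℚ m  ∎)
      1≤ : 1ℚ ≤ 2ℚ ^^ m * success es blank
      1≤ = ℚₚ.≤-trans (≤-by (p≤q⇒0≤q-p total≤m) (lemma′ (natℚ m) (total es blank)))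
        (chord final-chord es (bounded-tails vs-complete vs-unique 0≤σ-ρ unforced≤ R) blank blank-sat m)

-- The rate 1.46928

^^-* : ∀ x a b → x ^^ (b ℕ.* a) ≡ (x ^^ a) ^^ b
^^-* x a zero    = refl
^^-* x a (suc b) = trans (^^-+ x a (b ℕ.* a)) (cong (x ^^ a *_) (^^-* x a b))

*-^^ : ∀ x y m → (x * y) ^^ m ≡ x ^^ m * y ^^ m
*-^^ x y zero    = refl
*-^^ x y (suc m) = trans (cong (x * y *_) (*-^^ x y m)) (lemma x y (x ^^ m) (y ^^ m))
  where
  lemma : ∀ x y a b → x * y * (a * b) ≡ x * a * (y * b)
  lemma = solve-∀ ℚ-ring

natℚ-^ : ∀ a m → natℚ (a ^ m) ≡ natℚ a ^^ m
natℚ-^ a zero    = trans (natℚ-suc 0) (cong (1ℚ +_) natℚ-zero)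
natℚ-^ a (suc m) = trans (natℚ-* a (a ^ m)) (cong (natℚ a *_) (natℚ-^ a m))

-- Clears denominators, so that the comparison of real exponents becomes one between two natural
-- numbers that evaluation decides.
power-≤ : ∀ x a b e g .{{_ : ℕ.NonZero (b ^ e)}} → x * natℚ b ≡ natℚ a → a ^ e ℕ.* 2 ^ g ℕ.≤ b ^ e → x ^^ e ≤ ½ ^^ g
power-≤ x a b e g xb le = ℚₚ.*-cancelʳ-≤-pos (natℚ (b ^ e)) {{natℚ-positive (b ^ e)}} (begin
  x ^^ e * natℚ (b ^ e)  ≡⟨ cong (x ^^ e *_) (natℚ-^ b e) ⟩
  x ^^ e * natℚ b ^^ e  ≡⟨ sym (*-^^ x (natℚ b) e) ⟩
  (x * natℚ b) ^^ e  ≡⟨ trans (cong (_^^ e) xb) (sym (natℚ-^ a e)) ⟩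
  natℚ (a ^ e)  ≡⟨ sym (trans (lemma (natℚ (a ^ e)) (2ℚ ^^ g) (½ ^^ g)) (trans (cong (_* natℚ (a ^ e)) (halves g)) (ℚₚ.*-identityˡ _))) ⟩
  ½ ^^ g * (natℚ (a ^ e) * 2ℚ ^^ g)  ≡⟨ cong (½ ^^ g *_) (sym (trans (natℚ-* (a ^ e) (2 ^ g)) (cong (natℚ (a ^ e) *_) (natℚ-2^ g)))) ⟩
  ½ ^^ g * natℚ (a ^ e ℕ.* 2 ^ g)  ≤⟨ *-monoʳ (0≤^^ g 0≤½) (natℚ-mono le) ⟩
  ½ ^^ g * natℚ (b ^ e)  ∎)
  where
  open ℚₚ.≤-Reasoning
  lemma : ∀ a t h → h * (a * t) ≡ h * t * a
  lemma = solve-∀ ℚ-ring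

½^-positive : ∀ g → 0ℚ < ½ ^^ g
½^-positive g = ℚₚ.≰⇒> λ ½^≤0 → ℚₚ.<-irrefl refl (ℚₚ.<-≤-trans (ℚₚ.positive⁻¹ 1ℚ) (begin
  1ℚ  ≡⟨ sym (halves g) ⟩
  ½ ^^ g * 2ℚ ^^ g  ≤⟨ *-monoˡ (0≤^^ g 0≤2) ½^≤0 ⟩
  0ℚ * 2ℚ ^^ g  ≡⟨ ℚₚ.*-zeroˡ (2ℚ ^^ g) ⟩
  0ℚ  ∎))
  where open ℚₚ.≤-Reasoning

-- Only whole blocks of `e` factors are compared, the remaining factors being at most 1. The
-- prefactor `½ ^^ g` pays for rounding `n / e` up, and is the origin of the constant hidden in Ω.
rate : ∀ x e g .{{_ : ℕ.NonZero e}} → 0ℚ ≤ x → x ≤ 1ℚ → x ^^ e ≤ ½ ^^ g → ∀ n → ½ ^^ g * x ^^ n ≤ ½ ^^ (suc (n ℕ./ e) ℕ.* g)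
rate x e g 0≤x x≤1 x^e≤ n = begin
  ½ ^^ g * x ^^ n  ≡⟨ cong (λ k → ½ ^^ g * x ^^ k) (ℕ.m≡m%n+[m/n]*n n e) ⟩
  ½ ^^ g * x ^^ (n ℕ.% e ℕ.+ q ℕ.* e)  ≡⟨ cong (½ ^^ g *_) (trans (^^-+ x (n ℕ.% e) (q ℕ.* e)) (cong (x ^^ (n ℕ.% e) *_) (^^-* x e q))) ⟩
  ½ ^^ g * (x ^^ (n ℕ.% e) * (x ^^ e) ^^ q) ≤⟨ *-monoʳ (0≤^^ g 0≤½) (*-mono (0≤^^ (n ℕ.% e) 0≤x) (0≤^^ q (0≤^^ g 0≤½)) (^^≤1 (n ℕ.% e) 0≤x x≤1) (^^-mono q (0≤^^ e 0≤x) x^e≤)) ⟩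
  ½ ^^ g * (1ℚ * (½ ^^ g) ^^ q)  ≡⟨ cong (½ ^^ g *_) (ℚₚ.*-identityˡ ((½ ^^ g) ^^ q)) ⟩
  (½ ^^ g) ^^ suc q  ≡⟨ sym (^^-* ½ g (suc q)) ⟩
  ½ ^^ (suc q ℕ.* g)  ∎
  where
  open ℚₚ.≤-Reasoning
  q = n ℕ./ e

^ℚ≡^^ : ∀ x n → x ^ℚ n ≡ x ^^ n
^ℚ≡^^ x zero    = refl
^ℚ≡^^ x (suc n) = cong (x *_) (^ℚ≡^^ x n)

enough : ∀ n → n ℕ.* 136 ℕ.≤ 245 ℕ.* (suc (n ℕ./ 245) ℕ.* 136)
enough n = ℕₚ.≤-trans (ℕₚ.*-monoˡ-≤ 136 (ℕₚ.≤-trans (ℕₚ.≤-reflexive (ℕ.m≡m%n+[m/n]*n n 245))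
  (ℕₚ.+-monoˡ-≤ (n ℕ./ 245 ℕ.* 245) (ℕₚ.<⇒≤ (ℕ.m%n<n n 245))))) (ℕₚ.≤-reflexive (lemma (suc (n ℕ./ 245)) 245 136))
  where
  lemma : ∀ a b c → a ℕ.* b ℕ.* c ≡ b ℕ.* (a ℕ.* c)
  lemma = ℕ-Solver.solve-∀

abstract
  c₀ : ℚ
  c₀ = ½ ^^ 136

  0<c₀ : 0ℚ < c₀
  0<c₀ = ½^-positive 136

  c₀-rate : ∀ n → c₀ * (ℤ.+ 100000 / 146928) ^^ n ≤ ½ ^^ (suc (n ℕ./ 245) ℕ.* 136)
  c₀-rate = rate (ℤ.+ 100000 / 146928) 245 136 (ℚₚ.≤ᵇ⇒≤ tt) (ℚₚ.≤ᵇ⇒≤ tt)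
    (power-≤ (ℤ.+ 100000 / 146928) 100000 146928 245 136 {{ℕₚ.m^n≢0 146928 245}} (/-natℚ 100000 146928)
      (ℕₚ.≤ᵇ⇒≤ (100000 ^ 245 ℕ.* 2 ^ 136) (146928 ^ 245) tt))

-- Running time and success probability combined

module Main (d b R : ℕ) (σ : ℚ) (params : Admissible d (½ ^^ b) R σ) where

  time : Polynomial (λ n → algorithmTime d b R n (wordCount 4 n))
  time = polynomial-algorithm (polynomial-words 4) d b R

  f : ℕ → ℕ
  f = exponent (proj₁ time)

  module _ {n} (F : CNF n) (short : Is 4 -CNF F) where

    open Outcome F
    open Execution goal
    open WholeRun goal (clauses F) short (wordCount 4 n) (clause-count F short) (occurs F) d b using (algorithm-achieves)

    fast : algorithmTime d b R n (wordCount 4 n) ℕ.≤ 2 ^ f n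
    fast = polynomial≤2^exponent time n

    halts : (ω : Vec Bool (2 ^ f n)) → Halted (run (algorithm d b R) ⌜ F ⌝ ω)
    halts = achieves-halts (algorithm-achieves R) fast

    succeeds : Satisfiable F → ∀ {c x} → c * x ^^ n ≤ ½ ^^ (suc (n ℕ./ 245) ℕ.* 136) →
               c * x ^ℚ n ≤ successProbability (algorithm d b R) F (2 ^ f n)
    succeeds (α , α⊨) {c} {x} c-rate = begin
      c * x ^ℚ n  ≡⟨ cong (c *_) (^ℚ≡^^ x n) ⟩
      c * x ^^ n  ≤⟨ c-rate ⟩
      ½ ^^ (suc (n ℕ./ 245) ℕ.* 136)  ≤⟨ Satisfied.success≥ F short {d} {b} {R} {σ} params α⊨ (suc (n ℕ./ 245) ℕ.* 136) (enough n) ⟩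
      _  ≡⟨ sym (achieves-value (algorithm-achieves R) fast) ⟩
      value (2 ^ f n) (body (algorithm d b R) ∷ [] , ⌜ F ⌝ ∷ replicate 16 nil)
                                                             ≡⟨ sym (successProbability≡value d b R (2 ^ f n)) ⟩
      successProbability (algorithm d b R) F (2 ^ f n)  ∎
      where open ℚₚ.≤-Reasoning

conclusion : Parameters → ∀ {c} → 0ℚ < c →
  (∀ n → c * (ℤ.+ 100000 / 146928) ^^ n ≤ ½ ^^ (suc (n ℕ./ 245) ℕ.* 136)) →
  ∃[ P ] ∃[ f ] ∃[ c ]
    Sublinear f
    × RunsInTime P (λ F → Is 4 -CNF F) (λ n → 2 ^ f n)
    × 0ℚ < c
    × (∀ {n} (F : CNF n) → Is 4 -CNF F → Satisfiable F →
         c * (ℤ.+ 100000 / 146928) ^ℚ n ≤ successProbability P F (2 ^ f n))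
conclusion (d , b , R , σ , params) {c} 0<c c-rate =
  algorithm d b R , f , c , exponent-sublinear (proj₁ time) , halts , 0<c ,
  λ {n} F short sat → succeeds F short sat {c} {ℤ.+ 100000 / 146928} (c-rate n)
  where open Main d b R σ params

open import Data.Integer using (+_)

theorem5 : ∃[ P ] ∃[ f ] ∃[ c ]
    Sublinear f
    × RunsInTime P (λ F → Is 4 -CNF F) (λ n → 2 ^ f n)
    × 0ℚ < c
    × (∀ {n} (F : CNF n) → Is 4 -CNF F → Satisfiable F →
    c * (+ 100000 / 146928) ^ℚ n ≤ successProbability P F (2 ^ f n))
theorem5 = conclusion parameters 0<c₀ c₀-rate
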